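{- Let $\pi=(d_1\le\cdots\le d_n)$ be a graphical sequence with $n\ge3$. Suppose that (a) for every integer $i$ with $1\le i<\tfrac12 n$: if $d_i\le i$ then $d_{n-i}\ge n-i$; and (b) if $n$ is even, then $d_n\ge\tfrac12n+1$. Then every realization of $\pi$ is pancyclic. Moreover, this condition is weakly optimal: if $\pi$ fails (a) for some $i$ then $\pi$ is majorized by the degree sequence of $K_i+(\overline{K_i}\cup K_{n-2i})$, which has no $n$-cycle, and if $\pi$ fails (b) then $\pi$ is majorized by the degree sequence of $K_{n/2,n/2}$, which is not pancyclic.
   Context: Graphs are finite and simple. A graphical sequence is a nondecreasing integer sequence that is the degree sequence of some graph (a realization). Majorization: $(d_i')\ge(d_i)$ iff $d_i'\ge d_i$ for all $i$. A graph on $n$ vertices is pancyclic if it contains a cycle of length $l$ for every $3\le l\le n$. $G\cup H$ is disjoint union, $G+H$ is the join, $\overline{K_i}$ is the edgeless graph on $i$ vertices. -}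

module Defs where

open import Data.Bool.Base using (Bool; true; false; not; T)
open import Data.Fin.Base using (Fin; toℕ; fromℕ<; splitAt)
import Data.Fin.Base as Fin
open import Data.Fin.Permutation using (Permutation′; _⟨$⟩ʳ_)
open import Data.Fin.Properties using (_≟_)
open import Data.Fin.Subset using (Subset; ∣_∣)
open import Data.Nat.Base using (ℕ; suc; _+_; _*_; _∸_; _/_; _≤_; _<_; _≥_)
open import Data.Nat.Divisibility using (_∣_)
open import Data.Nat.Properties
  using (≤-refl; <⇒≤; m≤m+n; m∸n≤m; m<n⇒0<n∸m; ≤-<-trans)
open import Data.Product.Base using (_×_; ∃-syntax; Σ-syntax)
open import Data.Sum.Base using (_⊎_; inj₁; inj₂)
open import Data.Vec.Base using (Vec; lookup; tabulate)
open import Data.Vec.Relation.Binary.Pointwise.Inductive using (Pointwise)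
open import Function.Definitions using (Injective)
open import Relation.Binary.PropositionalEquality using (_≡_; refl; sym)
open import Relation.Nullary.Decidable using (does; yes; no)
open import Relation.Nullary.Negation using (contradiction)

record Graph (n : ℕ) : Set where
  field
    adj        : Fin n → Fin n → Bool
    adj-sym    : ∀ u v → adj u v ≡ adj v u
    adj-irrefl : ∀ v → adj v v ≡ false

  Adjacent : Fin n → Fin n → Set
  Adjacent u v = T (adj u v)

  neighbours : Fin n → Subset n
  neighbours v = tabulate (adj v)

  degree : Fin n → ℕ
  degree v = ∣ neighbours v ∣

open Graph public

-- A cycle of length l is given by its l distinct vertices
-- vertex 0, …, vertex (l - 1), listed in cyclic order.

record Cycle {n : ℕ} (G : Graph n) (l : ℕ) : Set where
  field
    3≤length : 3 ≤ l
    vertex   : Fin l → Fin n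
    distinct : Injective _≡_ _≡_ vertex
    step     : ∀ i j → toℕ j ≡ suc (toℕ i) → Adjacent G (vertex i) (vertex j)
    closing  : ∀ i j → suc (toℕ i) ≡ l → toℕ j ≡ 0 → Adjacent G (vertex i) (vertex j)

Pancyclic : ∀ {n} → Graph n → Set
Pancyclic {n} G = ∀ l → 3 ≤ l → l ≤ n → Cycle G l

complete : ∀ n → Graph n
complete n .adj u v = not (does (u ≟ v))
complete n .adj-sym u v with u ≟ v | v ≟ u
... | yes _   | yes _   = refl
... | no _    | no _    = refl
... | yes u≡v | no v≢u  = contradiction (sym u≡v) v≢u
... | no u≢v  | yes v≡u = contradiction (sym v≡u) u≢v
complete n .adj-irrefl v with v ≟ v
... | yes _  = refl
... | no v≢v = contradiction refl v≢v

edgeless : ∀ n → Graph n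
edgeless n .adj u v      = false
edgeless n .adj-sym u v  = refl
edgeless n .adj-irrefl v = refl

-- G and H side by side on Fin m ⊎ Fin n ≅ Fin (m + n), where every pair of a
-- vertex of G and a vertex of H is adjacent or not according to the flag.

module _ (cross : Bool) {m n : ℕ} (G : Graph m) (H : Graph n) where

  adj⊎ : Fin m ⊎ Fin n → Fin m ⊎ Fin n → Bool
  adj⊎ (inj₁ u) (inj₁ v) = adj G u v
  adj⊎ (inj₂ u) (inj₂ v) = adj H u v
  adj⊎ (inj₁ _) (inj₂ _) = cross
  adj⊎ (inj₂ _) (inj₁ _) = cross

  adj⊎-sym : ∀ x y → adj⊎ x y ≡ adj⊎ y x
  adj⊎-sym (inj₁ u) (inj₁ v) = adj-sym G u v
  adj⊎-sym (inj₂ u) (inj₂ v) = adj-sym H u v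
  adj⊎-sym (inj₁ _) (inj₂ _) = refl
  adj⊎-sym (inj₂ _) (inj₁ _) = refl

  adj⊎-irrefl : ∀ x → adj⊎ x x ≡ false
  adj⊎-irrefl (inj₁ v) = adj-irrefl G v
  adj⊎-irrefl (inj₂ v) = adj-irrefl H v

  combine : Graph (m + n)
  combine .adj u v      = adj⊎ (splitAt m u) (splitAt m v)
  combine .adj-sym u v  = adj⊎-sym (splitAt m u) (splitAt m v)
  combine .adj-irrefl v = adj⊎-irrefl (splitAt m v)

disjointUnion : ∀ {m n} → Graph m → Graph n → Graph (m + n)
disjointUnion = combine false

join : ∀ {m n} → Graph m → Graph n → Graph (m + n)
join = combine true

completeBipartite : ∀ m n → Graph (m + n)
completeBipartite m n = join (edgeless m) (edgeless n)

Nondecreasing : ∀ {n} → Vec ℕ n → Set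
Nondecreasing π = ∀ i j → i Fin.≤ j → lookup π i ≤ lookup π j

-- Also read as: G is a realization of π. For given G there is exactly one such π.

DegreeSequence : ∀ {n} → Graph n → Vec ℕ n → Set
DegreeSequence {n} G π =
  Nondecreasing π ×
  (Σ[ σ ∈ Permutation′ n ] (∀ i → lookup π i ≡ degree G (σ ⟨$⟩ʳ i)))

Graphical : ∀ {n} → Vec ℕ n → Set
Graphical {n} π = ∃[ G ] DegreeSequence {n} G π

-- Pointwise relates only vectors of equal length; allowing m and n to differ
-- syntactically avoids transporting along equations such as i + (i + (n ∸ 2 * i)) ≡ n.

infix 4 _≽_

_≽_ : ∀ {m n} → Vec ℕ m → Vec ℕ n → Set
π′ ≽ π = Pointwise _≥_ π′ π

MajorizedByDegreesOf : ∀ {m n} → Vec ℕ n → Graph m → Set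
MajorizedByDegreesOf {m} π H = Σ[ π′ ∈ Vec ℕ m ] (DegreeSequence H π′ × π′ ≽ π)

-- term π i is the i-th entry dᵢ of π = (d₁, …, dₙ), counting from 1.

term : ∀ {n} → Vec ℕ n → (i : ℕ) → .(1 ≤ i) → .(i ≤ n) → ℕ
term π (suc i) _ i<n = lookup π (fromℕ< i<n)

-- 1 ≤ i < n / 2, with n / 2 the exact half (not rounded down).

record BelowHalf (n i : ℕ) : Set where
  constructor mkBelowHalf
  field
    1≤i  : 1 ≤ i
    2i<n : 2 * i < n

  i<n : i < n
  i<n = ≤-<-trans (m≤m+n i _) 2i<n

  1≤n∸i : 1 ≤ n ∸ i
  1≤n∸i = m<n⇒0<n∸m i<n

ConditionA : ∀ {n} → Vec ℕ n → (i : ℕ) → BelowHalf n i → Set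
ConditionA {n} π i r =
  term π i 1≤i (<⇒≤ i<n) ≤ i → term π (n ∸ i) 1≤n∸i (m∸n≤m n i) ≥ n ∸ i
  where open BelowHalf r

ConditionB : ∀ {n} → Vec ℕ n → 1 ≤ n → Set
ConditionB {n} π 1≤n = 2 ∣ n → term π n 1≤n ≤-refl ≥ n / 2 + 1

{-# OPTIONS --safe #-}
module Submission where

-- The condition on π is Chvátal's, so every realization G has a Hamiltonian cycle: if uv is a
-- non-edge of maximal degree sum, the condition makes that sum at least n, and then G + uv is
-- Hamiltonian only if G is.
--
-- Let x and y be neighbours on a Hamiltonian cycle C, and suppose that G has no cycle of length l.
-- The possible chords at x and at y fall into n − 2 pairs, one chord at x and one at y, such that
-- the two chords of a pair close a cycle of length l together with C; hence d(x) + d(y) ≤ n.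
-- If d(x) + d(y) = n and l ≤ n − 2, each pair contains exactly one edge, and excluding a few more
-- shapes of cycles leaves only one possibility: x is adjacent to every second vertex of C and y to
-- the others.  In that situation n is even, and any edge between two vertices at even distance on C
-- gives cycles of all lengths; a vertex of degree more than n / 2, which (b) provides, has such an edge.
--
-- It remains to find x and y.  For odd n the condition gives consecutive x and y with
-- d(x) + d(y) > n.  For n = 2h, either at least h vertices have degree at least h + 1, or more than
-- h vertices have degree at least h.  In the first case two such vertices are consecutive or the
-- large vertices are exactly every second vertex of C, in the second some four consecutive vertices
-- of C contain three large ones; both settle the length l = n − 1 as well, because two vertices at
-- distance 2 on C have degree sum at most n if there is no cycle of length n − 1.

open import Data.Bool.Base using (Bool; true; false; not; _∧_; _∨_; _xor_; T; if_then_else_)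
import Data.Bool.Properties as Boolₚ
open import Data.Bool.Properties using (T?; not-involutive; ∧-identityʳ; ∧-zeroʳ; ∨-comm; ∨-idem; ∨-zeroʳ)
open import Data.Empty using (⊥; ⊥-elim)
open import Data.Fin.Base using (Fin; zero; suc; toℕ; fromℕ<; splitAt; _↑ˡ_; _↑ʳ_)
import Data.Fin.Base as Fin
open import Data.Fin.Permutation using (Permutation; Permutation′; _⟨$⟩ʳ_; _⟨$⟩ˡ_; permutation; inverseˡ; cast-id; _∘ₚ_)
  renaming (id to idₚ)
import Data.Fin.Properties as Finₚ
open import Data.Fin.Subset using (∣_∣)
open import Data.List.Base using ([]; _∷_)
open import Data.Nat using (ℕ; zero; suc; _+_; _*_; _∸_; _/_; _%_; _≤_; _<_; _≥_; z≤n; s≤s; _≤?_; _<?_; _≤ᵇ_)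
import Data.Nat as ℕ
open import Data.Nat.Divisibility using (_∣_; divides; _∣?_; ∣m+n∣m⇒∣n; ∣1⇒≡1; m%n≡0⇒n∣m)
open import Data.Nat.DivMod using (_mod_; m≡m%n+[m/n]*n; m%n<n; m<n⇒m%n≡m; [m+n]%n≡m%n; [m+kn]%n≡m%n; n%n≡0; m*n/n≡m)
open import Data.Nat.Induction using (<-wellFounded)
open import Data.Nat.Properties
open import Data.Nat.Tactic.RingSolver using (solve)
open import Data.Product using (_×_; _,_; proj₁; proj₂; ∃; ∃-syntax)
open import Data.Sum as Sum using (_⊎_; inj₁; inj₂; [_,_]′)
open import Data.Sum.Properties using (swap-involutive)
open import Data.Vec using (Vec; lookup; tabulate) renaming ([] to []ᵛ; _∷_ to _∷ᵛ_; _++_ to _++ᵛ_)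
import Data.Vec.Properties as Vecₚ
open import Data.Vec.Relation.Unary.All as All using (All)
import Data.Vec.Relation.Unary.All.Properties as Allₚ
open import Data.Vec.Relation.Unary.AllPairs as AllPairs using (AllPairs)
import Data.Vec.Relation.Unary.AllPairs.Properties as AllPairsₚ
open import Data.Vec.Relation.Unary.Unique.Propositional.Properties using (lookup-injective)
open import Data.Vec.Relation.Binary.Pointwise.Inductive as Pointwise using (Pointwise)
open import Function using (_∘_; id; case_of_)
open import Induction.WellFounded using (Acc; acc)
open import Relation.Binary.Definitions using (Tri; tri<; tri≈; tri>)
open import Relation.Binary.PropositionalEquality using (_≡_; _≢_; refl; sym; trans; cong; cong₂;
  subst; subst₂; module ≡-Reasoning)
open import Relation.Nullary using (¬_; Dec; yes; no; does; contradiction)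
open import Relation.Nullary.Decidable using (dec-true; dec-false; map′; _×-dec_; _→-dec_; ¬?; decidable-stable)
open import Defs

-- Write l = c + 3 and n = c + t + 3, so that a cycle of length l omits t vertices. They can be
-- taken from the two ends of v_1 ... v_N (chords x v_i and y v_(i+c), closed by the edge xy) or as
-- one inner block (chords y v_k and x v_(k+t+1)); these are the n - 2 pairs. If every pair is
-- tight, the chords at y are determined by those at x, and a single Boolean sequence `a` remains to
-- be understood. For c ≤ t this sequence turns out to have period c. For t < c the place of the
-- period is taken by a step s by which neighbours of x beyond v_(t+1) can be moved; the least such
-- s is shown to be 2. The obstacle is t = 1, that is l = n - 1. There tightness yields just a
-- recursion that mixes the chords at x with those at y, and a third vertex of degree at least n / 2
-- close to x and y disentangles it. This is why the argument for even n asks for more than one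
-- heavy edge.

-- Linear arithmetic and sums over positions

infixl 5 _⊕_
_⊕_ : ∀ {a b c d} → a ≤ b → c ≤ d → a + c ≤ b + d
_⊕_ = +-mono-≤

-- A certificate check for linear arithmetic: the hypotheses are added up to `L ≤ R`, `s` is the
-- slack, and the identity that remains is left to the ring solver.
linear : ∀ {L R a b} → L ≤ R → ∀ s → a + R + s ≡ b + L → a ≤ b
linear {L} {R} {a} {b} L≤R s eq = +-cancelʳ-≤ R a b (begin
  a + R     ≤⟨ m≤m+n (a + R) s ⟩
  a + R + s ≡⟨ eq ⟩
  b + L     ≤⟨ +-monoʳ-≤ b L≤R ⟩
  b + R     ∎)
  where open ≤-Reasoning

true≢false : ∀ {b} → b ≡ true → b ≡ false → ⊥
true≢false refl ()

⟦_⟧ : Bool → ℕ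
⟦ true ⟧  = 1
⟦ false ⟧ = 0

⟦⟧≤1 : ∀ b → ⟦ b ⟧ ≤ 1
⟦⟧≤1 true  = s≤s z≤n
⟦⟧≤1 false = z≤n

⟦not⟧ : ∀ b → ⟦ b ⟧ + ⟦ not b ⟧ ≡ 1
⟦not⟧ true  = refl
⟦not⟧ false = refl

exclusive⇒≤1 : ∀ x y → (x ≡ true → y ≡ true → ⊥) → ⟦ x ⟧ + ⟦ y ⟧ ≤ 1
exclusive⇒≤1 true  true  ¬xy = ⊥-elim (¬xy refl refl)
exclusive⇒≤1 true  false _   = s≤s z≤n
exclusive⇒≤1 false y     _   = ⟦⟧≤1 y

≡1⇒not : ∀ x y → ⟦ x ⟧ + ⟦ y ⟧ ≡ 1 → y ≡ not x
≡1⇒not true  false _ = refl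
≡1⇒not false true  _ = refl

Σ< : ℕ → (ℕ → ℕ) → ℕ
Σ< zero    f = 0
Σ< (suc n) f = Σ< n f + f n

Σ<-mono : ∀ n {f g} → (∀ i → i < n → f i ≤ g i) → Σ< n f ≤ Σ< n g
Σ<-mono zero    f≤g = z≤n
Σ<-mono (suc n) f≤g = Σ<-mono n (λ i i<n → f≤g i (m<n⇒m<1+n i<n)) ⊕ f≤g n ≤-refl

Σ<-cong : ∀ n {f g} → (∀ i → i < n → f i ≡ g i) → Σ< n f ≡ Σ< n g
Σ<-cong zero    f≡g = refl
Σ<-cong (suc n) f≡g = cong₂ _+_ (Σ<-cong n (λ i i<n → f≡g i (m<n⇒m<1+n i<n))) (f≡g n ≤-refl)

Σ<-tight : ∀ n {f g} → (∀ i → i < n → f i ≤ g i) → Σ< n g ≤ Σ< n f → ∀ i → i < n → f i ≡ g i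
Σ<-tight (suc n) {f} {g} f≤g Σg≤Σf i i<1+n = case m≤n⇒m<n∨m≡n (≤-pred i<1+n) of λ where
    (inj₁ i<n)  → Σ<-tight n f≤g′ (rest (Σ< n f) (Σ< n g) (f n) (g n) Σg≤Σf (f≤g n ≤-refl)) i i<n
    (inj₂ refl) → ≤-antisym (f≤g n ≤-refl) (last (Σ< n f) (Σ< n g) (f n) (g n) Σg≤Σf (Σ<-mono n f≤g′))
  where
  f≤g′ : ∀ i → i < n → f i ≤ g i
  f≤g′ i i<n = f≤g i (m<n⇒m<1+n i<n)
  rest : ∀ F G x y → G + y ≤ F + x → x ≤ y → G ≤ F
  rest F G x y h x≤y = linear (h ⊕ x≤y) 0 (solve (F ∷ G ∷ x ∷ y ∷ []))
  last : ∀ F G x y → G + y ≤ F + x → F ≤ G → y ≤ x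
  last F G x y h F≤G = linear (h ⊕ F≤G) 0 (solve (F ∷ G ∷ x ∷ y ∷ []))

Σ<-+ : ∀ n f g → Σ< n (λ i → f i + g i) ≡ Σ< n f + Σ< n g
Σ<-+ zero    f g = refl
Σ<-+ (suc n) f g = trans (cong (_+ (f n + g n)) (Σ<-+ n f g)) (interchange (Σ< n f) (Σ< n g) (f n) (g n))
  where
  interchange : ∀ a b c d → a + b + (c + d) ≡ a + c + (b + d)
  interchange a b c d = solve (a ∷ b ∷ c ∷ d ∷ [])

Σ<-split : ∀ m n f → Σ< (m + n) f ≡ Σ< m f + Σ< n (λ i → f (m + i))
Σ<-split m zero    f = trans (cong (λ k → Σ< k f) (+-identityʳ m)) (sym (+-identityʳ _))
Σ<-split m (suc n) f = begin
  Σ< (m + suc n) f                                      ≡⟨ cong (λ k → Σ< k f) (+-suc m n) ⟩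
  Σ< (m + n) f + f (m + n)                              ≡⟨ cong (_+ f (m + n)) (Σ<-split m n f) ⟩
  Σ< m f + Σ< n (λ i → f (m + i)) + f (m + n)           ≡⟨ +-assoc (Σ< m f) _ _ ⟩
  Σ< m f + (Σ< n (λ i → f (m + i)) + f (m + n))         ∎
  where open ≡-Reasoning

Σ<-const : ∀ n c → Σ< n (λ _ → c) ≡ n * c
Σ<-const zero    c = refl
Σ<-const (suc n) c = trans (cong (_+ c) (Σ<-const n c)) (+-comm (n * c) c)

Σ<-exists : ∀ n (f : ℕ → Bool) → 0 < Σ< n (⟦_⟧ ∘ f) → ∃[ i ] (i < n × f i ≡ true)
Σ<-exists (suc n) f 0<Σ with f n in fn
... | true  = n , ≤-refl , fn
... | false =
  let i , i<n , fi = Σ<-exists n f (subst (0 <_) (+-identityʳ _) 0<Σ) in i , m<n⇒m<1+n i<n , fi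

Σ<-meet : ∀ n (f g : ℕ → Bool) → n < Σ< n (⟦_⟧ ∘ f) + Σ< n (⟦_⟧ ∘ g) →
          ∃[ i ] (i < n × f i ≡ true × g i ≡ true)
Σ<-meet n f g n<Σ with Σ<-exists n (λ i → f i ∧ g i) (+-cancelˡ-< n _ _ bound)
  where
  ⟦∧⟧ : ∀ x y → ⟦ x ⟧ + ⟦ y ⟧ ≤ 1 + ⟦ x ∧ y ⟧
  ⟦∧⟧ true  y = ≤-refl
  ⟦∧⟧ false y = ≤-trans (⟦⟧≤1 y) (s≤s z≤n)
  open ≤-Reasoning
  bound : n + 0 < n + Σ< n (λ i → ⟦ f i ∧ g i ⟧)
  bound = begin-strict
    n + 0                                     ≡⟨ +-identityʳ n ⟩
    n                                         <⟨ n<Σ ⟩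
    Σ< n (⟦_⟧ ∘ f) + Σ< n (⟦_⟧ ∘ g)            ≡⟨ Σ<-+ n _ _ ⟨
    Σ< n (λ i → ⟦ f i ⟧ + ⟦ g i ⟧)            ≤⟨ Σ<-mono n (λ i _ → ⟦∧⟧ (f i) (g i)) ⟩
    Σ< n (λ i → 1 + ⟦ f i ∧ g i ⟧)            ≡⟨ Σ<-+ n _ _ ⟩
    Σ< n (λ _ → 1) + Σ< n (λ i → ⟦ f i ∧ g i ⟧)
      ≡⟨ cong (_+ Σ< n (λ i → ⟦ f i ∧ g i ⟧)) (trans (Σ<-const n 1) (*-identityʳ n)) ⟩
    n + Σ< n (λ i → ⟦ f i ∧ g i ⟧)            ∎
... | i , i<n , fgi = i , i<n , ∧-true (f i) (g i) fgi
  where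
  ∧-true : ∀ x y → x ∧ y ≡ true → x ≡ true × y ≡ true
  ∧-true true true _ = refl , refl

-- Sums over vertices; Σ< above sums over positions on a cycle.

∑ : ∀ {n} → (Fin n → ℕ) → ℕ
∑ {zero}  f = 0
∑ {suc n} f = f zero + ∑ (f ∘ suc)

∑-mono : ∀ {n} {f g : Fin n → ℕ} → (∀ v → f v ≤ g v) → ∑ f ≤ ∑ g
∑-mono {zero}  f≤g = z≤n
∑-mono {suc n} f≤g = f≤g zero ⊕ ∑-mono (f≤g ∘ suc)

∑-mono-< : ∀ {n} {f g : Fin n → ℕ} → (∀ v → f v ≤ g v) → ∀ u → f u < g u → ∑ f < ∑ g
∑-mono-< f≤g zero    fu<gu = fu<gu ⊕ ∑-mono (f≤g ∘ suc)
∑-mono-< f≤g (suc u) fu<gu = +-mono-≤-< (f≤g zero) (∑-mono-< (f≤g ∘ suc) u fu<gu)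

-- Counting vertices

cnt : ∀ {n} → (Fin n → Bool) → ℕ
cnt f = ∑ (⟦_⟧ ∘ f)

_≡ᵇ_ : ∀ {n} → Fin n → Fin n → Bool
u ≡ᵇ v = does (u Finₚ.≟ v)

≡ᵇ-refl : ∀ {n} (v : Fin n) → (v ≡ᵇ v) ≡ true
≡ᵇ-refl v = dec-true (v Finₚ.≟ v) refl

≡ᵇ-false : ∀ {n} {u v : Fin n} → u ≢ v → (u ≡ᵇ v) ≡ false
≡ᵇ-false {u = u} {v} = dec-false (u Finₚ.≟ v)

∣tabulate∣ : ∀ {n} (f : Fin n → Bool) → ∣ tabulate f ∣ ≡ cnt f
∣tabulate∣ {zero}  f = refl
∣tabulate∣ {suc n} f with f zero
... | true  = cong suc (∣tabulate∣ (f ∘ suc))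
... | false = ∣tabulate∣ (f ∘ suc)

cnt-cong : ∀ {n} {f g : Fin n → Bool} → (∀ v → f v ≡ g v) → cnt f ≡ cnt g
cnt-cong {zero}  f≡g = refl
cnt-cong {suc n} f≡g = cong₂ _+_ (cong ⟦_⟧ (f≡g zero)) (cnt-cong (f≡g ∘ suc))

⟦⟧-mono : ∀ {x y} → (x ≡ true → y ≡ true) → ⟦ x ⟧ ≤ ⟦ y ⟧
⟦⟧-mono {false} _ = z≤n
⟦⟧-mono {true} x⇒y rewrite x⇒y refl = ≤-refl

cnt-mono : ∀ {n} {f g : Fin n → Bool} → (∀ v → f v ≡ true → g v ≡ true) → cnt f ≤ cnt g
cnt-mono f⇒g = ∑-mono (λ v → ⟦⟧-mono (f⇒g v))

_without_ : ∀ {n} → (Fin n → Bool) → Fin n → Fin n → Bool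
(f without q) v = f v ∧ not (v ≡ᵇ q)

cnt-without : ∀ {n} (f : Fin n → Bool) q → cnt f ≡ ⟦ f q ⟧ + cnt (f without q)
cnt-without {suc n} f zero = cong (⟦ f zero ⟧ +_) (begin
    cnt (f ∘ suc)                                       ≡⟨ cnt-cong (λ v → sym (∧-identityʳ (f (suc v)))) ⟩
    cnt ((f without zero) ∘ suc)                        ≡⟨ cong (λ b → ⟦ b ⟧ + cnt ((f without zero) ∘ suc)) (∧-zeroʳ (f zero)) ⟨
    cnt (f without zero)                                ∎)
  where
  open ≡-Reasoning
cnt-without {suc n} f (suc q) = begin
    ⟦ f zero ⟧ + cnt (f ∘ suc)
      ≡⟨ cong (⟦ f zero ⟧ +_) (cnt-without (f ∘ suc) q) ⟩
    ⟦ f zero ⟧ + (⟦ f (suc q) ⟧ + cnt ((f ∘ suc) without q))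
      ≡⟨ swap ⟦ f zero ⟧ ⟦ f (suc q) ⟧ _ ⟩
    ⟦ f (suc q) ⟧ + (⟦ f zero ⟧ + cnt ((f ∘ suc) without q))
      ≡⟨ cong (λ b → ⟦ f (suc q) ⟧ + (⟦ b ⟧ + cnt ((f ∘ suc) without q))) (sym (∧-identityʳ (f zero))) ⟩
    ⟦ f (suc q) ⟧ + cnt (f without suc q) ∎
  where
  open ≡-Reasoning
  swap : ∀ a b c → a + (b + c) ≡ b + (a + c)
  swap a b c = solve (a ∷ b ∷ c ∷ [])

cnt-positive : ∀ {n} (f : Fin n → Bool) {v} → f v ≡ true → 0 < cnt f
cnt-positive f {v} fv = ≤-trans (≤-trans (≤-reflexive (cong ⟦_⟧ (sym fv))) (m≤m+n _ (cnt (f without v))))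
  (≤-reflexive (sym (cnt-without f v)))

cnt-not : ∀ {n} (f : Fin n → Bool) → cnt f + cnt (not ∘ f) ≡ n
cnt-not {zero}  f = refl
cnt-not {suc n} f = begin
    ⟦ f zero ⟧ + cnt (f ∘ suc) + (⟦ not (f zero) ⟧ + cnt (not ∘ f ∘ suc))
      ≡⟨ interchange ⟦ f zero ⟧ _ _ _ ⟩
    ⟦ f zero ⟧ + ⟦ not (f zero) ⟧ + (cnt (f ∘ suc) + cnt (not ∘ f ∘ suc))
      ≡⟨ cong₂ _+_ (⟦not⟧ (f zero)) (cnt-not (f ∘ suc)) ⟩
    suc n ∎
  where
  open ≡-Reasoning
  interchange : ∀ a b c d → a + b + (c + d) ≡ a + c + (b + d)
  interchange a b c d = solve (a ∷ b ∷ c ∷ d ∷ [])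

cnt-true : ∀ n → cnt {n} (λ _ → true) ≡ n
cnt-true zero    = refl
cnt-true (suc n) = cong suc (cnt-true n)

cnt-exists : ∀ {n} (f g : Fin n → Bool) → cnt f < cnt g → ∃[ v ] (f v ≡ false × g v ≡ true)
cnt-exists {suc n} f g f<g with f zero in f0 | g zero in g0
... | false | true  = zero , f0 , g0
... | true  | true  = let v , h = cnt-exists (f ∘ suc) (g ∘ suc) (≤-pred f<g) in suc v , h
... | false | false = let v , h = cnt-exists (f ∘ suc) (g ∘ suc) f<g in suc v , h
... | true  | false = let v , h = cnt-exists (f ∘ suc) (g ∘ suc) (<-trans (n<1+n _) f<g) in suc v , h

-- Vertices are enumerated by all of ℕ with injectivity only below n, so that arithmetic on
-- positions carries no bound proofs.
InjectiveBelow : ∀ {A : Set} → ℕ → (ℕ → A) → Set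
InjectiveBelow n p = ∀ {i j} → i < n → j < n → p i ≡ p j → i ≡ j

Σ<-injective-≤ : ∀ n {m} {p : ℕ → Fin m} → InjectiveBelow n p → ∀ f →
                 Σ< n (λ i → ⟦ f (p i) ⟧) ≤ cnt f
Σ<-injective-≤ zero    inj f = z≤n
Σ<-injective-≤ (suc n) {p = p} inj f = begin
    Σ< n (λ i → ⟦ f (p i) ⟧) + ⟦ f (p n) ⟧                 ≡⟨ cong (_+ ⟦ f (p n) ⟧) (Σ<-cong n unaffected) ⟩
    Σ< n (λ i → ⟦ (f without p n) (p i) ⟧) + ⟦ f (p n) ⟧   ≤⟨ +-monoˡ-≤ _ (Σ<-injective-≤ n inj′ (f without p n)) ⟩
    cnt (f without p n) + ⟦ f (p n) ⟧                      ≡⟨ +-comm (cnt (f without p n)) _ ⟩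
    ⟦ f (p n) ⟧ + cnt (f without p n)                      ≡⟨ cnt-without f (p n) ⟨
    cnt f                                                  ∎
  where
  open ≤-Reasoning
  inj′ : InjectiveBelow n p
  inj′ i<n j<n = inj (m<n⇒m<1+n i<n) (m<n⇒m<1+n j<n)
  unaffected : ∀ i → i < n → ⟦ f (p i) ⟧ ≡ ⟦ (f without p n) (p i) ⟧
  unaffected i i<n
    rewrite ≡ᵇ-false (λ pi≡pn → <-irrefl (inj (m<n⇒m<1+n i<n) ≤-refl pi≡pn) i<n) with f (p i)
  ... | true  = refl
  ... | false = refl

-- The inequality for `f` and the one for its complement add up to n on both sides, so neither can
-- be strict.
Σ<-injective : ∀ {n} {p : ℕ → Fin n} → InjectiveBelow n p → ∀ f → Σ< n (λ i → ⟦ f (p i) ⟧) ≡ cnt f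
Σ<-injective {n} {p} inj f = ≤-antisym (Σ<-injective-≤ n inj f)
    (+-cancelʳ-≤ (cnt (not ∘ f)) (cnt f) (Σ< n (λ i → ⟦ f (p i) ⟧)) (begin
      cnt f + cnt (not ∘ f)                                           ≡⟨ cnt-not f ⟩
      n                                                               ≡⟨ trans (Σ<-const n 1) (*-identityʳ n) ⟨
      Σ< n (λ _ → 1)                                                  ≡⟨ Σ<-cong n (λ i _ → sym (⟦not⟧ (f (p i)))) ⟩
      Σ< n (λ i → ⟦ f (p i) ⟧ + ⟦ not (f (p i)) ⟧)                     ≡⟨ Σ<-+ n _ _ ⟩
      Σ< n (λ i → ⟦ f (p i) ⟧) + Σ< n (λ i → ⟦ not (f (p i)) ⟧)        ≤⟨ +-monoʳ-≤ _ (Σ<-injective-≤ n inj (not ∘ f)) ⟩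
      Σ< n (λ i → ⟦ f (p i) ⟧) + cnt (not ∘ f)                        ∎))
  where open ≤-Reasoning

injective⇒surjective : ∀ {n} {p : ℕ → Fin n} → InjectiveBelow n p → ∀ v → ∃[ i ] (i < n × p i ≡ v)
injective⇒surjective {n} {p} inj v with Σ<-exists n (λ i → p i ≡ᵇ v) (begin-strict
    0                                     <⟨ s≤s z≤n ⟩
    1 + cnt ((_≡ᵇ v) without v)           ≡⟨ cong (λ b → ⟦ b ⟧ + cnt ((_≡ᵇ v) without v)) (≡ᵇ-refl v) ⟨
    ⟦ v ≡ᵇ v ⟧ + cnt ((_≡ᵇ v) without v)  ≡⟨ cnt-without (_≡ᵇ v) v ⟨
    cnt (_≡ᵇ v)                           ≡⟨ Σ<-injective inj (_≡ᵇ v) ⟨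
    Σ< n (λ i → ⟦ p i ≡ᵇ v ⟧)             ∎)
  where open ≤-Reasoning
... | i , i<n , eq with p i Finₚ.≟ v
...   | yes pi≡v = i , i<n , pi≡v

-- Walks and cycles

data Walk (E : ℕ → ℕ → Set) : (s f : ℕ) → ∀ {k} → Vec ℕ k → Set where
  stop : ∀ {s} → Walk E s s (s ∷ᵛ []ᵛ)
  _∷ʷ_ : ∀ {s u f k} {xs : Vec ℕ k} → E s u → Walk E u f xs → Walk E s f (s ∷ᵛ xs)

module _ {E : ℕ → ℕ → Set} where

  walk-++ : ∀ {s f s′ f′ k l} {xs : Vec ℕ k} {ys : Vec ℕ l} →
            Walk E s f xs → E f s′ → Walk E s′ f′ ys → Walk E s f′ (xs ++ᵛ ys)
  walk-++ stop    e w = e ∷ʷ w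
  walk-++ (d ∷ʷ v) e w = d ∷ʷ walk-++ v e w

  walk-first : ∀ {s f k} {xs : Vec ℕ k} → Walk E s f xs → ∀ i → toℕ i ≡ 0 → lookup xs i ≡ s
  walk-first stop    zero _ = refl
  walk-first (_ ∷ʷ _) zero _ = refl

  walk-last : ∀ {s f k} {xs : Vec ℕ k} → Walk E s f xs → ∀ i → suc (toℕ i) ≡ k → lookup xs i ≡ f
  walk-last stop     zero    _    = refl
  walk-last (_ ∷ʷ ()) zero    refl
  walk-last (_ ∷ʷ w)  (suc i) eq   = walk-last w i (suc-injective eq)

  walk-step : ∀ {s f k} {xs : Vec ℕ k} → Walk E s f xs →
              ∀ i j → toℕ j ≡ suc (toℕ i) → E (lookup xs i) (lookup xs j)
  walk-step (e ∷ʷ w) zero    (suc j) eq = subst (E _) (sym (walk-first w j (suc-injective eq))) e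
  walk-step (e ∷ʷ w) (suc i) (suc j) eq = walk-step w i j (suc-injective eq)

-- Paths and cycles through the vertices q 0, …, q M, which are identified with their positions.
-- Every cycle built below is glued from runs of consecutive positions, so that comparing the
-- ranges of the parts suffices to see that no vertex is repeated.

module Positions {n : ℕ} (G : Graph n) (q : ℕ → Fin n) (M : ℕ) (inj : InjectiveBelow (suc M) q) where

  E : ℕ → ℕ → Set
  E i j = Adjacent G (q i) (q j)

  -- The type keeps only the ends, the range and the number of positions: this decides what may be
  -- glued on and how long the resulting cycle is.
  record Trail (s f lo hi k : ℕ) : Set where
    constructor trail
    field
      {positions} : Vec ℕ k
      walk        : Walk E s f positions
      above       : All (lo ≤_) positions
      below       : All (_≤ hi) positions
      unique      : AllPairs _≢_ positions

  one : ∀ i → Trail i i i i 1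
  one i = trail stop (≤-refl All.∷ All.[]) (≤-refl All.∷ All.[]) (All.[] AllPairs.∷ AllPairs.[])

  private
    apart : ∀ {k l c d} {xs : Vec ℕ k} {ys : Vec ℕ l} → c < d →
            All (_≤ c) xs → All (d ≤_) ys → All (λ x → All (x ≢_) ys) xs
    apart c<d x≤c d≤y = All.map (λ i≤c → All.map (λ d≤j i≡j →
      <-irrefl i≡j (≤-<-trans i≤c (<-≤-trans c<d d≤j))) d≤y) x≤c

    apart′ : ∀ {k l c d} {xs : Vec ℕ k} {ys : Vec ℕ l} → d < c →
             All (c ≤_) xs → All (_≤ d) ys → All (λ x → All (x ≢_) ys) xs
    apart′ d<c c≤x y≤d = All.map (λ c≤i → All.map (λ j≤d i≡j →
      <-irrefl (sym i≡j) (≤-<-trans j≤d (<-≤-trans d<c c≤i))) y≤d) c≤x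

    lo≤hi : ∀ {s f lo hi k} → Trail s f lo hi k → lo ≤ hi
    lo≤hi (trail stop    (lo≤s All.∷ _) (s≤hi All.∷ _) _) = ≤-trans lo≤s s≤hi
    lo≤hi (trail (_ ∷ʷ _) (lo≤s All.∷ _) (s≤hi All.∷ _) _) = ≤-trans lo≤s s≤hi

  infixr 5 _▷⟨_,_⟩_ _◁⟨_,_⟩_

  _▷⟨_,_⟩_ : ∀ {s f s′ f′ lo hi lo′ hi′ k l} → Trail s f lo hi k → hi < lo′ → E f s′ →
             Trail s′ f′ lo′ hi′ l → Trail s f′ lo hi′ (k + l)
  t@(trail w a b u) ▷⟨ hi<lo′ , e ⟩ t′@(trail w′ a′ b′ u′) = trail (walk-++ w e w′)
    (Allₚ.++⁺ a (All.map (≤-trans (≤-trans (lo≤hi t) (<⇒≤ hi<lo′))) a′))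
    (Allₚ.++⁺ (All.map (λ i≤hi → ≤-trans i≤hi (≤-trans (<⇒≤ hi<lo′) (lo≤hi t′))) b) b′)
    (AllPairsₚ.++⁺ u u′ (apart hi<lo′ b a′))

  _◁⟨_,_⟩_ : ∀ {s f s′ f′ lo hi lo′ hi′ k l} → Trail s f lo hi k → hi′ < lo → E f s′ →
             Trail s′ f′ lo′ hi′ l → Trail s f′ lo′ hi (k + l)
  t@(trail w a b u) ◁⟨ hi′<lo , e ⟩ t′@(trail w′ a′ b′ u′) = trail (walk-++ w e w′)
    (Allₚ.++⁺ (All.map (≤-trans (≤-trans (lo≤hi t′) (<⇒≤ hi′<lo))) a) a′)
    (Allₚ.++⁺ b (All.map (λ i≤hi′ → ≤-trans i≤hi′ (≤-trans (<⇒≤ hi′<lo) (lo≤hi t))) b′))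
    (AllPairsₚ.++⁺ u u′ (apart′ hi′<lo a b′))

  module _ (link : ∀ i → i < M → E i (suc i)) where

    up : ∀ i k → i + k ≤ M → Trail i (i + k) i (i + k) (suc k)
    up i zero    _       = subst (λ j → Trail i j i j 1) (sym (+-identityʳ i)) (one i)
    up i (suc k) i+1+k≤M = subst₂ (λ j l → Trail i j i j l) (sym (+-suc i k)) (+-comm (suc k) 1)
      (up i k (<⇒≤ i+k<M) ▷⟨ ≤-refl , link (i + k) i+k<M ⟩ one (suc (i + k)))
      where
      i+k<M : i + k < M
      i+k<M = subst (_≤ M) (+-suc i k) i+1+k≤M

    down : ∀ i k → i + k ≤ M → Trail (i + k) i i (i + k) (suc k)
    down i zero    _       = subst (λ j → Trail j i i j 1) (sym (+-identityʳ i)) (one i)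
    down i (suc k) i+1+k≤M = subst (λ j → Trail j i i j (suc (suc k))) (sym (+-suc i k))
      (one (suc (i + k)) ◁⟨ ≤-refl , subst T (adj-sym G _ _) (link (i + k) i+k<M) ⟩ down i k (<⇒≤ i+k<M))
      where
      i+k<M : i + k < M
      i+k<M = subst (_≤ M) (+-suc i k) i+1+k≤M

  close : ∀ {s f lo hi k l} → Trail s f lo hi k → hi ≤ M → E f s → 3 ≤ l → k ≡ l → Cycle G l
  close {s} {f} {k = k} (trail {positions} w _ b u) hi≤M e 3≤k refl = record
    { 3≤length = 3≤k
    ; vertex   = λ i → q (lookup positions i)
    ; distinct = λ {i} {j} eq → lookup-injective u i j
        (inj (s≤s (≤-trans (Allₚ.lookup⁺ b i) hi≤M)) (s≤s (≤-trans (Allₚ.lookup⁺ b j) hi≤M)) eq)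
    ; step     = walk-step w
    ; closing  = λ i j last first → subst₂ E (sym (walk-last w i last)) (sym (walk-first w j first)) e
    }

-- Missing cycle lengths

odd : ℕ → Bool
odd zero    = false
odd (suc n) = not (odd n)

odd-+ : ∀ m n → odd (m + n) ≡ odd m xor odd n
odd-+ zero    n = refl
odd-+ (suc m) n rewrite odd-+ m n with odd m
... | true  = not-involutive (odd n)
... | false = refl

odd-+-even : ∀ i {c} → odd c ≡ false → odd (i + c) ≡ odd i
odd-+-even zero    even-c = even-c
odd-+-even (suc i) even-c = cong not (odd-+-even i even-c)

same-parity : ∀ {m n} → m ≤ n → odd m ≡ odd n → ∃[ k ] m + k * 2 ≡ n
same-parity {m} {n} m≤n eq with m≤n⇒∃[o]m+o≡n m≤n
... | o , refl = let k , o≡ = half o (cancel (odd m) (odd o) (trans eq (odd-+ m o)))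
                 in k , cong (m +_) (sym o≡)
  where
  cancel : ∀ x y → x ≡ x xor y → y ≡ false
  cancel true  false _ = refl
  cancel true  true  ()
  cancel false false _ = refl
  half : ∀ o → odd o ≡ false → ∃[ k ] o ≡ k * 2
  half zero          _  = 0 , refl
  half (suc (suc o)) eq =
    let k , o≡ = half o (trans (sym (not-involutive (odd o))) eq) in suc k , cong (λ i → suc (suc i)) o≡

≢true : ∀ {x} → (x ≡ true → ⊥) → x ≡ false
≢true {true}  h = ⊥-elim (h refl)
≢true {false} _ = refl

≢false : ∀ {x} → (x ≡ false → ⊥) → x ≡ true
≢false {false} h = ⊥-elim (h refl)
≢false {true}  _ = refl

not-flip : ∀ {x y} → y ≡ not x → x ≡ not y
not-flip {x} refl = sym (not-involutive x)

negated : ∀ {x y v} → y ≡ not x → x ≡ v → y ≡ not v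
negated eq refl = eq

move : ∀ {f : ℕ → Bool} {v i j} → i ≡ j → f i ≡ v → f j ≡ v
move refl h = h

-- With this order of the arguments the indices are known when a solver is called for i ≡ j.
move′ : ∀ {f : ℕ → Bool} {v i j} → f i ≡ v → i ≡ j → f j ≡ v
move′ h refl = h

last-true : ∀ (f : ℕ → Bool) i d → f i ≡ true → f (i + d) ≡ false →
            ∃[ k ] (i ≤ k × k < i + d × f k ≡ true × f (suc k) ≡ false)
last-true f i zero    fi ¬f = ⊥-elim (true≢false fi (move {f} (+-identityʳ i) ¬f))
last-true f i (suc d) fi ¬f with f (suc i) in fsi
... | false = i , ≤-refl , m<m+n i (s≤s z≤n) , fi , fsi
... | true  = let k , 1+i≤k , k< , fk , ¬fk = last-true f (suc i) d fsi (move {f} (+-suc i d) ¬f)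
              in k , <⇒≤ 1+i≤k , ≤-trans k< (≤-reflexive (sym (+-suc i d))) , fk , ¬fk

-- Let x = v₀, v₁, …, v_N, y = v_{N+1} be a Hamiltonian cycle of a graph on N + 2 = c + t + 3
-- vertices, and let a i and b i say whether v_i is adjacent to x and to y.  If there is no cycle of
-- length c + 3, then the following six kinds of cycles of that length are excluded.

record Missing (c t : ℕ) (a b : ℕ → Bool) : Set where
  field
    a₁   : a 1 ≡ true
    b-N  : b (suc (c + t)) ≡ true
    noAB : ∀ i → 1 ≤ i → i ≤ suc t → a i ≡ true → b (i + c) ≡ true → ⊥
    noBA : ∀ i → 1 ≤ i → i ≤ suc t → b i ≡ true → a (i + c) ≡ true → ⊥
    noAA : ∀ i → 1 ≤ i → i ≤ t → a i ≡ true → a (i + suc c) ≡ true → ⊥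
    noBB : ∀ i → 1 ≤ i → i ≤ t → b i ≡ true → b (i + suc c) ≡ true → ⊥
    noABAB : ∀ i k j m → 1 ≤ i → i + k < j → j + m ≤ suc (c + t) → suc (k + m) ≡ c →
             a i ≡ true → b (i + k) ≡ true → a j ≡ true → b (j + m) ≡ true → ⊥
    noABBA : ∀ i k j m → 1 ≤ i → i + k < j → j + m ≤ suc (c + t) → suc (k + m) ≡ c →
             a i ≡ true → b (i + k) ≡ true → b j ≡ true → a (j + m) ≡ true → ⊥

-- The pairing of the chords at x and y

module Counting {c t : ℕ} {a b : ℕ → Bool} (M : Missing c t a b) where

  open Missing M

  -- The cycle is x v_1 ... v_k y v_N ... v_(k+t+1); it omits the inner block v_(k+1) ... v_(k+t).
  wrap : ∀ k → 1 ≤ k → k ≤ c → b k ≡ true → a (k + suc t) ≡ true → ⊥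
  wrap (suc k) _ k<c bk ak with m≤n⇒∃[o]m+o≡n k<c
  ... | m , refl = noABAB 1 k (suc k + suc t) m ≤-refl (m<m+n (suc k) (s≤s z≤n))
                     (≤-reflexive end) refl a₁ bk ak (move {b} (sym end) b-N)
    where
    end : suc k + suc t + m ≡ suc (suc (k + m) + t)
    end = solve (k ∷ t ∷ m ∷ [])

  private
    U V : ℕ → ℕ
    U i = ⟦ a (1 + i) ⟧ + ⟦ b (1 + (c + i)) ⟧
    V k = ⟦ b (1 + k) ⟧ + ⟦ a (1 + (suc t + k)) ⟧

    U≤1 : ∀ i → i < suc t → U i ≤ 1
    U≤1 i i<1+t = exclusive⇒≤1 _ _ λ ai bi →
      noAB (suc i) (s≤s z≤n) i<1+t ai (move {b} (cong suc (+-comm c i)) bi)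

    V≤1 : ∀ k → k < c → V k ≤ 1
    V≤1 k k<c = exclusive⇒≤1 _ _ λ bk ak →
      wrap (suc k) (s≤s z≤n) k<c bk (move {a} (cong suc (+-comm (suc t) k)) ak)

    -- `U` takes `a` on 1, ..., t + 1 and `b` on c + 1, ..., N, while `V` takes the rest, so each
    -- chord is counted once.
    total : Σ< (suc (c + t)) (λ i → ⟦ a (1 + i) ⟧) + Σ< (suc (c + t)) (λ i → ⟦ b (1 + i) ⟧) ≡ Σ< (suc t) U + Σ< c V
    total = begin
      Σ< (suc (c + t)) (λ i → ⟦ a (1 + i) ⟧) + Σ< (suc (c + t)) (λ i → ⟦ b (1 + i) ⟧)
        ≡⟨ cong₂ _+_ (trans (cong (λ n → Σ< n (λ i → ⟦ a (1 + i) ⟧)) (cong suc (+-comm c t)))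
                            (Σ<-split (suc t) c (λ i → ⟦ a (1 + i) ⟧)))
                     (trans (cong (λ n → Σ< n (λ i → ⟦ b (1 + i) ⟧)) (sym (+-suc c t)))
                            (Σ<-split c (suc t) (λ i → ⟦ b (1 + i) ⟧))) ⟩
      A₁ + A₂ + (B₁ + B₂)
        ≡⟨ rearrange A₁ A₂ B₁ B₂ ⟩
      A₁ + B₂ + (B₁ + A₂)
        ≡⟨ cong₂ _+_ (Σ<-+ (suc t) _ _) (Σ<-+ c _ _) ⟨
      Σ< (suc t) U + Σ< c V ∎
      where
      open ≡-Reasoning
      A₁ = Σ< (suc t) (λ i → ⟦ a (1 + i) ⟧)
      A₂ = Σ< c (λ k → ⟦ a (1 + (suc t + k)) ⟧)
      B₁ = Σ< c (λ k → ⟦ b (1 + k) ⟧)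
      B₂ = Σ< (suc t) (λ i → ⟦ b (1 + (c + i)) ⟧)
      rearrange : ∀ x y z w → x + y + (z + w) ≡ x + w + (z + y)
      rearrange x y z w = solve (x ∷ y ∷ z ∷ w ∷ [])

    Σ-≤ : ∀ n {f} → (∀ i → i < n → f i ≤ 1) → Σ< n f ≤ n
    Σ-≤ n f≤1 = ≤-trans (Σ<-mono n f≤1) (≤-reflexive (trans (Σ<-const n 1) (*-identityʳ n)))

    Σ-tight : ∀ n {f} → (∀ i → i < n → f i ≤ 1) → n ≤ Σ< n f → ∀ i → i < n → f i ≡ 1
    Σ-tight n f≤1 n≤Σ = Σ<-tight n f≤1 (≤-trans (≤-reflexive (trans (Σ<-const n 1) (*-identityʳ n))) n≤Σ)

  Σ≤N : Σ< (suc (c + t)) (λ i → ⟦ a (1 + i) ⟧) + Σ< (suc (c + t)) (λ i → ⟦ b (1 + i) ⟧) ≤ suc (c + t)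
  Σ≤N = ≤-trans (≤-reflexive total) (≤-trans (Σ-≤ (suc t) U≤1 ⊕ Σ-≤ c V≤1) (≤-reflexive (cong suc (+-comm t c))))

  module Tight (N≤Σ : suc (c + t) ≤ Σ< (suc (c + t)) (λ i → ⟦ a (1 + i) ⟧) + Σ< (suc (c + t)) (λ i → ⟦ b (1 + i) ⟧)) where

    private
      bound : suc t + c ≤ Σ< (suc t) U + Σ< c V
      bound = ≤-trans (≤-reflexive (cong suc (+-comm t c))) (≤-trans N≤Σ (≤-reflexive total))

    b[i+c] : ∀ i → 1 ≤ i → i ≤ suc t → b (i + c) ≡ not (a i)
    b[i+c] (suc i) _ i<1+t = ≡1⇒not (a (suc i)) (b (suc i + c))
      (trans (cong (λ j → ⟦ a (suc i) ⟧ + ⟦ b (suc j) ⟧) (+-comm i c))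
             (Σ-tight (suc t) U≤1 (split (suc t) c bound (Σ-≤ c V≤1)) i i<1+t))
      where
      split : ∀ x y {u v} → x + y ≤ u + v → v ≤ y → x ≤ u
      split x y {u} {v} p q = linear (p ⊕ q) 0 (solve (x ∷ y ∷ u ∷ v ∷ []))

    a[k+1+t] : ∀ k → 1 ≤ k → k ≤ c → a (k + suc t) ≡ not (b k)
    a[k+1+t] (suc k) _ k<c = ≡1⇒not (b (suc k)) (a (suc k + suc t))
      (trans (cong (λ j → ⟦ b (suc k) ⟧ + ⟦ a (suc j) ⟧) (+-comm k (suc t)))
             (Σ-tight c V≤1 (split (suc t) c bound (Σ-≤ (suc t) U≤1)) k k<c))
      where
      split : ∀ x y {u v} → x + y ≤ u + v → u ≤ x → y ≤ v
      split x y {u} {v} p q = linear (p ⊕ q) 0 (solve (x ∷ y ∷ u ∷ v ∷ []))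

    -- Disjointness offers a second pairing, of `a i` with `b i`, and the same total is tight for it
    -- as well.
    complementary : (∀ i → 1 ≤ i → i ≤ suc (c + t) → a i ≡ true → b i ≡ true → ⊥) →
                    ∀ i → 1 ≤ i → i ≤ suc (c + t) → b i ≡ not (a i)
    complementary disjoint (suc i) _ i<N = ≡1⇒not (a (suc i)) (b (suc i))
      (Σ-tight (suc (c + t)) (λ j j<N → exclusive⇒≤1 _ _ (disjoint (suc j) (s≤s z≤n) j<N))
               (≤-trans N≤Σ (≤-reflexive (sym (Σ<-+ (suc (c + t)) _ _)))) i i<N)

Alternates : ℕ → (ℕ → Bool) → (ℕ → Bool) → Set
Alternates N a b = ∀ i → 1 ≤ i → i ≤ N → a i ≡ odd i × b i ≡ not (odd i)

-- The tight case for c ≤ t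

module Short {c t : ℕ} {a b : ℕ → Bool} (M : Missing c t a b) (c≤t : c ≤ t)
  (N≤Σ : suc (c + t) ≤ Σ< (suc (c + t)) (λ i → ⟦ a (1 + i) ⟧) + Σ< (suc (c + t)) (λ i → ⟦ b (1 + i) ⟧)) where

  open Missing M
  open Counting M
  open Tight N≤Σ

  -- Combined with the pairing, b = not a makes c a period of both sequences. Under this period the
  -- chords at distance c + 1 forbidden by `noAA` and `noBB` become chords at distance 1, which
  -- forces alternation.
  disjoint⇒alternates : (∀ i → 1 ≤ i → i ≤ suc (c + t) → a i ≡ true → b i ≡ true → ⊥) → Alternates (suc (c + t)) a b
  disjoint⇒alternates disjoint i 1≤i i≤N = a≡odd i 1≤i i≤N , trans (b≡¬a i 1≤i i≤N) (cong not (a≡odd i 1≤i i≤N))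
    where
    b≡¬a : ∀ i → 1 ≤ i → i ≤ suc (c + t) → b i ≡ not (a i)
    b≡¬a = complementary disjoint

    i≤t⇒i≤N : ∀ {i} → i ≤ suc t → i ≤ suc (c + t)
    i≤t⇒i≤N i≤1+t = ≤-trans i≤1+t (s≤s (m≤n+m t c))

    b-periodic : ∀ i → 1 ≤ i → i ≤ suc t → b (i + c) ≡ b i
    b-periodic i 1≤i i≤1+t = trans (b[i+c] i 1≤i i≤1+t) (sym (b≡¬a i 1≤i (i≤t⇒i≤N i≤1+t)))

    a-periodic : ∀ i → 1 ≤ i → i ≤ suc t → a (i + c) ≡ a i
    a-periodic i 1≤i i≤1+t = trans
      (not-flip (b≡¬a (i + c) (≤-trans 1≤i (m≤m+n i c)) (linear i≤1+t 0 (solve (i ∷ c ∷ t ∷ [])))))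
      (trans (cong not (b-periodic i 1≤i i≤1+t)) (sym (not-flip (b≡¬a i 1≤i (i≤t⇒i≤N i≤1+t)))))

    step : ∀ i → 1 ≤ i → i ≤ t → a (suc i) ≡ not (a i)
    step i 1≤i i≤t with a i in ai | a (suc i) in asi
    ... | true  | false = refl
    ... | false | true  = refl
    ... | true  | true  = ⊥-elim (noAA i 1≤i i≤t ai
      (move {a} (sym (+-suc i c)) (trans (a-periodic (suc i) (s≤s z≤n) (s≤s i≤t)) asi)))
    ... | false | false = ⊥-elim (noBB i 1≤i i≤t (b-true i 1≤i (m≤n⇒m≤1+n i≤t) ai)
      (move {b} (sym (+-suc i c)) (trans (b-periodic (suc i) (s≤s z≤n) (s≤s i≤t))
                                         (b-true (suc i) (s≤s z≤n) (s≤s i≤t) asi))))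
      where
      b-true : ∀ i → 1 ≤ i → i ≤ suc t → a i ≡ false → b i ≡ true
      b-true i 1≤i i≤1+t = negated (b≡¬a i 1≤i (i≤t⇒i≤N i≤1+t))

    initial : ∀ i → 1 ≤ i → i ≤ suc t → a i ≡ odd i
    initial (suc zero)    _ _     = a₁
    initial (suc (suc i)) _ i<1+t = trans (step (suc i) (s≤s z≤n) (≤-pred i<1+t))
                                          (cong not (initial (suc i) (s≤s z≤n) (<⇒≤ i<1+t)))

    c-even : odd c ≡ false
    c-even = trans (sym (not-involutive (odd c)))
      (cong not (trans (sym (initial (suc c) (s≤s z≤n) (s≤s c≤t))) (trans (a-periodic 1 ≤-refl (s≤s z≤n)) a₁)))

    -- Positions beyond t + 1 are reached by the period c.
    a≡odd : ∀ i → 1 ≤ i → i ≤ suc (c + t) → a i ≡ odd i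
    a≡odd i 1≤i i≤N with i ≤? suc t
    ... | yes i≤1+t = initial i 1≤i i≤1+t
    ... | no  i≰1+t with m≤n⇒∃[o]m+o≡n (≤-trans c≤t (≤-trans (n≤1+n t) (<⇒≤ (≰⇒> i≰1+t))))
    ...   | j , refl = begin
            a (c + j)   ≡⟨ cong a (+-comm c j) ⟩
            a (j + c)   ≡⟨ a-periodic j 1≤j j≤1+t ⟩
            a j         ≡⟨ initial j 1≤j j≤1+t ⟩
            odd j       ≡⟨ odd-+-even j c-even ⟨
            odd (j + c) ≡⟨ cong odd (+-comm j c) ⟩
            odd (c + j) ∎
      where
      open ≡-Reasoning
      j≤1+t : j ≤ suc t
      j≤1+t = linear i≤N 0 (solve (c ∷ j ∷ t ∷ []))
      1≤j : 1 ≤ j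
      1≤j = linear (≰⇒> i≰1+t ⊕ c≤t) 1 (solve (c ∷ j ∷ t ∷ []))

  -- A chord y v_1 excludes x v_(c+1), so y is adjacent to v_(2c+1), and with a chord y v_c the run
  -- v_c ... v_(2c+1) would close at y.
  b₁⇒¬b-c : 1 ≤ c → b 1 ≡ true → b c ≡ false
  b₁⇒¬b-c 1≤c b₁ = ≢true λ bc → noBB c 1≤c c≤t bc
    (move {b} (sym (+-suc c c)) (negated (b[i+c] (suc c) (s≤s z≤n) (s≤s c≤t))
      (≢true (noBA 1 ≤-refl (s≤s z≤n) b₁))))

  -- Let t = c + s. Without the chord y v_c there is a chord x v_N, hence none from y to v_(t+1),
  -- hence one from x to v_(s+1). As x is adjacent to v_(t+2) too, the run v_(s+1) ... v_(t+2)
  -- closes at x.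
  ¬b₁⇒b-c : 1 ≤ c → b 1 ≡ false → b c ≡ true
  ¬b₁⇒b-c 1≤c ¬b₁ = ≢false λ ¬bc → contra ¬bc (m≤n⇒∃[o]m+o≡n c≤t)
    where
    contra : b c ≡ false → ∃[ s ] c + s ≡ t → ⊥
    contra ¬bc (s , refl) = noAA (suc s) (s≤s z≤n) (linear 1≤c 0 (solve (c ∷ s ∷ []))) a[1+s]
        (move′ {a} (negated (a[k+1+t] 1 ≤-refl 1≤c) ¬b₁) (solve (c ∷ s ∷ [])))
      where
      ¬b[1+t] : b (suc (c + s)) ≡ false
      ¬b[1+t] = ≢true λ bt → noBA (suc (c + s)) (s≤s z≤n) ≤-refl bt
        (move {a} (+-comm c (suc (c + s))) (negated (a[k+1+t] c 1≤c ≤-refl) ¬bc))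
      a[1+s] : a (suc s) ≡ true
      a[1+s] = trans (not-flip (b[i+c] (suc s) (s≤s z≤n) (s≤s (m≤n+m s c))))
                     (cong not (move {b} (cong suc (+-comm c s)) ¬b[1+t]))

  -- Somewhere between 1 and c the sequence `b` drops from true to false. At such a drop after
  -- position p, the pairing forces all chords of the cycle x v_1 ... v_p y v_(p+t+1) ... v_N.
  b₁-absurd : 1 ≤ c → b 1 ≡ true → ⊥
  b₁-absurd 1≤c b₁ with m≤n⇒∃[o]m+o≡n 1≤c | m≤n⇒∃[o]m+o≡n c≤t | b₁⇒¬b-c 1≤c b₁
  ... | d , refl | s , refl | ¬bc with last-true b 1 d b₁ ¬bc
  ...   | suc k , _ , k<c , bk , ¬b[k+1] with m≤n⇒∃[o]m+o≡n k<c
  ...     | m , refl = noABBA 1 k (suc k + suc (c + s)) (suc m) ≤-refl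
              (m<m+n (suc k) (s≤s z≤n))
              (≤-reflexive end) (+-suc (suc k) m) a₁ bk b[k+1+t]
              (move {a} (sym (trans end (sym (+-suc c (c + s))))) a-N)
    where
    a-N : a (c + suc (c + s)) ≡ true
    a-N = negated (a[k+1+t] c 1≤c ≤-refl) ¬bc
    end : suc k + suc (c + s) + suc m ≡ suc (c + (c + s))
    end = solve (k ∷ m ∷ s ∷ [])
    a[k+2+t] : a (suc (suc k) + suc (c + s)) ≡ true
    a[k+2+t] = negated (a[k+1+t] (suc (suc k)) (s≤s z≤n) (s≤s (s≤s (m≤m+n k m)))) ¬b[k+1]
    i≤t : suc k + suc s ≤ c + s
    i≤t = linear (z≤n {m}) 0 (solve (k ∷ m ∷ s ∷ []))
    ¬a : a (suc k + suc s) ≡ false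
    ¬a = ≢true λ ai → noAA (suc k + suc s) (s≤s z≤n) i≤t ai (move′ {a} a[k+2+t] (solve (k ∷ m ∷ s ∷ [])))
    b[k+1+t] : b (suc k + suc (c + s)) ≡ true
    b[k+1+t] = move′ {b}
      (negated (b[i+c] (suc k + suc s) (s≤s z≤n) (m≤n⇒m≤1+n i≤t)) ¬a) (solve (k ∷ m ∷ s ∷ []))

  alternates : Alternates (suc (c + t)) a b
  alternates with m≤n⇒m<n∨m≡n (z≤n {c})
  -- For triangles, c = 0, `noAB` is disjointness itself.
  ... | inj₂ refl = disjoint⇒alternates λ i 1≤i i≤1+t ai bi →
          noAB i 1≤i i≤1+t ai (move {b} (sym (+-identityʳ i)) bi)
  ... | inj₁ 1≤c with b 1 in b₁
  ...   | true  = ⊥-elim (b₁-absurd 1≤c b₁)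
  ...   | false = disjoint⇒alternates (disjoint (m≤n⇒∃[o]m+o≡n 1≤c))
    where
    -- A common neighbour v_i of x and y serves as a run of a single vertex: in x v_i y v_N ...
    -- v_(t+2) if i ≤ t + 1, and in x v_1 ... v_c y v_i otherwise.
    disjoint : ∃[ d ] 1 + d ≡ c → ∀ i → 1 ≤ i → i ≤ suc (c + t) → a i ≡ true → b i ≡ true → ⊥
    disjoint (d , refl) i 1≤i i≤N ai bi with i ≤? suc t
    ... | yes i≤1+t = noABAB i 0 (2 + t) d 1≤i
            (linear i≤1+t 0 (solve (i ∷ t ∷ []))) (≤-reflexive (solve (t ∷ d ∷ []))) refl
            ai (move {b} (sym (+-identityʳ i)) bi)
            (negated (a[k+1+t] 1 ≤-refl 1≤c) b₁) (move′ {b} b-N (solve (t ∷ d ∷ [])))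
    ... | no i≰1+t = noABAB 1 d i 0 ≤-refl
            (linear (≰⇒> i≰1+t ⊕ c≤t) 1 (solve (i ∷ t ∷ d ∷ [])))
            (≤-trans (≤-reflexive (+-identityʳ i)) i≤N) (cong suc (+-identityʳ d))
            a₁ (¬b₁⇒b-c 1≤c b₁) ai (move {b} (sym (+-identityʳ i)) bi)

-- The tight case for t < c: shifts

module Long {c t : ℕ} {a b : ℕ → Bool} (M : Missing c t a b) (t<c : t < c) (2≤t : 2 ≤ t)
  (N≤Σ : suc (c + t) ≤ Σ< (suc (c + t)) (λ i → ⟦ a (1 + i) ⟧) + Σ< (suc (c + t)) (λ i → ⟦ b (1 + i) ⟧)) where

  open Missing M
  open Counting M
  open Tight N≤Σ

  ¬a[1+t] : a (suc t) ≡ false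
  ¬a[1+t] = ≢true λ at → noAB (suc t) (s≤s z≤n) ≤-refl at (move {b} (cong suc (+-comm c t)) b-N)

  -- A missing chord x v_i gives a chord y v_(i+c); the run v_(i-1) ... v_(i+c) then forbids y
  -- v_(i-1), and the pairing returns a chord x v_(i+t).
  ¬a⇒a[i+t] : ∀ i → 2 ≤ i → i ≤ suc t → a i ≡ false → a (i + t) ≡ true
  ¬a⇒a[i+t] (suc i) (s≤s 1≤i) (s≤s i≤t) ¬ai = move {a} (+-suc i t)
    (negated (a[k+1+t] i 1≤i (≤-trans i≤t (<⇒≤ t<c))) (≢true λ bi → noBB i 1≤i i≤t bi
      (move {b} (sym (+-suc i c)) (negated (b[i+c] (suc i) (s≤s z≤n) (s≤s i≤t)) ¬ai))))

  a⇒¬a[j+1+c] : ∀ j → 1 ≤ j → j ≤ t → a j ≡ true → a (j + suc c) ≡ false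
  a⇒¬a[j+1+c] j 1≤j j≤t aj = ≢true (noAA j 1≤j j≤t aj)

  -- s is a shift if neighbours of x beyond position t + 1 can be moved up by s.
  Shift : ℕ → Set
  Shift s = a (suc s) ≡ true ⊎ ∃[ r ] (r + s ≡ suc t × a r ≡ false)

  -- If x were not adjacent to v_(i+s), then y would be adjacent to v_(i+s-t-1). Either form of
  -- `Shift s` completes a cycle with this chord: x v_(s+1) ... v_(i+s-t-1) y v_N ... v_i for the
  -- first, x v_1 ... v_(i+s-t-1) y v_(r+c) ... v_i for the second.
  shift : ∀ {s} → 1 ≤ s → s < t → Shift s → ∀ i → 2 + t ≤ i → i + s ≤ suc (c + t) →
          a i ≡ true → a (i + s) ≡ true
  shift {s} 1≤s s<t available i t+2≤i i+s≤N ai with m≤n⇒∃[o]m+o≡n t+2≤i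
  ... | e , refl = ≢false λ ¬a[i+s] → contra (b-k ¬a[i+s]) available
    where
    k≤c : suc s + e ≤ c
    k≤c = linear i+s≤N 0 (solve (s ∷ e ∷ c ∷ t ∷ []))
    b-k : a (2 + t + e + s) ≡ false → b (suc s + e) ≡ true
    b-k ¬a[i+s] = trans (not-flip (a[k+1+t] (suc s + e) (s≤s z≤n) k≤c))
      (cong not (move′ {a} ¬a[i+s] (solve (t ∷ e ∷ s ∷ []))))
    contra : b (suc s + e) ≡ true → Shift s → ⊥
    contra bk (inj₁ a[1+s]) with m≤n⇒∃[o]m+o≡n (≤-trans (m≤m+n (2 + t + e) s) i+s≤N)
    ... | m , i+m≡N = noABAB (suc s) e (2 + t + e) m (s≤s z≤n)
            (linear s<t 1 (solve (s ∷ t ∷ e ∷ [])))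
            (≤-reflexive i+m≡N) (+-cancelʳ-≡ (suc t) _ _ (trans (left e m) (trans i+m≡N (sym (+-suc c t)))))
            a[1+s] bk ai (move {b} (sym i+m≡N) b-N)
      where
      left : ∀ e m → suc (e + m) + suc t ≡ 2 + t + e + m
      left e m = solve (e ∷ m ∷ t ∷ [])
    contra bk (inj₂ (r , r+s≡1+t , ¬ar)) with m≤n⇒∃[o]m+o≡n i≤r+c
      where
      i≤r+c : 2 + t + e ≤ r + c
      i≤r+c = linear (i+s≤N ⊕ ≤-reflexive (sym r+s≡1+t)) 0 (solve (t ∷ e ∷ s ∷ c ∷ r ∷ []))
    ... | m , i+m≡r+c = noABAB 1 (s + e) (2 + t + e) m ≤-refl
            (linear s<t 1 (solve (s ∷ t ∷ e ∷ [])))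
            (≤-trans (≤-reflexive i+m≡r+c) (linear (≤-reflexive r+s≡1+t) s (solve (r ∷ c ∷ s ∷ t ∷ []))))
            (+-cancelʳ-≡ (suc t) _ _ (trans (left e m) (trans (cong (_+ s) i+m≡r+c)
              (trans (right r) (cong (c +_) r+s≡1+t)))))
            a₁ bk ai (move {b} (sym i+m≡r+c) (negated (b[i+c] r 1≤r r≤1+t) ¬ar))
      where
      left : ∀ e m → suc (s + e + m) + suc t ≡ 2 + t + e + m + s
      left e m = solve (s ∷ e ∷ m ∷ t ∷ [])
      right : ∀ r → r + c + s ≡ c + (r + s)
      right r = solve (r ∷ c ∷ s ∷ [])
      r≤1+t : r ≤ suc t
      r≤1+t = ≤-trans (m≤m+n r s) (≤-reflexive r+s≡1+t)
      1≤r : 1 ≤ r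
      1≤r = linear (s<t ⊕ ≤-reflexive (sym r+s≡1+t)) 1 (solve (s ∷ t ∷ r ∷ []))

  shifts : ∀ {s} → 1 ≤ s → s < t → Shift s → ∀ m i → 2 + t ≤ i → i + m * s ≤ suc (c + t) →
           a i ≡ true → a (i + m * s) ≡ true
  shifts         1≤s s<t available zero    i t+2≤i _      ai = move {a} (sym (+-identityʳ i)) ai
  shifts {s} 1≤s s<t available (suc m) i t+2≤i i+ms≤N ai = move {a} (+-assoc i s (m * s))
    (shifts 1≤s s<t available m (i + s) (≤-trans t+2≤i (m≤m+n i s)) i+s+ms≤N
      (shift 1≤s s<t available i t+2≤i (≤-trans (m≤m+n (i + s) (m * s)) i+s+ms≤N) ai))
    where
    i+s+ms≤N : i + s + m * s ≤ suc (c + t)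
    i+s+ms≤N = ≤-trans (≤-reflexive (+-assoc i s (m * s))) i+ms≤N

  -- A non-neighbour v_i of x produces the neighbour v_(i+t), a neighbour v_j produces the
  -- non-neighbour v_(j+c+1); steps of length s must not lead from the former to the latter.
  no-shift : ∀ {s} → 1 ≤ s → s < t → Shift s → ∀ i j m → 2 ≤ i → i ≤ suc t → a i ≡ false →
             1 ≤ j → j ≤ t → a j ≡ true → i + t + m * s ≡ j + suc c → ⊥
  no-shift 1≤s s<t available i j m 2≤i i≤1+t ¬ai 1≤j j≤t aj eq = true≢false
    (shifts 1≤s s<t available m (i + t) (+-monoˡ-≤ t 2≤i)
      (≤-trans (≤-reflexive eq) (linear j≤t 0 (solve (j ∷ c ∷ t ∷ [])))) (¬a⇒a[i+t] i 2≤i i≤1+t ¬ai))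
    (move {a} (sym eq) (a⇒¬a[j+1+c] j 1≤j j≤t aj))

  -- Where `a` drops from k to k + 1, the positions k + 1 + t and k + 1 + c of `no-shift` are c - t
  -- ≥ 1 unit steps apart.
  no-shift-by-1 : ¬ Shift 1
  no-shift-by-1 available with last-true a 1 t a₁ ¬a[1+t] | m≤n⇒∃[o]m+o≡n t<c
  ... | k , 1≤k , k<1+t , ak , ¬a[1+k] | m , refl =
    no-shift ≤-refl 2≤t available (suc k) k (suc m) (s≤s 1≤k) k<1+t ¬a[1+k] 1≤k (≤-pred k<1+t) ak
      (solve (k ∷ t ∷ m ∷ []))

  ¬a₂ : a 2 ≡ false
  ¬a₂ = ≢true (no-shift-by-1 ∘ inj₁)

  a-t : a t ≡ true
  a-t = ≢false λ ¬at → no-shift-by-1 (inj₂ (t , +-comm t 1 , ¬at))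

  2<t : 2 < t
  2<t = case m≤n⇒m<n∨m≡n 2≤t of λ where
    (inj₁ 2<t)  → 2<t
    (inj₂ refl) → ⊥-elim (true≢false a-t ¬a₂)

  -- No shift is smaller than s.
  Flat : ℕ → Set
  Flat s = ∀ i → 2 ≤ i → i ≤ s → a i ≡ false × (∀ r → r + i ≡ 2 + t → a r ≡ true)

  flat-suc : ∀ {s} → Flat s → ¬ Shift s → Flat (suc s)
  flat-suc {s} flat unavailable i 2≤i i≤1+s with m≤n⇒m<n∨m≡n i≤1+s
  ... | inj₁ i<1+s = flat i 2≤i (≤-pred i<1+s)
  ... | inj₂ refl  = ≢true (unavailable ∘ inj₁) , λ r r+i≡2+t → ≢false λ ¬ar →
          unavailable (inj₂ (r , suc-injective (trans (sym (+-suc r s)) r+i≡2+t) , ¬ar))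

  flat-2 : Flat 2
  flat-2 (suc (suc zero)) _ _ = ¬a₂ , λ r r+2≡2+t → move {a} (sym (+-cancelʳ-≡ 2 r t (trans r+2≡2+t (+-comm 2 t)))) a-t
  flat-2 (suc (suc (suc _))) _ (s≤s (s≤s ()))
  flat-2 (suc zero) (s≤s ()) _

  Shift? : ∀ s → s ≤ t → Shift s ⊎ ¬ Shift s
  Shift? s s≤t with a (suc s) in a[1+s] | m≤n⇒∃[o]m+o≡n (m≤n⇒m≤1+n s≤t)
  ... | true  | _ = inj₁ (inj₁ refl)
  ... | false | r , s+r≡1+t with a r in ar
  ...   | false = inj₁ (inj₂ (r , trans (+-comm r s) s+r≡1+t , ar))
  ...   | true  = inj₂ λ where
            (inj₁ ())
            (inj₂ (r′ , r′+s≡1+t , ¬ar′)) → true≢false ar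
              (move {a} (+-cancelʳ-≡ s r′ r (trans r′+s≡1+t (trans (sym s+r≡1+t) (+-comm s r)))) ¬ar′)

  -- Beyond t + 1, only positions congruent to t + 1 modulo s can be non-neighbours of x, but the
  -- last two positions are non-neighbours.
  no-shift-above-2 : ∀ {s} → 3 ≤ s → s < t → Flat s → ¬ Shift s
  no-shift-above-2 {s@(suc s-1)} 3≤s s<t flat available =
    contradiction (∣1⇒≡1 (∣m+n∣m⇒∣n (subst (s ∣_) (sym (+-comm d 1)) s∣c) s∣d)) λ where refl → contradiction 3≤s λ where (s≤s ())
    where
    covered : ∀ r → 1 ≤ r → r ≤ c → a (suc t + r) ≡ false → s ∣ r
    covered r 1≤r r≤c ¬a with r % s in r%s
    ... | zero  = m%n≡0⇒n∣m r s r%s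
    ... | suc ρ = ⊥-elim (true≢false
            (shifts (≤-trans (s≤s z≤n) 3≤s) s<t available (r / s) (2 + ρ + t)
              (linear (z≤n {ρ}) 0 (solve (ρ ∷ t ∷ [])))
              (≤-trans (≤-reflexive position) (linear r≤c 0 (solve (r ∷ c ∷ t ∷ []))))
              (¬a⇒a[i+t] (2 + ρ) (s≤s (s≤s z≤n)) (≤-trans 2+ρ≤s (<⇒≤ (m<n⇒m<1+n s<t))) (proj₁ (flat (2 + ρ) (s≤s (s≤s z≤n)) 2+ρ≤s))))
            (move {a} (sym position) ¬a))
      where
      2+ρ≤s : 2 + ρ ≤ s
      2+ρ≤s = subst (_< s) r%s (m%n<n r s)
      position : 2 + ρ + t + r / s * s ≡ suc t + r
      position = trans (reorder (r / s * s)) (cong (suc t +_) (sym (trans (m≡m%n+[m/n]*n r s) (cong (_+ r / s * s) r%s))))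
        where
        reorder : ∀ x → 2 + ρ + t + x ≡ suc t + (suc ρ + x)
        reorder x = solve (ρ ∷ t ∷ x ∷ [])
    top : ∃[ d ] 1 + d ≡ c
    top = m≤n⇒∃[o]m+o≡n (≤-trans (s≤s z≤n) t<c)
    d = proj₁ top
    pre : ∃[ u ] 1 + u ≡ t
    pre = m≤n⇒∃[o]m+o≡n (≤-trans (s≤s z≤n) 2≤t)
    u = proj₁ pre
    s∣c : s ∣ suc d
    s∣c = covered (suc d) (s≤s z≤n) (≤-reflexive (proj₂ top))
      (move {a} (trans (cong (λ c → t + suc c) (sym (proj₂ top))) (+-suc t (suc d)))
        (a⇒¬a[j+1+c] t (≤-trans (s≤s z≤n) 2≤t) ≤-refl a-t))
    s∣d : s ∣ d
    s∣d = covered d (≤-pred (≤-trans 2≤t (≤-trans (<⇒≤ t<c) (≤-reflexive (sym (proj₂ top))))))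
      (≤-trans (n≤1+n d) (≤-reflexive (proj₂ top)))
      (move {a} (trans (cong (λ c → u + suc c) (sym (proj₂ top))) (trans (reorder u d) (cong (λ t → suc t + d) (proj₂ pre))))
        (a⇒¬a[j+1+c] u 1≤u (≤-trans (n≤1+n u) (≤-reflexive (proj₂ pre)))
          (proj₂ (flat 3 (s≤s (s≤s z≤n)) 3≤s) u (trans (+-comm u 3) (cong (2 +_) (proj₂ pre))))))
      where
      reorder : ∀ u d → u + suc (suc d) ≡ suc (suc u) + d
      reorder u d = solve (u ∷ d ∷ [])
      1≤u : 1 ≤ u
      1≤u = ≤-pred (≤-trans 2≤t (≤-reflexive (sym (proj₂ pre))))

  -- If no step from 2 to t - 1 were a shift, flatness would grow up to t, where it clashes with
  -- `a-t`.
  flat-absurd : ∀ d {s} → 3 ≤ s → s + d ≡ t → Flat s → ⊥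
  flat-absurd zero    {s} 3≤s s+0≡t flat = true≢false
    (move {a} (sym (trans (sym (+-identityʳ s)) s+0≡t)) a-t) (proj₁ (flat s (≤-trans (s≤s (s≤s z≤n)) 3≤s) ≤-refl))
  flat-absurd (suc d) {s} 3≤s s+1+d≡t flat = flat-absurd d (m≤n⇒m≤1+n 3≤s) (trans (sym (+-suc s d)) s+1+d≡t)
    (flat-suc flat (no-shift-above-2 3≤s (≤-trans (m<m+n s (s≤s z≤n)) (≤-reflexive s+1+d≡t)) flat))

  shift-by-2 : Shift 2
  shift-by-2 with Shift? 2 2≤t
  ... | inj₁ available   = available
  ... | inj₂ unavailable = let d , 3+d≡t = m≤n⇒∃[o]m+o≡n 2<t in
                           ⊥-elim (flat-absurd d ≤-refl 3+d≡t (flat-suc flat-2 unavailable))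

  2≤1+t : 2 ≤ suc t
  2≤1+t = m≤n⇒m≤1+n 2≤t

  1≤t : 1 ≤ t
  1≤t = <⇒≤ 2≤t

  parity-clash : ∀ i j → 2 ≤ i → i ≤ suc t → a i ≡ false → 1 ≤ j → j ≤ t → a j ≡ true →
                 i + t ≤ j + suc c → odd (i + t) ≡ odd (j + suc c) → ⊥
  parity-clash i j 2≤i i≤1+t ¬ai 1≤j j≤t aj i+t≤j+1+c eq =
    let m , i+t+2m≡ = same-parity i+t≤j+1+c eq in
    no-shift (s≤s z≤n) 2<t shift-by-2 i j m 2≤i i≤1+t ¬ai 1≤j j≤t aj i+t+2m≡

  i+t≤t+1+c : ∀ {i} → i ≤ suc t → i + t ≤ t + suc c
  i+t≤t+1+c {i} i≤1+t = linear (i≤1+t ⊕ t<c) 1 (solve (i ∷ t ∷ c ∷ []))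

  -- The pairs (i, j) = (2, t) and (t + 1, t) in `parity-clash` leave one combination of parities.
  parities : odd t ≡ true × odd c ≡ false
  parities = solution (odd t) (odd c)
    (λ eq → parity-clash 2 t ≤-refl 2≤1+t ¬a₂ 1≤t ≤-refl a-t (i+t≤t+1+c 2≤1+t)
      (trans (odd-+ 2 t) (trans eq (sym (odd-+ t (suc c))))))
    (λ eq → parity-clash (suc t) t 2≤1+t ≤-refl ¬a[1+t] 1≤t ≤-refl a-t (i+t≤t+1+c ≤-refl)
      (trans (odd-+ (suc t) t) (trans eq (sym (odd-+ t (suc c))))))
    where
    solution : ∀ x y → (x ≡ x xor not y → ⊥) → (not x xor x ≡ x xor not y → ⊥) → x ≡ true × y ≡ false
    solution true  false _ _ = refl , refl
    solution true  true  h _ = ⊥-elim (h refl)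
    solution false true  h _ = ⊥-elim (h refl)
    solution false false _ h = ⊥-elim (h refl)

  odd-+-suc-t : ∀ i → odd (i + suc t) ≡ odd i
  odd-+-suc-t i = odd-+-even i (cong not (proj₁ parities))

  a≡odd : ∀ i → 1 ≤ i → i ≤ suc (c + t) → a i ≡ odd i
  a≡odd i 1≤i i≤N with i ≤? suc t | odd i in oddi
  a≡odd 1 _ _ | yes _ | true = a₁
  a≡odd i@(suc (suc _)) 1≤i i≤N | yes i≤1+t | true = ≢false λ ¬ai →
    parity-clash i t (s≤s (s≤s z≤n)) i≤1+t ¬ai 1≤t ≤-refl a-t (i+t≤t+1+c i≤1+t)
      (trans (odd-+ i t) (trans (cong₂ _xor_ oddi (proj₁ parities))
        (sym (trans (odd-+ t (suc c)) (cong₂ (λ x y → x xor not y) (proj₁ parities) (proj₂ parities))))))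
  a≡odd i 1≤i i≤N | yes i≤1+t | false with m≤n⇒m<n∨m≡n i≤1+t
  ... | inj₂ refl  = ¬a[1+t]
  ... | inj₁ i<1+t = ≢true λ ai →
    parity-clash 2 i ≤-refl 2≤1+t ¬a₂ 1≤i (≤-pred i<1+t) ai (linear (t<c ⊕ 1≤i) 1 (solve (t ∷ c ∷ i ∷ [])))
      (trans (odd-+ 2 t) (trans (proj₁ parities)
        (sym (trans (odd-+ i (suc c)) (cong₂ (λ x y → x xor not y) oddi (proj₂ parities))))))
  a≡odd i 1≤i i≤N | no i≰1+t | true =
    let m , 2+t+2m≡i = same-parity (≰⇒> i≰1+t) (trans (odd-+ 2 t) (trans (proj₁ parities) (sym oddi))) in
    move {a} 2+t+2m≡i (shifts (s≤s z≤n) 2<t shift-by-2 m (2 + t) ≤-refl (≤-trans (≤-reflexive 2+t+2m≡i) i≤N)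
      (¬a⇒a[i+t] 2 ≤-refl 2≤1+t ¬a₂))
  a≡odd i 1≤i i≤N | no i≰1+t | false = ≢true λ ai →
    let m , i+2m≡N = same-parity i≤N (trans oddi (sym N-even)) in
    true≢false (shifts (s≤s z≤n) 2<t shift-by-2 m i (≰⇒> i≰1+t) (≤-reflexive i+2m≡N) ai)
      (move {a} (trans (+-suc t c) (trans (cong suc (+-comm t c)) (sym i+2m≡N))) (a⇒¬a[j+1+c] t 1≤t ≤-refl a-t))
    where
    N-even : odd (suc (c + t)) ≡ false
    N-even = cong not (trans (odd-+ c t) (cong₂ _xor_ (proj₂ parities) (proj₁ parities)))

  alternates : Alternates (suc (c + t)) a b
  alternates i 1≤i i≤N = a≡odd i 1≤i i≤N , b≡even (i ≤? c)
    where
    b≡even : Dec (i ≤ c) → b i ≡ not (odd i)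
    b≡even (yes i≤c) = trans (not-flip (a[k+1+t] i 1≤i i≤c)) (cong not
      (trans (a≡odd (i + suc t) (≤-trans 1≤i (m≤m+n i (suc t))) (linear i≤c 0 (solve (i ∷ t ∷ c ∷ [])))) (odd-+-suc-t i)))
    b≡even (no i≰c) with m≤n⇒∃[o]m+o≡n (<⇒≤ (≰⇒> i≰c))
    ... | j , refl = trans (move {b} (+-comm j c) (b[i+c] j 1≤j j≤1+t))
            (cong not (trans (a≡odd j 1≤j (≤-trans j≤1+t (s≤s (m≤n+m t c))))
              (trans (sym (odd-+-even j (proj₂ parities))) (cong odd (+-comm j c)))))
      where
      1≤j : 1 ≤ j
      1≤j = linear (≰⇒> i≰c) 0 (solve (c ∷ j ∷ []))
      j≤1+t : j ≤ suc t
      j≤1+t = linear i≤N 0 (solve (c ∷ j ∷ t ∷ []))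

missing⇒alternates : ∀ {c t a b} → Missing c t a b → 2 ≤ t →
  suc (c + t) ≤ Σ< (suc (c + t)) (λ i → ⟦ a (1 + i) ⟧) + Σ< (suc (c + t)) (λ i → ⟦ b (1 + i) ⟧) →
  Alternates (suc (c + t)) a b
missing⇒alternates {c} {t} M 2≤t N≤Σ with c ≤? t
... | yes c≤t = Short.alternates M c≤t N≤Σ
... | no  c≰t = Long.alternates M (≰⇒> c≰t) 2≤t N≤Σ

-- Hamiltonian paths and cycles

T⇒true : ∀ {x} → T x → x ≡ true
T⇒true {true} _ = refl

true⇒T : ∀ {x} → x ≡ true → T x
true⇒T refl = _

adjacent-sym : ∀ {n} (G : Graph n) {u v} → Adjacent G u v → Adjacent G v u
adjacent-sym G {u} {v} = subst T (adj-sym G u v)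

∃-Vec? : ∀ {n} l {P : Vec (Fin n) l → Set} → (∀ xs → Dec (P xs)) → Dec (∃ P)
∃-Vec? zero    P? = map′ ([]ᵛ ,_) (λ where ([]ᵛ , p) → p) (P? []ᵛ)
∃-Vec? (suc l) P? = map′ (λ (x , xs , p) → x ∷ᵛ xs , p) (λ where (x ∷ᵛ xs , p) → x , xs , p)
  (Finₚ.any? λ x → ∃-Vec? l (λ xs → P? (x ∷ᵛ xs)))

-- Decidability turns each refutation of the absence of a cycle into a cycle, through
-- `decidable-stable`.
Cycle? : ∀ {n} (G : Graph n) l → Dec (Cycle G l)
Cycle? {n} G l = map′ from to (∃-Vec? l λ xs →
    (3 ≤? l) ×-dec (Finₚ.all? λ i → Finₚ.all? λ j → (lookup xs i Finₚ.≟ lookup xs j) →-dec (i Finₚ.≟ j))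
    ×-dec (Finₚ.all? λ i → Finₚ.all? λ j → (toℕ j ℕ.≟ suc (toℕ i)) →-dec T? (adj G (lookup xs i) (lookup xs j)))
    ×-dec (Finₚ.all? λ i → Finₚ.all? λ j →
      (suc (toℕ i) ℕ.≟ l) →-dec ((toℕ j ℕ.≟ 0) →-dec T? (adj G (lookup xs i) (lookup xs j)))))
  where
  IsCycle : Vec (Fin n) l → Set
  IsCycle xs = 3 ≤ l × (∀ i j → lookup xs i ≡ lookup xs j → i ≡ j)
    × (∀ i j → toℕ j ≡ suc (toℕ i) → Adjacent G (lookup xs i) (lookup xs j))
    × (∀ i j → suc (toℕ i) ≡ l → toℕ j ≡ 0 → Adjacent G (lookup xs i) (lookup xs j))
  from : ∃ IsCycle → Cycle G l
  from (xs , 3≤l , distinct , step , closing) = record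
    { 3≤length = 3≤l ; vertex = lookup xs ; distinct = λ {i} {j} → distinct i j ; step = step ; closing = closing }
  to : Cycle G l → ∃ IsCycle
  to C = tabulate vertex , 3≤length
    , (λ i j eq → distinct (subst₂ _≡_ (Vecₚ.lookup∘tabulate vertex i) (Vecₚ.lookup∘tabulate vertex j) eq))
    , (λ i j eq → retabulate i j (step i j eq))
    , (λ i j eq eq′ → retabulate i j (closing i j eq eq′))
    where
    open Cycle C
    retabulate : ∀ i j → Adjacent G (vertex i) (vertex j) →
                 Adjacent G (lookup (tabulate vertex) i) (lookup (tabulate vertex) j)
    retabulate i j = subst₂ (Adjacent G) (sym (Vecₚ.lookup∘tabulate vertex i)) (sym (Vecₚ.lookup∘tabulate vertex j))

record Path {n} (G : Graph n) (M : ℕ) (q : ℕ → Fin n) : Set where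
  field
    inj  : InjectiveBelow (suc M) q
    link : ∀ i → i < M → Adjacent G (q i) (q (suc i))

module _ {n : ℕ} {G : Graph n} {M : ℕ} {q : ℕ → Fin n} (P : Path G M q) where

  open Path P
  open Positions G q M inj

  flip : ∀ {i j} → adj G (q i) (q j) ≡ true → E j i
  flip {i} {j} e = true⇒T (trans (adj-sym G (q j) (q i)) e)

  -- In the order of the fields, the excluded cycles are x v_i ... v_(i+c) y; x v_(i+c) ... v_i y; x
  -- v_i ... v_(i+c+1); v_i ... v_(i+c+1) y; x v_i ... v_(i+k) y v_(j+m) ... v_j; and x v_i ...
  -- v_(i+k) y v_j ... v_(j+m).
  path⇒missing : ∀ c t → M ≡ 2 + (c + t) → E M 0 → ¬ Cycle G (3 + c) →
                 Missing c t (λ i → adj G (q 0) (q i)) (λ i → adj G (q M) (q i))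
  path⇒missing c t refl y~x ¬C = record
    { a₁   = T⇒true (link 0 (s≤s z≤n))
    ; b-N  = trans (adj-sym G _ _) (T⇒true (link (suc (c + t)) ≤-refl))
    ; noAB = λ i 1≤i i≤1+t ai bi → ¬C (close
        (one 0 ▷⟨ 1≤i , true⇒T ai ⟩ up link i c (<⇒≤ (i+c<M i≤1+t)) ▷⟨ i+c<M i≤1+t , flip bi ⟩ one M)
        ≤-refl y~x 3≤3+c (solve (c ∷ [])))
    ; noBA = λ i 1≤i i≤1+t bi ai → ¬C (close
        (one 0 ▷⟨ 1≤i , true⇒T ai ⟩ down link i c (<⇒≤ (i+c<M i≤1+t)) ▷⟨ i+c<M i≤1+t , flip bi ⟩ one M)
        ≤-refl y~x 3≤3+c (solve (c ∷ [])))
    ; noAA = λ i 1≤i i≤t ai aj → ¬C (close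
        (one 0 ▷⟨ 1≤i , true⇒T ai ⟩ up link i (suc c) (<⇒≤ (i+1+c<M i≤t)))
        (<⇒≤ (i+1+c<M i≤t)) (flip aj) 3≤3+c refl)
    ; noBB = λ i 1≤i i≤t bi bj → ¬C (close
        (up link i (suc c) (<⇒≤ (i+1+c<M i≤t)) ▷⟨ i+1+c<M i≤t , flip bj ⟩ one M)
        ≤-refl (true⇒T bi) 3≤3+c (solve (c ∷ [])))
    ; noABAB = λ i k j m 1≤i i+k<j j+m≤N total ai bi aj bj → ¬C (close
        ((one 0 ▷⟨ 1≤i , true⇒T ai ⟩ up link i k (i+k≤M {i} {k} i+k<j j+m≤N))
          ▷⟨ i+k<j , flip bi ⟩ (one M ◁⟨ s≤s j+m≤N , true⇒T bj ⟩ down link j m (m≤n⇒m≤1+n j+m≤N)))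
        ≤-refl (flip aj) 3≤3+c (size k m total))
    ; noABBA = λ i k j m 1≤i i+k<j j+m≤N total ai bi bj aj → ¬C (close
        ((one 0 ▷⟨ 1≤i , true⇒T ai ⟩ up link i k (i+k≤M {i} {k} i+k<j j+m≤N))
          ▷⟨ i+k<j , flip bi ⟩ (one M ◁⟨ s≤s j+m≤N , true⇒T bj ⟩ up link j m (m≤n⇒m≤1+n j+m≤N)))
        ≤-refl (flip aj) 3≤3+c (size k m total))
    }
    where
    3≤3+c : 3 ≤ 3 + c
    3≤3+c = s≤s (s≤s (s≤s z≤n))
    i+c<M : ∀ {i} → i ≤ suc t → i + c < 2 + (c + t)
    i+c<M {i} i≤1+t = linear i≤1+t 0 (solve (i ∷ c ∷ t ∷ []))
    i+1+c<M : ∀ {i} → i ≤ t → i + suc c < 2 + (c + t)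
    i+1+c<M {i} i≤t = linear i≤t 0 (solve (i ∷ c ∷ t ∷ []))
    i+k≤M : ∀ {i k j m} → i + k < j → j + m ≤ suc (c + t) → i + k ≤ 2 + (c + t)
    i+k≤M {j = j} {m} i+k<j j+m≤N = ≤-trans (<⇒≤ i+k<j) (≤-trans (m≤m+n j m) (m≤n⇒m≤1+n j+m≤N))
    size : ∀ k m {c} → suc (k + m) ≡ c → 1 + suc k + (1 + suc m) ≡ 3 + c
    size k m refl = solve (k ∷ m ∷ [])

  private
    a b : ℕ → Bool
    a i = adj G (q 0) (q i)
    b i = adj G (q M) (q i)

    crossing : 2 ≤ M → ¬ Cycle G (suc M) → ∀ k → k < M → b k ≡ true → a (suc k) ≡ true → ⊥
    crossing 2≤M ¬C k k<M bk ak with m≤n⇒∃[o]m+o≡n k<M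
    ... | m , refl = ¬C (close
            (up link 0 k (<⇒≤ k<M) ▷⟨ ≤-refl , flip bk ⟩ down link (suc k) m ≤-refl)
            ≤-refl (flip ak) (s≤s 2≤M) (+-suc (suc k) m))

    U : ℕ → ℕ
    U k = ⟦ b k ⟧ + ⟦ a (suc k) ⟧

    total : Σ< (suc M) (⟦_⟧ ∘ a) + Σ< (suc M) (⟦_⟧ ∘ b) ≡ Σ< M U
    total = begin
      Σ< (suc M) (⟦_⟧ ∘ a) + (Σ< M (⟦_⟧ ∘ b) + ⟦ b M ⟧)
        ≡⟨ cong₂ (λ x y → x + (Σ< M (⟦_⟧ ∘ b) + ⟦ y ⟧)) (Σ<-split 1 M (⟦_⟧ ∘ a)) (adj-irrefl G (q M)) ⟩
      ⟦ a 0 ⟧ + Σ< M (λ k → ⟦ a (suc k) ⟧) + (Σ< M (⟦_⟧ ∘ b) + 0)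
        ≡⟨ cong₂ (λ x y → ⟦ x ⟧ + Σ< M (λ k → ⟦ a (suc k) ⟧) + y) (adj-irrefl G (q 0)) (+-identityʳ _) ⟩
      Σ< M (λ k → ⟦ a (suc k) ⟧) + Σ< M (⟦_⟧ ∘ b)
        ≡⟨ +-comm (Σ< M (λ k → ⟦ a (suc k) ⟧)) _ ⟩
      Σ< M (⟦_⟧ ∘ b) + Σ< M (λ k → ⟦ a (suc k) ⟧)
        ≡⟨ Σ<-+ M _ _ ⟨
      Σ< M U ∎
      where open ≡-Reasoning

    Σ1 : Σ< M (λ _ → 1) ≡ M
    Σ1 = trans (Σ<-const M 1) (*-identityʳ M)

  -- Ore's crossing argument: chords from the last vertex to v_k and from the first to v_(k+1) close
  -- up the whole path. It is kept general in the path, since it serves once with all n vertices,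
  -- for the step from G + uv to G, and once with n - 1 of them.
  ore-≤ : 2 ≤ M → ¬ Cycle G (suc M) → Σ< (suc M) (⟦_⟧ ∘ a) + Σ< (suc M) (⟦_⟧ ∘ b) ≤ M
  ore-≤ 2≤M ¬C = ≤-trans (≤-reflexive total) (≤-trans
    (Σ<-mono M (λ k k<M → exclusive⇒≤1 _ _ (crossing 2≤M ¬C k k<M))) (≤-reflexive Σ1))

  ore-tight : 2 ≤ M → ¬ Cycle G (suc M) → M ≤ Σ< (suc M) (⟦_⟧ ∘ a) + Σ< (suc M) (⟦_⟧ ∘ b) →
              ∀ k → k < M → a (suc k) ≡ not (b k)
  ore-tight 2≤M ¬C M≤Σ k k<M = ≡1⇒not _ _
    (Σ<-tight M (λ k k<M → exclusive⇒≤1 _ _ (crossing 2≤M ¬C k k<M))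
      (≤-trans (≤-reflexive Σ1) (≤-trans M≤Σ (≤-reflexive total))) k k<M)

-- A Hamiltonian cycle, unrolled to a periodic sequence of vertices.

record Tour {n} (G : Graph n) : Set where
  field
    at       : ℕ → Fin n
    at-inj   : InjectiveBelow n at
    at-link  : ∀ i → Adjacent G (at i) (at (suc i))
    periodic : ∀ i → at (i + n) ≡ at i

  path : ∀ {M} → suc M ≤ n → Path G M at
  path M<n = record
    { inj  = λ i≤M j≤M → at-inj (≤-trans i≤M M<n) (≤-trans j≤M M<n)
    ; link = λ i _ → at-link i
    }

  degree-Σ : ∀ v → degree G v ≡ Σ< n (λ i → ⟦ adj G v (at i) ⟧)
  degree-Σ v = trans (∣tabulate∣ (adj G v)) (sym (Σ<-injective at-inj (adj G v)))

  position : ∀ v → ∃[ i ] (i < n × at i ≡ v)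
  position = injective⇒surjective at-inj

open Tour

rotate-1 : ∀ {n} {G : Graph n} → Tour G → Tour G
rotate-1 {n} P .at i       = P .at (suc i)
rotate-1 {n} P .at-link i     = P .at-link (suc i)
rotate-1 {n} P .periodic i = P .periodic (suc i)
rotate-1 {suc n} P .at-inj {i} {j} i<1+n j<1+n eq with m≤n⇒m<n∨m≡n (≤-pred i<1+n) | m≤n⇒m<n∨m≡n (≤-pred j<1+n)
... | inj₁ i<n  | inj₁ j<n  = suc-injective (P .at-inj (s≤s i<n) (s≤s j<n) eq)
... | inj₂ refl | inj₂ refl = refl
... | inj₁ i<n  | inj₂ refl = contradiction (P .at-inj (s≤s i<n) (s≤s z≤n) (trans eq (P .periodic 0))) λ ()
... | inj₂ refl | inj₁ j<n  = contradiction (P .at-inj (s≤s j<n) (s≤s z≤n) (trans (sym eq) (P .periodic 0))) λ ()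

rotate : ∀ {n} {G : Graph n} → ℕ → Tour G → Tour G
rotate zero    P = P
rotate (suc k) P = rotate-1 (rotate k P)

rotate-at : ∀ {n} {G : Graph n} k (P : Tour G) i → rotate k P .at i ≡ P .at (k + i)
rotate-at zero    P i = refl
rotate-at (suc k) P i = trans (rotate-at k P (suc i)) (cong (P .at) (+-suc k i))

suc-% : ∀ i M → (suc (i % suc M) < suc M × suc i % suc M ≡ suc (i % suc M)) ⊎ (i % suc M ≡ M × suc i % suc M ≡ 0)
suc-% i M with m≤n⇒m<n∨m≡n (≤-pred (m%n<n i (suc M)))
... | inj₁ r<M = inj₁ (s≤s r<M , trans reduce (m<n⇒m%n≡m (s≤s r<M)))
  where
  reduce : suc i % suc M ≡ suc (i % suc M) % suc M
  reduce = trans (cong (λ j → suc j % suc M) (m≡m%n+[m/n]*n i (suc M))) ([m+kn]%n≡m%n (suc (i % suc M)) (i / suc M) (suc M))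
... | inj₂ r≡M = inj₂ (r≡M , trans reduce (trans (cong (λ r → suc r % suc M) r≡M) (n%n≡0 (suc M))))
  where
  reduce : suc i % suc M ≡ suc (i % suc M) % suc M
  reduce = trans (cong (λ j → suc j % suc M) (m≡m%n+[m/n]*n i (suc M))) ([m+kn]%n≡m%n (suc (i % suc M)) (i / suc M) (suc M))

path⇒tour : ∀ {M} {G : Graph (suc M)} {q} → Path G M q → Adjacent G (q M) (q 0) → Tour G
path⇒tour {M} {G} {q} P closing = record
  { at       = λ i → q (i % suc M)
  ; at-inj   = λ {i} {j} i<n j<n eq → trans (sym (m<n⇒m%n≡m i<n)) (trans
                 (Path.inj P (m%n<n i (suc M)) (m%n<n j (suc M)) eq) (m<n⇒m%n≡m j<n))
  ; at-link  = link-%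
  ; periodic = λ i → cong q ([m+n]%n≡m%n i (suc M))
  }
  where
  link-% : ∀ i → Adjacent G (q (i % suc M)) (q (suc i % suc M))
  link-% i with suc-% i M
  ... | inj₁ (r<M , eq) = subst (λ j → Adjacent G (q (i % suc M)) (q j)) (sym eq) (Path.link P (i % suc M) (≤-pred r<M))
  ... | inj₂ (r≡M , eq) = subst₂ (λ r j → Adjacent G (q r) (q j)) (sym r≡M) (sym eq) closing

path⇒tour-at : ∀ {M} {G : Graph (suc M)} {q} (P : Path G M q) (c : Adjacent G (q M) (q 0)) {i} → i ≤ M →
               path⇒tour P c .at i ≡ q i
path⇒tour-at {q = q} P c i≤M = cong q (m<n⇒m%n≡m (s≤s i≤M))

tour⇒cycle : ∀ {n} {G : Graph n} → Tour G → 3 ≤ n → Cycle G n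
tour⇒cycle {suc M} {G} P 3≤n = close (up (λ i _ → P .at-link i) 0 M ≤-refl) ≤-refl
    (subst (Adjacent G (P .at M)) (P .periodic 0) (P .at-link M)) 3≤n refl
  where open Positions G (P .at) M (P .at-inj)

mod-toℕ : ∀ i M → toℕ (i mod suc M) ≡ i % suc M
mod-toℕ i M = Finₚ.toℕ-fromℕ< (m%n<n i (suc M))

cycle⇒tour : ∀ {n} {G : Graph n} → Cycle G n → Tour G
cycle⇒tour {zero}      C = contradiction (Cycle.3≤length C) λ ()
cycle⇒tour {suc M} {G} C = record
  { at       = λ i → vertex (i mod suc M)
  ; at-inj   = λ {i} {j} i<n j<n eq → trans (sym (m<n⇒m%n≡m i<n)) (trans (sym (mod-toℕ i M))
                 (trans (cong toℕ (distinct eq)) (trans (mod-toℕ j M) (m<n⇒m%n≡m j<n))))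
  ; at-link  = link-mod
  ; periodic = λ i → cong vertex (Finₚ.toℕ-injective
                 (trans (mod-toℕ (i + suc M) M) (trans ([m+n]%n≡m%n i (suc M)) (sym (mod-toℕ i M)))))
  }
  where
  open Cycle C
  link-mod : ∀ i → Adjacent G (vertex (i mod suc M)) (vertex (suc i mod suc M))
  link-mod i with suc-% i M
  ... | inj₁ (_ , eq)   = step _ _ (trans (mod-toℕ (suc i) M) (trans eq (cong suc (sym (mod-toℕ i M)))))
  ... | inj₂ (r≡M , eq) = closing _ _ (cong suc (trans (mod-toℕ i M) r≡M)) (trans (mod-toℕ (suc i) M) eq)

reverse-path : ∀ {n} {G : Graph n} {M q} → Path G M q → Path G M (λ i → q (M ∸ i))
reverse-path {G = G} {M} {q} P = record
  { inj  = λ {i} {j} i≤M j≤M eq → ∸-cancelˡ-≡ (≤-pred i≤M) (≤-pred j≤M)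
             (Path.inj P (s≤s (m∸n≤m M i)) (s≤s (m∸n≤m M j)) eq)
  ; link = λ i i<M → subst (λ j → Adjacent G (q j) (q (M ∸ suc i))) (sym (+-∸-assoc 1 i<M))
             (adjacent-sym G (Path.link P (M ∸ suc i) (≤-trans (≤-reflexive (sym (+-∸-assoc 1 i<M))) (m∸n≤m M i))))
  }

tour-closing : ∀ {M} {G : Graph (suc M)} (P : Tour G) → Adjacent G (P .at M) (P .at 0)
tour-closing {M} {G} P = subst (Adjacent G (P .at M)) (P .periodic 0) (P .at-link M)

reverse-closing : ∀ {M} {G : Graph (suc M)} (P : Tour G) → Adjacent G (P .at (M ∸ M)) (P .at M)
reverse-closing {M} {G} P = subst (λ j → Adjacent G (P .at j) (P .at M)) (sym (n∸n≡0 M)) (adjacent-sym G (tour-closing P))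

reverse : ∀ {M} {G : Graph (suc M)} → Tour G → Tour G
reverse P = path⇒tour (reverse-path (path P ≤-refl)) (reverse-closing P)

Σ<-ends : ∀ N f → Σ< (suc (suc N)) f ≡ f 0 + Σ< N (λ i → f (1 + i)) + f (suc N)
Σ<-ends N f = cong (_+ f (suc N)) (Σ<-split 1 N f)

module _ {N : ℕ} {G : Graph (suc (suc N))} (P : Tour G) where

  private
    a b : ℕ → Bool
    a i = adj G (P .at 0) (P .at i)
    b i = adj G (P .at (suc N)) (P .at i)

  -- The 2 is the edge xy, seen from both of its ends.
  degree-ends : degree G (P .at 0) + degree G (P .at (suc N))
              ≡ 2 + (Σ< N (λ i → ⟦ a (1 + i) ⟧) + Σ< N (λ i → ⟦ b (1 + i) ⟧))
  degree-ends = begin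
      degree G (P .at 0) + degree G (P .at (suc N))
        ≡⟨ cong₂ _+_ (degree-Σ P (P .at 0)) (degree-Σ P (P .at (suc N))) ⟩
      Σ< (suc (suc N)) (⟦_⟧ ∘ a) + Σ< (suc (suc N)) (⟦_⟧ ∘ b)
        ≡⟨ cong₂ _+_ (Σ<-ends N (⟦_⟧ ∘ a)) (Σ<-ends N (⟦_⟧ ∘ b)) ⟩
      ⟦ a 0 ⟧ + A + ⟦ a (suc N) ⟧ + (⟦ b 0 ⟧ + B + ⟦ b (suc N) ⟧)
        ≡⟨ cong₂ _+_ (cong₂ (λ x y → ⟦ x ⟧ + A + ⟦ y ⟧) (adj-irrefl G _) (T⇒true (adjacent-sym G (tour-closing P))))
                     (cong₂ (λ x y → ⟦ x ⟧ + B + ⟦ y ⟧) (T⇒true (tour-closing P)) (adj-irrefl G _)) ⟩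
      A + 1 + (1 + B + 0)
        ≡⟨ reorder A B ⟩
      2 + (A + B) ∎
    where
    open ≡-Reasoning
    A = Σ< N (λ i → ⟦ a (1 + i) ⟧)
    B = Σ< N (λ i → ⟦ b (1 + i) ⟧)
    reorder : ∀ x y → x + 1 + (1 + y + 0) ≡ 2 + (x + y)
    reorder x y = solve (x ∷ y ∷ [])

  tour-missing : ∀ c t → N ≡ suc (c + t) → ¬ Cycle G (3 + c) → Missing c t a b
  tour-missing c t N≡ ¬C = path⇒missing (path P ≤-refl) c t (cong suc N≡) (tour-closing P) ¬C

  missing⇒degree-sum-≤ : ∀ l → 3 ≤ l → l ≤ 2 + N → ¬ Cycle G l → degree G (P .at 0) + degree G (P .at (suc N)) ≤ 2 + N
  missing⇒degree-sum-≤ l 3≤l l≤n ¬C with m≤n⇒∃[o]m+o≡n 3≤l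
  ... | c , refl with m≤n⇒∃[o]m+o≡n l≤n
  ...   | t , refl = ≤-trans (≤-reflexive degree-ends)
            (+-monoʳ-≤ 2 (Counting.Σ≤N (tour-missing c t refl ¬C)))

  missing⇒alternates-ends : ∀ l → 3 ≤ l → l ≤ N → ¬ Cycle G l →
    2 + N ≤ degree G (P .at 0) + degree G (P .at (suc N)) → Alternates N a b
  missing⇒alternates-ends l 3≤l l≤N ¬C n≤deg with m≤n⇒∃[o]m+o≡n 3≤l
  ... | c , refl with m≤n⇒∃[o]m+o≡n l≤N
  -- Here l ≤ n - 2 becomes t = 2 + u, as the classification of the tight case demands.
  ...   | u , refl = subst (λ n → Alternates n a b) (sym N≡) (missing⇒alternates (tour-missing c (2 + u) N≡ ¬C) (s≤s (s≤s z≤n))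
            (subst (λ n → n ≤ Σ< n (λ i → ⟦ a (1 + i) ⟧) + Σ< n (λ i → ⟦ b (1 + i) ⟧)) N≡
              (+-cancelˡ-≤ 2 _ _ (≤-trans n≤deg (≤-reflexive degree-ends)))))
    where
    N≡ : 3 + (c + u) ≡ suc (c + (2 + u))
    N≡ = solve (c ∷ u ∷ [])

-- x is adjacent to the odd positions and y to the even ones; a chord v_p v_q with p and q odd gives
-- the cycles of odd length l: if l ≤ q - p + 1 then x, q, p, p+1, …, p+l-3; if l ≤ q + 2 then
-- x, …, p-1, p, q, q-1, …, p+1, y; otherwise x, 1, …, p, q, …, p+1, y, m, m-1, …, q+2.

module OddChord {n N : ℕ} {q₀ : ℕ → Fin n} {G : Graph n} (P : Path G (suc N) q₀)
  (y~x : Adjacent G (q₀ (suc N)) (q₀ 0)) (N-even : odd N ≡ false)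
  (alt : Alternates N (λ i → adj G (q₀ 0) (q₀ i)) (λ i → adj G (q₀ (suc N)) (q₀ i)))
  {p g : ℕ} (1≤p : 1 ≤ p) (p-odd : odd p ≡ true) (g-even : odd (suc g) ≡ false) (q≤N : p + suc g ≤ N)
  (p~q : Adjacent G (q₀ p) (q₀ (p + suc g))) where

  open Path P
  open Positions G q₀ (suc N) inj

  x~ : ∀ {i} → 1 ≤ i → i ≤ N → odd i ≡ true → E 0 i
  x~ {i} 1≤i i≤N i-odd = true⇒T (trans (proj₁ (alt i 1≤i i≤N)) i-odd)

  ~x : ∀ {i} → 1 ≤ i → i ≤ N → odd i ≡ true → E i 0
  ~x 1≤i i≤N i-odd = adjacent-sym G (x~ 1≤i i≤N i-odd)

  y~ : ∀ {i} → 1 ≤ i → i ≤ N → odd i ≡ false → E (suc N) i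
  y~ {i} 1≤i i≤N i-even = true⇒T (trans (proj₂ (alt i 1≤i i≤N)) (cong not i-even))

  ~y : ∀ {i} → 1 ≤ i → i ≤ N → odd i ≡ false → E i (suc N)
  ~y 1≤i i≤N i-even = adjacent-sym G (y~ 1≤i i≤N i-even)

  q : ℕ
  q = p + suc g

  q-odd : odd q ≡ true
  q-odd = trans (odd-+-even p g-even) p-odd

  p<q : p < q
  p<q = m<m+n p (s≤s z≤n)

  p<N : suc p ≤ N
  p<N = ≤-trans p<q q≤N

  q→p+1 : Trail q (suc p) (suc p) q (suc g)
  q→p+1 = subst (λ j → Trail j (suc p) (suc p) j (suc g)) (sym (+-suc p g))
    (down link (suc p) g (≤-trans (≤-reflexive (sym (+-suc p g))) (m≤n⇒m≤1+n q≤N)))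

  3≤3+ : ∀ {c} → 3 ≤ 3 + c
  3≤3+ = s≤s (s≤s (s≤s z≤n))

  -- The run v_1 ... v_(c+1) starts at a neighbour of x and, c + 1 being even, ends at a neighbour
  -- of y.
  even-cycle : ∀ c → odd c ≡ true → suc c ≤ N → Cycle G (3 + c)
  even-cycle c c-odd 1+c≤N = close
    (one 0 ▷⟨ ≤-refl , x~ ≤-refl (≤-trans (s≤s z≤n) 1+c≤N) refl ⟩ up link 1 c (m≤n⇒m≤1+n 1+c≤N)
      ▷⟨ s≤s 1+c≤N , ~y (s≤s z≤n) 1+c≤N (cong not c-odd) ⟩ one (suc N))
    ≤-refl y~x 3≤3+ (solve (c ∷ []))

  short-cycle : ∀ c → odd c ≡ false → p + c < q → Cycle G (3 + c)
  short-cycle c c-even p+c<q = close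
    (one 0 ▷⟨ 1≤p , x~ (≤-trans 1≤p (<⇒≤ p<q)) q≤N q-odd ⟩
      (one q ◁⟨ p+c<q , adjacent-sym G p~q ⟩ up link p c (≤-trans (<⇒≤ p+c<q) (m≤n⇒m≤1+n q≤N))))
    (m≤n⇒m≤1+n q≤N)
    (~x (≤-trans 1≤p (m≤m+n p c)) (≤-trans (<⇒≤ p+c<q) q≤N) (trans (odd-+-even p c-even) p-odd))
    3≤3+ refl

  p+1-even : odd (suc p) ≡ false
  p+1-even = cong not p-odd

  medium-cycle : ∀ e → odd e ≡ false → e < p → Cycle G (3 + (suc g + e))
  medium-cycle e e-even e<p with m≤n⇒∃[o]m+o≡n e<p
  ... | r , 1+e+r≡p = close
    (one 0 ▷⟨ s≤s z≤n , x~ (s≤s z≤n) (≤-trans (≤-trans (m≤m+n (suc r) e) (≤-reflexive r+e≡p)) (<⇒≤ p<N)) r-odd ⟩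
      subst (λ j → Trail (suc r) j (suc r) j (suc e)) r+e≡p
        (up link (suc r) e (≤-trans (≤-reflexive r+e≡p) (<⇒≤ (m≤n⇒m≤1+n p<N))))
      ▷⟨ ≤-refl , p~q ⟩ q→p+1
      ▷⟨ s≤s q≤N , ~y (s≤s z≤n) p<N p+1-even ⟩ one (suc N))
    ≤-refl y~x 3≤3+ (solve (e ∷ g ∷ []))
    where
    r+e≡p : suc r + e ≡ p
    r+e≡p = trans (cong suc (+-comm r e)) 1+e+r≡p
    r-odd : odd (suc r) ≡ true
    r-odd = trans (sym (odd-+-even (suc r) e-even)) (trans (cong odd r+e≡p) p-odd)

  long-cycle : ∀ f → odd f ≡ true → q + suc f ≤ N → Cycle G (3 + (q + f))
  long-cycle f f-odd q+1+f≤N with m≤n⇒∃[o]m+o≡n 1≤p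
  ... | r , 1+r≡p = close
    ((one 0 ▷⟨ s≤s z≤n , x~ ≤-refl (≤-trans 1≤p (<⇒≤ p<N)) refl ⟩
      subst (λ j → Trail 1 j 1 j (suc r)) 1+r≡p (up link 1 r (≤-trans (≤-reflexive 1+r≡p) (<⇒≤ (m≤n⇒m≤1+n p<N))))
      ▷⟨ ≤-refl , p~q ⟩ q→p+1)
      ▷⟨ m≤n+m (suc q) 1 , ~y (s≤s z≤n) p<N p+1-even ⟩
      (one (suc N) ◁⟨ s≤s m≤N , y~ (s≤s z≤n) m≤N m-even ⟩ down link (2 + q) f (m≤n⇒m≤1+n m≤N)))
    ≤-refl (~x (s≤s z≤n) (≤-trans (m≤m+n (2 + q) f) m≤N) (trans (not-involutive (odd q)) q-odd)) 3≤3+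
    (trans (cong (λ j → 1 + (j + suc g) + (1 + suc f)) 1+r≡p) (reorder p g f))
    where
    reorder : ∀ p g f → 1 + (p + suc g) + (1 + suc f) ≡ 3 + (p + suc g + f)
    reorder p g f = solve (p ∷ g ∷ f ∷ [])
    m-even : odd (2 + q + f) ≡ false
    m-even = trans (not-involutive (odd (q + f))) (trans (odd-+ q f) (cong₂ _xor_ q-odd f-odd))
    -- N is even while q + f + 1 is odd.
    m≤N : 2 + q + f ≤ N
    m≤N = case m≤n⇒m<n∨m≡n q+1+f≤N of λ where
      (inj₁ q+1+f<N) → ≤-trans (≤-reflexive (cong suc (sym (+-suc q f)))) q+1+f<N
      (inj₂ refl)    → ⊥-elim (true≢false
        (trans (odd-+ q (suc f)) (cong₂ (λ x y → x xor not y) q-odd f-odd)) N-even)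

  cycles : ∀ l → 3 ≤ l → l ≤ 2 + N → Cycle G l
  cycles l 3≤l l≤n with m≤n⇒∃[o]m+o≡n 3≤l
  ... | c , refl with odd c in oddc
  ...   | true  = even-cycle c oddc (≤-pred (≤-pred l≤n))
  ...   | false with c <? suc g
  ...     | yes c<1+g = short-cycle c oddc (+-monoʳ-< p c<1+g)
  ...     | no  c≮1+g with m≤n⇒∃[o]m+o≡n (≮⇒≥ c≮1+g)
  ...       | e , refl with e <? p
  ...         | yes e<p = medium-cycle e e-even e<p
    where
    e-even : odd e ≡ false
    e-even = trans (sym (odd-+-even e g-even)) (trans (cong odd (+-comm e (suc g))) oddc)
  ...         | no  e≮p with m≤n⇒∃[o]m+o≡n (≮⇒≥ e≮p)
  ...           | f , refl = subst (Cycle G) (reorder p g f) (long-cycle f f-odd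
                    (≤-trans (≤-reflexive (reorder′ p g f)) (≤-pred (≤-pred l≤n))))
    where
    reorder : ∀ p g f → 3 + (p + suc g + f) ≡ 3 + (suc g + (p + f))
    reorder p g f = solve (p ∷ g ∷ f ∷ [])
    reorder′ : ∀ p g f → p + suc g + suc f ≡ 1 + (suc g + (p + f))
    reorder′ p g f = solve (p ∷ g ∷ f ∷ [])
    f-odd : odd f ≡ true
    f-odd = cancel (odd f) (trans (cong (_xor odd f) (sym q-odd)) (trans (sym (odd-+ q f))
              (trans (cong odd (suc-injective (suc-injective (suc-injective (reorder p g f))))) oddc)))
      where
      cancel : ∀ y → true xor y ≡ false → y ≡ true
      cancel true _ = refl

-- Chords between positions of equal parity

Σ<-odd : ∀ h → Σ< (h * 2) (λ i → ⟦ odd i ⟧) ≡ h × odd (h * 2) ≡ false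
Σ<-odd zero    = refl , refl
Σ<-odd (suc h) with Σ<-odd h
... | Σ≡h , even rewrite even | Σ≡h = trans (+-assoc h 0 1) (+-comm h 1) , refl

Σ<-even : ∀ h → Σ< (h * 2) (λ i → ⟦ not (odd i) ⟧) ≡ h
Σ<-even zero    = refl
Σ<-even (suc h) with Σ<-odd h | Σ<-even h
... | _ , even | Σ≡h rewrite even | Σ≡h = trans (+-assoc h 1 0) (+-comm h 1)

module _ {N h : ℕ} {G : Graph (suc (suc N))} (P : Tour G) (n≡2h : suc (suc N) ≡ h * 2) where

  private
    N-even : odd N ≡ false
    N-even = trans (sym (not-involutive (odd N))) (trans (cong odd n≡2h) (proj₂ (Σ<-odd h)))

    same-parity-count : ∀ x → Σ< (suc (suc N)) (λ j → ⟦ not (x xor odd j) ⟧) ≡ h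
    same-parity-count true  = trans (Σ<-cong (suc (suc N)) (λ j _ → cong ⟦_⟧ (not-involutive (odd j))))
      (trans (cong (λ n → Σ< n (λ j → ⟦ odd j ⟧)) n≡2h) (proj₁ (Σ<-odd h)))
    same-parity-count false = trans (cong (λ n → Σ< n (λ j → ⟦ not (odd j) ⟧)) n≡2h) (Σ<-even h)

    xnor⇒≡ : ∀ x y → not (x xor y) ≡ true → y ≡ x
    xnor⇒≡ true  true  _ = refl
    xnor⇒≡ false false _ = refl

    -- Only h of the n = 2h positions have the parity of i, so h + 1 neighbours cannot all avoid
    -- them.
    chord-from : ∀ i → suc h ≤ degree G (P .at i) →
                 ∃[ j ] (j < suc (suc N) × adj G (P .at i) (P .at j) ≡ true × odd j ≡ odd i)
    chord-from i h<deg =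
      let j , j<n , ij , parity = Σ<-meet (suc (suc N)) (λ j → adj G (P .at i) (P .at j)) (λ j → not (odd i xor odd j)) bound
      in j , j<n , ij , xnor⇒≡ (odd i) (odd j) parity
      where
      double : ∀ h → h * 2 ≡ h + h
      double h = solve (h ∷ [])
      bound : suc (suc N) < Σ< (suc (suc N)) (λ j → ⟦ adj G (P .at i) (P .at j) ⟧)
                          + Σ< (suc (suc N)) (λ j → ⟦ not (odd i xor odd j) ⟧)
      bound = ≤-trans (s≤s (≤-reflexive (trans n≡2h (double h))))
        (h<deg′ ⊕ ≤-reflexive (sym (same-parity-count (odd i))))
        where
        h<deg′ : suc h ≤ Σ< (suc (suc N)) (λ j → ⟦ adj G (P .at i) (P .at j) ⟧)
        h<deg′ = ≤-trans h<deg (≤-reflexive (degree-Σ P (P .at i)))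

    suc-N-odd : odd (suc N) ≡ true
    suc-N-odd = cong not N-even

    odd-cancel : ∀ i j {x} → odd (i + j) ≡ x → odd j ≡ odd i xor x
    odd-cancel i j refl rewrite odd-+ i j with odd i
    ... | true  = sym (not-involutive (odd j))
    ... | false = refl

  module _ (alt : Alternates N (λ i → adj G (P .at 0) (P .at i)) (λ i → adj G (P .at (suc N)) (P .at i))) where

    private
      -- Reversal exchanges x and y and, as N + 1 is odd, also the parities of the positions, so
      -- that an even chord becomes an odd one. `N ∸ N` is what the last index `suc N ∸ suc N`
      -- computes to.
      reversed-alt : Alternates N (λ i → adj G (P .at (suc N)) (P .at (suc N ∸ i)))
                                  (λ i → adj G (P .at (N ∸ N)) (P .at (suc N ∸ i)))
      reversed-alt i 1≤i i≤N =
          trans (proj₂ (alt j 1≤j j≤N)) (trans (cong not j-odd) (not-involutive (odd i)))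
        , trans (cong (λ k → adj G (P .at k) (P .at j)) (n∸n≡0 N)) (trans (proj₁ (alt j 1≤j j≤N)) j-odd)
        where
        j = suc N ∸ i
        j-odd : odd j ≡ not (odd i)
        j-odd = trans (odd-cancel i j (trans (cong odd (m+[n∸m]≡n (m≤n⇒m≤1+n i≤N))) suc-N-odd)) (xor-true (odd i))
          where
          xor-true : ∀ x → x xor true ≡ not x
          xor-true true  = refl
          xor-true false = refl
        1≤j : 1 ≤ j
        1≤j = m<n⇒0<n∸m (s≤s i≤N)
        j≤N : j ≤ N
        j≤N = ∸-monoʳ-≤ (suc N) 1≤i

      odd-chord : ∀ p g → 1 ≤ p → p + suc g ≤ N → odd p ≡ odd (p + suc g) → odd p ≡ true →
                  adj G (P .at p) (P .at (p + suc g)) ≡ true → Pancyclic G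
      odd-chord p g 1≤p q≤N p≡q p-odd pq = OddChord.cycles (path P ≤-refl) (tour-closing P) N-even alt
        1≤p p-odd (trans (odd-cancel p (suc g) (sym p≡q)) (cong (λ x → x xor x) p-odd)) q≤N (true⇒T pq)

      even-chord : ∀ p g → 1 ≤ p → p + suc g ≤ N → odd p ≡ odd (p + suc g) → odd p ≡ false →
                   adj G (P .at p) (P .at (p + suc g)) ≡ true → Pancyclic G
      even-chord p g 1≤p q≤N p≡q p-even pq with m≤n⇒∃[o]m+o≡n (m≤n⇒m≤1+n q≤N)
      ... | r , q+r≡M = OddChord.cycles (reverse-path (path P ≤-refl)) (reverse-closing P) N-even reversed-alt {r} {g}
              1≤r
              (trans (odd-cancel (p + suc g) r (trans (cong odd q+r≡M) suc-N-odd)) (cong (_xor true) (trans (sym p≡q) p-even)))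
              (trans (odd-cancel p (suc g) (sym p≡q)) (cong (λ x → x xor x) p-even))
              (linear (≤-reflexive q+r≡M ⊕ 1≤p) 0 (solve (p ∷ g ∷ r ∷ N ∷ [])))
              (subst₂ (λ i j → Adjacent G (P .at i) (P .at j)) (sym M∸r) (sym M∸[r+1+g])
                (true⇒T (trans (adj-sym G _ _) pq)))
        where
        1≤r : 1 ≤ r
        1≤r = linear (q≤N ⊕ ≤-reflexive (sym q+r≡M)) 0 (solve (p ∷ g ∷ r ∷ N ∷ []))
        M∸r : suc N ∸ r ≡ p + suc g
        M∸r = trans (cong (_∸ r) (sym q+r≡M)) (m+n∸n≡m (p + suc g) r)
        M∸[r+1+g] : suc N ∸ (r + suc g) ≡ p
        M∸[r+1+g] = trans (cong (_∸ (r + suc g)) (trans (sym q+r≡M) (reorder p g r))) (m+n∸n≡m p (r + suc g))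
          where
          reorder : ∀ p g r → p + suc g + r ≡ p + (r + suc g)
          reorder p g r = solve (p ∷ g ∷ r ∷ [])

      chord : ∀ p q → p < q → q < suc (suc N) → adj G (P .at p) (P .at q) ≡ true → odd p ≡ odd q → Pancyclic G
      chord zero q 0<q q<n xq even-q with m≤n⇒m<n∨m≡n (≤-pred q<n)
      ... | inj₁ q≤N  = ⊥-elim (true≢false (trans (sym (proj₁ (alt q 0<q (≤-pred q≤N)))) xq) (sym even-q))
      ... | inj₂ refl = ⊥-elim (true≢false suc-N-odd (sym even-q))
      chord (suc p) q p<q q<n pq p≡q with m≤n⇒m<n∨m≡n (≤-pred q<n)
      ... | inj₂ refl = ⊥-elim (true≢false (trans (adj-sym G _ _) pq)
              (trans (proj₂ (alt (suc p) (s≤s z≤n) (≤-pred p<q))) (cong not (trans p≡q suc-N-odd))))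
      ... | inj₁ q≤N with m≤n⇒∃[o]m+o≡n p<q
      ...   | g , refl = by-parity (odd (suc p)) refl
        where
        q≡ : suc p + suc g ≡ suc (suc (p + g))
        q≡ = +-suc (suc p) g
        q≤N′ : suc p + suc g ≤ N
        q≤N′ = ≤-trans (≤-reflexive q≡) (≤-pred q≤N)
        p≡q′ : odd (suc p) ≡ odd (suc p + suc g)
        p≡q′ = trans p≡q (cong odd (sym q≡))
        pq′ : adj G (P .at (suc p)) (P .at (suc p + suc g)) ≡ true
        pq′ = subst (λ q → adj G (P .at (suc p)) (P .at q) ≡ true) (sym q≡) pq
        by-parity : ∀ x → odd (suc p) ≡ x → Pancyclic G
        by-parity true  p-odd  = odd-chord (suc p) g (s≤s z≤n) q≤N′ p≡q′ p-odd pq′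
        by-parity false p-even = even-chord (suc p) g (s≤s z≤n) q≤N′ p≡q′ p-even pq′

    alternates⇒pancyclic : ∀ v → suc h ≤ degree G v → Pancyclic G
    alternates⇒pancyclic v h<deg =
      let i , i<n , i≡v = position P v
          j , j<n , ij , j≡i = chord-from i (subst (λ v → suc h ≤ degree G v) (sym i≡v) h<deg)
      in ordered i j i<n j<n ij j≡i (<-cmp i j)
      where
      ordered : ∀ i j → i < suc (suc N) → j < suc (suc N) → adj G (P .at i) (P .at j) ≡ true → odd j ≡ odd i →
                Tri (i < j) (i ≡ j) (j < i) → Pancyclic G
      ordered i j i<n j<n ij j≡i (tri< i<j _ _)  = chord i j i<j j<n ij (sym j≡i)
      ordered i j i<n j<n ij j≡i (tri≈ _ refl _) = ⊥-elim (true≢false ij (adj-irrefl G _))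
      ordered i j i<n j<n ij j≡i (tri> _ _ j<i)  = chord j i j<i i<n (trans (adj-sym G _ _) ij) j≡i

-- Cycles of length n − 1

module _ {M : ℕ} {G : Graph (suc (suc M))} (P : Tour G) (2≤M : 2 ≤ M) (¬C : ¬ Cycle G (suc M)) where

  private
    a b : ℕ → Bool
    a i = adj G (P .at 0) (P .at i)
    b i = adj G (P .at M) (P .at i)

    degrees-≤ : degree G (P .at 0) + degree G (P .at M) ≤ 2 + (Σ< (suc M) (⟦_⟧ ∘ a) + Σ< (suc M) (⟦_⟧ ∘ b))
    degrees-≤ = ≤-trans (≤-reflexive (cong₂ _+_ (degree-Σ P (P .at 0)) (degree-Σ P (P .at M))))
      (bound (Σ< (suc M) (⟦_⟧ ∘ a)) (Σ< (suc M) (⟦_⟧ ∘ b)) (⟦⟧≤1 (a (suc M))) (⟦⟧≤1 (b (suc M))))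
      where
      bound : ∀ A B {x y} → x ≤ 1 → y ≤ 1 → A + x + (B + y) ≤ 2 + (A + B)
      bound A B {x} {y} x≤1 y≤1 = linear (x≤1 ⊕ y≤1) 0 (solve (A ∷ B ∷ x ∷ y ∷ []))

  -- The path from position 0 to M contains all vertices but one, and that one adds at most 1 to
  -- each of the two degrees.
  second-neighbour-degrees-≤ : degree G (P .at 0) + degree G (P .at M) ≤ 2 + M
  second-neighbour-degrees-≤ = ≤-trans degrees-≤ (+-monoʳ-≤ 2 (ore-≤ (path P (n≤1+n (suc M))) 2≤M ¬C))

  second-neighbour-tight : 2 + M ≤ degree G (P .at 0) + degree G (P .at M) → ∀ k → k < M → a (suc k) ≡ not (b k)
  second-neighbour-tight n≤deg = ore-tight (path P (n≤1+n (suc M))) 2≤M ¬C (+-cancelˡ-≤ 2 _ _ (≤-trans n≤deg degrees-≤))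

-- The case t = 1, outside the classification above. The pairing ties `a` at k + 2 to `b` at k, and
-- otherwise fixes just a few values near the ends.
module MissingOne {c : ℕ} {G : Graph (4 + c)} (P : Tour G) (¬C : ¬ Cycle G (3 + c))
  (n≤deg : 4 + c ≤ degree G (P .at 0) + degree G (P .at (3 + c))) where

  a b : ℕ → Bool
  a i = adj G (P .at 0) (P .at i)
  b i = adj G (P .at (3 + c)) (P .at i)

  private
    N≡ : 2 + c ≡ suc (c + 1)
    N≡ = cong suc (+-comm 1 c)

    missing : Missing c 1 a b
    missing = tour-missing P c 1 N≡ ¬C

    open Missing missing using (noBB; noAA; b-N)
    open Counting missing
    open Tight (subst (λ n → n ≤ Σ< n (λ i → ⟦ a (1 + i) ⟧) + Σ< n (λ i → ⟦ b (1 + i) ⟧)) N≡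
      (+-cancelˡ-≤ 2 _ _ (≤-trans n≤deg (≤-reflexive (degree-ends P)))))

  a₁ : a 1 ≡ true
  a₁ = Missing.a₁ missing

  b-last : b (2 + c) ≡ true
  b-last = move {b} (sym N≡) b-N

  ¬a₂ : a 2 ≡ false
  ¬a₂ = trans (not-flip (b[i+c] 2 (s≤s z≤n) ≤-refl)) (cong not b-last)

  ¬b₁ : b 1 ≡ false
  ¬b₁ = ≢true λ b₁ → noBB 1 ≤-refl ≤-refl b₁ b-last

  ¬a-last : a (2 + c) ≡ false
  ¬a-last = ≢true (noAA 1 ≤-refl ≤-refl a₁)

  ¬b-penultimate : b (1 + c) ≡ false
  ¬b-penultimate = trans (b[i+c] 1 ≤-refl (s≤s z≤n)) (cong not a₁)

  a[k+2] : ∀ k → 1 ≤ k → k ≤ c → a (2 + k) ≡ not (b k)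
  a[k+2] k 1≤k k≤c = move {a} (+-comm k 2) (a[k+1+t] k 1≤k k≤c)

  a-alternates⇒alternates : odd c ≡ false → (∀ i → 1 ≤ i → i ≤ 2 + c → a i ≡ odd i) → Alternates (2 + c) a b
  a-alternates⇒alternates c-even a≡odd i 1≤i i≤N = a≡odd i 1≤i i≤N , b≡even
    where
    b≡even : b i ≡ not (odd i)
    b≡even with m≤n⇒m<n∨m≡n i≤N
    ... | inj₂ refl = trans b-last (cong not (sym (trans (not-involutive (odd c)) c-even)))
    ... | inj₁ i<N with m≤n⇒m<n∨m≡n (≤-pred i<N)
    ...   | inj₂ refl  = trans ¬b-penultimate (cong (λ x → not (not x)) (sym c-even))
    ...   | inj₁ i<1+c = trans (not-flip (a[k+2] i 1≤i (≤-pred i<1+c)))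
            (cong not (trans (a≡odd (2 + i) (s≤s z≤n) (s≤s (s≤s (≤-pred i<1+c)))) (not-involutive (odd i))))

module MissingThree {c : ℕ} {G : Graph (4 + c)} (P : Tour G) (c-even : odd c ≡ false) (¬C : ¬ Cycle G (3 + c))
  (n≤deg : 4 + c ≤ degree G (P .at 0) + degree G (P .at (3 + c))) where

  open MissingOne P ¬C n≤deg

  private
    2≤2+c : 2 ≤ 2 + c
    2≤2+c = s≤s (s≤s z≤n)

    a₃ : 1 ≤ c → a 3 ≡ true
    a₃ 1≤c = trans (a[k+2] 1 ≤-refl 1≤c) (cong not ¬b₁)

  -- Let `f` be the adjacency of the third vertex v_1. Tightness for the neighbours v_0, v_1 on the
  -- tour gives f (k+3) = not (a (k+1)), tightness for v_1 and v_(n-1) at distance 2 gives f (k+2) =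
  -- not (b (k+1)). Eliminating `f` and `b` leaves a (k+4) = not (a (k+1)), a recursion of step 3
  -- that agrees with parity.
  next⇒alternates : 4 + c ≤ degree G (P .at 1) + degree G (P .at 0) →
                    4 + c ≤ degree G (P .at 1) + degree G (P .at (3 + c)) → Alternates (2 + c) a b
  next⇒alternates n≤deg₀₁ n≤deg₁ = a-alternates⇒alternates c-even a≡odd
    where
    f : ℕ → Bool
    f i = adj G (P .at 1) (P .at i)

    module Next = MissingOne (rotate 1 P) ¬C (subst (λ v → 4 + c ≤ degree G (P .at 1) + degree G v) (sym (P .periodic 0)) n≤deg₀₁)

    f[k+3] : ∀ k → 1 ≤ k → k ≤ c → f (3 + k) ≡ not (a (1 + k))
    f[k+3] k 1≤k k≤c = trans (Next.a[k+2] k 1≤k k≤c) (cong (λ v → not (adj G v (P .at (1 + k)))) (P .periodic 0))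

    f[k+2] : ∀ k → k < 2 + c → f (2 + k) ≡ not (b (1 + k))
    f[k+2] = second-neighbour-tight (rotate 1 P) 2≤2+c ¬C n≤deg₁

    a[k+4] : ∀ k → 1 ≤ k → 2 + k ≤ c → a (4 + k) ≡ not (a (1 + k))
    a[k+4] k 1≤k 2+k≤c = trans (a[k+2] (2 + k) (s≤s z≤n) 2+k≤c)
      (trans (sym (f[k+2] (1 + k) (s≤s (s≤s (≤-trans (m≤n+m k 2) 2+k≤c))))) (f[k+3] k 1≤k (≤-trans (m≤n+m k 2) 2+k≤c)))

    a≡odd : ∀ i → 1 ≤ i → i ≤ 2 + c → a i ≡ odd i
    a≡odd 1 _ _ = a₁
    a≡odd 2 _ _ = ¬a₂
    a≡odd 3 _ (s≤s (s≤s 1≤c)) = a₃ 1≤c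
    a≡odd 4 _ (s≤s (s≤s 2≤c)) = trans (a[k+2] 2 (s≤s z≤n) 2≤c)
      (trans (sym (f[k+2] 1 (s≤s (s≤s z≤n)))) Next.¬a₂)
    a≡odd (suc (suc (suc j@(suc (suc i))))) _ (s≤s (s≤s 3+i≤c)) = trans (a[k+4] (suc i) (s≤s z≤n) 3+i≤c)
      (trans (cong not (a≡odd j (s≤s z≤n) (≤-trans (m≤n+m (2 + i) 1) (≤-trans 3+i≤c (m≤n+m c 2)))))
             (sym (cong not (not-involutive (odd (2 + i))))))

  -- Let `f` be the adjacency of the third vertex v_2. Its distance 2 from v_0 ties `f` to `a`. Its
  -- distance from v_(n-1) is 3, but the chords v_0 v_3 and v_2 v_(n-1) allow v_0 v_1 v_2 to be
  -- turned around, which makes v_2 and v_(n-1) neighbours on another tour and ties `f` to `b`.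
  -- Together with the original pairing this gives a (k+1) = not (a k) from position 4 on.
  skip⇒alternates : 4 + c ≤ degree G (P .at 2) + degree G (P .at 0) →
                    4 + c ≤ degree G (P .at 2) + degree G (P .at (3 + c)) → Alternates (2 + c) a b
  skip⇒alternates n≤deg₀₂ n≤deg₂ = a-alternates⇒alternates c-even a≡odd
    where
    f : ℕ → Bool
    f i = adj G (P .at 2) (P .at i)

    f[k+3] : ∀ k → k < 2 + c → f (3 + k) ≡ not (a (2 + k))
    f[k+3] k k<2+c = trans (second-neighbour-tight (rotate 2 P) 2≤2+c ¬C
        (subst (λ v → 4 + c ≤ degree G (P .at 2) + degree G v) (sym (P .periodic 0)) n≤deg₀₂) k k<2+c)
      (cong (λ v → not (adj G v (P .at (2 + k)))) (P .periodic 0))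

    b₂ : b 2 ≡ true
    b₂ = trans (adj-sym G _ _) (trans (f[k+3] c (s≤s (n≤1+n c))) (cong not ¬a-last))

    -- 2, 1, 0, 3, 4, … is again a Hamiltonian cycle.
    σ : ℕ → ℕ
    σ 0 = 2
    σ 1 = 1
    σ 2 = 0
    σ i = i

    σ-involutive : ∀ i → σ (σ i) ≡ i
    σ-involutive 0 = refl
    σ-involutive 1 = refl
    σ-involutive 2 = refl
    σ-involutive (suc (suc (suc i))) = refl

    σ-bound : ∀ {i} → i < 4 + c → σ i < 4 + c
    σ-bound {0} _ = s≤s (s≤s (s≤s z≤n))
    σ-bound {1} _ = s≤s (s≤s z≤n)
    σ-bound {2} _ = s≤s z≤n
    σ-bound {suc (suc (suc i))} i<n = i<n

    module _ (1≤c : 1 ≤ c) where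

      Q : Path G (3 + c) (P .at ∘ σ)
      Q = record
        { inj  = λ {i} {j} i<n j<n eq → trans (sym (σ-involutive i))
                   (trans (cong σ (P .at-inj (σ-bound i<n) (σ-bound j<n) eq)) (σ-involutive j))
        ; link = links
        }
        where
        links : ∀ i → i < 3 + c → Adjacent G (P .at (σ i)) (P .at (σ (suc i)))
        links 0 _ = adjacent-sym G (P .at-link 1)
        links 1 _ = adjacent-sym G (P .at-link 0)
        links 2 _ = true⇒T (a₃ 1≤c)
        links (suc (suc (suc i))) _ = P .at-link (3 + i)

      Q-closing : Adjacent G (P .at (3 + c)) (P .at 2)
      Q-closing = true⇒T b₂

      Q-at : ∀ {i} → i ≤ 3 + c → path⇒tour Q Q-closing .at i ≡ P .at (σ i)
      Q-at = path⇒tour-at Q Q-closing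

      module Q = MissingOne (path⇒tour Q Q-closing) ¬C
        (subst₂ (λ u v → 4 + c ≤ degree G u + degree G v) (sym (Q-at z≤n)) (sym (Q-at ≤-refl)) n≤deg₂)

      f[k+5] : ∀ k → 3 + k ≤ c → f (5 + k) ≡ not (b (3 + k))
      f[k+5] k 3+k≤c = trans (cong₂ (adj G) (sym (Q-at z≤n)) (sym (Q-at (s≤s (s≤s (≤-trans 3+k≤c (n≤1+n c)))))))
        (trans (Q.a[k+2] (3 + k) (s≤s z≤n) 3+k≤c)
          (cong not (cong₂ (adj G) (Q-at ≤-refl) (Q-at (≤-trans 3+k≤c (m≤n+m c 3))))))

    a≡odd : ∀ i → 1 ≤ i → i ≤ 2 + c → a i ≡ odd i
    a≡odd 1 _ _ = a₁
    a≡odd 2 _ _ = ¬a₂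
    a≡odd 3 _ (s≤s (s≤s 1≤c)) = a₃ 1≤c
    a≡odd 4 _ (s≤s (s≤s 2≤c)) = trans (a[k+2] 2 (s≤s z≤n) 2≤c) (cong not b₂)
    a≡odd (suc j@(suc (suc (suc (suc i))))) _ (s≤s (s≤s 3+i≤c)) = trans (a[k+2] (3 + i) (s≤s z≤n) 3+i≤c)
      (trans (sym (f[k+5] (≤-trans (s≤s z≤n) 3+i≤c) i 3+i≤c))
        (trans (f[k+3] (2 + i) (≤-trans 3+i≤c (m≤n+m c 2)))
          (cong not (a≡odd j (s≤s z≤n) (s≤s (≤-trans 3+i≤c (n≤1+n c)))))))

-- Degree conditions

module _ {n : ℕ} (G : Graph n) where

  atLeast atMost : ℕ → Fin n → Bool
  atLeast k v = k ≤ᵇ degree G v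
  atMost k v = not (atLeast (suc k) v)

  atLeast⁻ : ∀ {k v} → atLeast k v ≡ true → k ≤ degree G v
  atLeast⁻ {k} h = ≤ᵇ⇒≤ k _ (true⇒T h)

  atLeast⁺ : ∀ {k v} → k ≤ degree G v → atLeast k v ≡ true
  atLeast⁺ k≤d = T⇒true (≤⇒≤ᵇ k≤d)

  atMost⁻ : ∀ {k v} → atMost k v ≡ true → degree G v ≤ k
  atMost⁻ {k} {v} h = ≮⇒≥ λ k<d → true≢false h (cong not (atLeast⁺ k<d))

  atMost⁺ : ∀ {k v} → degree G v ≤ k → atMost k v ≡ true
  atMost⁺ {k} {v} d≤k = cong not (≢true (λ h → <-irrefl refl (≤-trans (atLeast⁻ {suc k} {v} h) d≤k)))

  cnt-atLeast : ∀ k → cnt (atLeast (suc k)) + cnt (atMost k) ≡ n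
  cnt-atLeast k = cnt-not (atLeast (suc k))

  -- Chvátal's condition, with n − i written as r.
  Chvátal : Set
  Chvátal = ∀ i r → 1 ≤ i → i < r → i + r ≡ n → i ≤ cnt (atMost i) → suc i ≤ cnt (atLeast r)

  neighbour⇒0<degree : ∀ {u v} → Adjacent G u v → 0 < degree G u
  neighbour⇒0<degree {u} u~v = ≤-trans (cnt-positive (adj G u) (T⇒true u~v)) (≤-reflexive (sym (∣tabulate∣ (adj G u))))

Σ<-exceeds : ∀ n c f → n * c < Σ< n f → ∃[ i ] (i < n × c < f i)
Σ<-exceeds (suc n) c f c+nc<Σ with c <? f n
... | yes c<fn = n , ≤-refl , c<fn
... | no  c≮fn =
  let i , i<n , c<fi = Σ<-exceeds n c f (rest (≮⇒≥ c≮fn)) in i , m<n⇒m<1+n i<n , c<fi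
  where
  rest : f n ≤ c → n * c < Σ< n f
  rest fn≤c = cancel (n * c) (Σ< n f) (f n) c+nc<Σ fn≤c
    where
    cancel : ∀ x y z → c + x < y + z → z ≤ c → x < y
    cancel x y z p q = linear (p ⊕ q) 0 (solve (x ∷ y ∷ z ∷ c ∷ []))

-- Large vertices on a Hamiltonian cycle

module _ {N : ℕ} {G : Graph (suc (suc N))} (P : Tour G) where

  tour-meet : ∀ f g → suc (suc N) < cnt f + cnt g → ∃[ k ] (f (P .at k) ≡ true × g (P .at (suc k)) ≡ true)
  tour-meet f g n<Σ =
    let k , _ , fk , gk = Σ<-meet (suc (suc N)) (f ∘ P .at) (g ∘ P .at ∘ suc)
          (≤-trans n<Σ (≤-reflexive (sym (cong₂ _+_ (Σ<-injective (P .at-inj) f) (Σ<-injective (rotate-1 P .at-inj) g)))))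
    in k , fk , gk

  -- Rotation by k + 1 puts v_k and v_(k+1) into the roles of y and x.
  consecutive : ∀ k → ∃[ Q ] (Tour.at {G = G} Q (suc N) ≡ P .at k × (∀ i → Q .at i ≡ P .at (suc k + i)))
  consecutive k = rotate (suc k) P , trans (rotate-at (suc k) P (suc N))
    (trans (cong (P .at) (sym (+-suc k (suc N)))) (P .periodic k)) , rotate-at (suc k) P

  strict⇒pancyclic : ∀ k → suc (suc (suc N)) ≤ degree G (P .at k) + degree G (P .at (suc k)) → Pancyclic G
  strict⇒pancyclic k n<deg l 3≤l l≤n = decidable-stable (Cycle? G l) λ ¬C →
    let Q , Q-M , Q-at = consecutive k in
    <⇒≱ n<deg (≤-trans (≤-reflexive (trans (+-comm (degree G (P .at k)) _)
        (cong₂ (λ u v → degree G u + degree G v) (sym (trans (Q-at 0) (cong (P .at) (+-identityʳ (suc k))))) (sym Q-M))))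
      (missing⇒degree-sum-≤ Q l 3≤l l≤n ¬C))

module _ {h : ℕ} {G : Graph (suc (suc h) * 2)} {v : Fin (suc (suc h) * 2)} (h<deg : 3 + h ≤ degree G v) where

  private
    c : ℕ
    c = h * 2

    c-even : odd c ≡ false
    c-even = proj₂ (Σ<-odd h)

    n≤ : ∀ {x y} → 2 + h ≤ x → 2 + h ≤ y → 4 + h * 2 ≤ x + y
    n≤ {x} {y} p q = linear (p ⊕ q) 0 (solve (h ∷ x ∷ y ∷ []))

  -- The third large vertex enters at l = n - 1. In every case a missing length l < n forces
  -- alternation, and the chord at v then supplies that very length.
  three-large⇒pancyclic : (Q : Tour G) → 2 + h ≤ degree G (Q .at 0) → 2 + h ≤ degree G (Q .at (3 + c)) →
    2 + h ≤ degree G (Q .at 1) ⊎ 2 + h ≤ degree G (Q .at 2) → Pancyclic G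
  three-large⇒pancyclic Q d₀ d-M third l 3≤l l≤n = decidable-stable (Cycle? G l) λ ¬C →
      ¬C (alternates⇒pancyclic {h = 2 + h} Q refl (alternates ¬C) v h<deg l 3≤l l≤n)
    where
    alternates : ¬ Cycle G l → Alternates (2 + c) (λ i → adj G (Q .at 0) (Q .at i)) (λ i → adj G (Q .at (3 + c)) (Q .at i))
    alternates ¬C with m≤n⇒m<n∨m≡n l≤n
    ... | inj₂ refl = ⊥-elim (¬C (tour⇒cycle Q 3≤l))
    ... | inj₁ l<n with m≤n⇒m<n∨m≡n (≤-pred l<n)
    ...   | inj₁ l<n-1 = missing⇒alternates-ends Q l 3≤l (≤-pred l<n-1) ¬C (n≤ d₀ d-M)
    ...   | inj₂ refl  = [ (λ d₁ → MissingThree.next⇒alternates Q c-even ¬C (n≤ d₀ d-M) (n≤ d₁ d₀) (n≤ d₁ d-M))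
                         , (λ d₂ → MissingThree.skip⇒alternates Q c-even ¬C (n≤ d₀ d-M) (n≤ d₂ d₀) (n≤ d₂ d-M)) ]′ third

  -- Three of some four consecutive vertices have degree at least n / 2.
  many-large⇒pancyclic : Tour G → 3 + h ≤ cnt (atLeast G (2 + h)) → Pancyclic G
  many-large⇒pancyclic P h<cnt =
      let k , _ , 2<B = Σ<-exceeds (4 + c) 2 four exceeds
      in pattern-at k (B k) (B (1 + k)) (B (2 + k)) (B (3 + k)) refl refl refl refl 2<B
    where
    B : ℕ → Bool
    B k = atLeast G (2 + h) (P .at k)
    four : ℕ → ℕ
    four k = ⟦ B k ⟧ + ⟦ B (1 + k) ⟧ + ⟦ B (2 + k) ⟧ + ⟦ B (3 + k) ⟧
    -- Each large vertex lies in four of the n cyclic windows of length four, and 4 (h + 3) > 2 n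
    -- for n = 2h + 4.
    exceeds : (4 + c) * 2 < Σ< (4 + c) four
    exceeds = ≤-trans (linear (h<cnt ⊕ h<cnt ⊕ h<cnt ⊕ h<cnt) 3 (count (cnt (atLeast G (2 + h))) h)) (≤-reflexive (sym
      (trans (Σ<-+ (4 + c) _ _) (cong₂ _+_ (trans (Σ<-+ (4 + c) _ _) (cong₂ _+_
        (trans (Σ<-+ (4 + c) _ _) (cong₂ _+_ (shifted 0) (shifted 1))) (shifted 2))) (shifted 3)))))
      where
      shifted : ∀ r → Σ< (4 + c) (λ k → ⟦ B (r + k) ⟧) ≡ cnt (atLeast G (2 + h))
      shifted r = trans (Σ<-cong (4 + c) (λ k _ → cong (⟦_⟧ ∘ atLeast G (2 + h)) (sym (rotate-at r P k))))
        (Σ<-injective (rotate r P .at-inj) (atLeast G (2 + h)))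
      count : ∀ x h → suc ((4 + h * 2) * 2) + (x + x + x + x) + 3 ≡ x + x + x + x + (3 + h + (3 + h) + (3 + h) + (3 + h))
      count x h = solve (x ∷ h ∷ [])

    large : ∀ {u} {i} → u ≡ P .at i → B i ≡ true → 2 + h ≤ degree G u
    large refl Bi = atLeast⁻ G Bi

    forward : ∀ k → B k ≡ true → B (1 + k) ≡ true → B (2 + k) ≡ true ⊎ B (3 + k) ≡ true → Pancyclic G
    forward k Bk B1 B23 = let Q , Q-M , Q-at = consecutive P k in
      three-large⇒pancyclic Q
        (large (trans (Q-at 0) (cong (P .at) (+-identityʳ (suc k)))) B1) (large Q-M Bk)
        (Sum.map (large (trans (Q-at 1) (cong (P .at) (+-comm (suc k) 1))))
                      (large (trans (Q-at 2) (cong (P .at) (+-comm (suc k) 2)))) B23)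

    -- Read in the opposite direction, the pattern large, small, large, large has its adjacent large
    -- pair first, followed by the third large vertex two places later.
    backward : ∀ k → B k ≡ true → B (2 + k) ≡ true → B (3 + k) ≡ true → Pancyclic G
    backward k Bk B2 B3 = three-large⇒pancyclic (reverse Q)
        (large (trans (reversed 0 z≤n) Q-M) B2)
        (large (trans (reversed (3 + c) ≤-refl) (trans (cong (Q .at) (n∸n≡0 (3 + c)))
          (trans (Q-at 0) (cong (P .at) (+-identityʳ (3 + k)))))) B3)
        (inj₂ (large (trans (reversed 2 (s≤s (s≤s z≤n))) (trans (Q-at (1 + c))
          (trans (cong (P .at) (reorder k c)) (P .periodic k)))) Bk))
      where
      Q = proj₁ (consecutive P (2 + k))
      Q-M = proj₁ (proj₂ (consecutive P (2 + k)))
      Q-at = proj₂ (proj₂ (consecutive P (2 + k)))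
      reversed : ∀ i → i ≤ 3 + c → reverse Q .at i ≡ Q .at (3 + c ∸ i)
      reversed i i≤M = path⇒tour-at (reverse-path (path Q ≤-refl)) (reverse-closing Q) i≤M
      reorder : ∀ k c → 3 + k + (1 + c) ≡ k + (4 + c)
      reorder k c = solve (k ∷ c ∷ [])

    pattern-at : ∀ k x y z w → B k ≡ x → B (1 + k) ≡ y → B (2 + k) ≡ z → B (3 + k) ≡ w →
                 2 < ⟦ x ⟧ + ⟦ y ⟧ + ⟦ z ⟧ + ⟦ w ⟧ → Pancyclic G
    pattern-at k true  true  true  _    Bx By Bz _  _ = forward k Bx By (inj₁ Bz)
    pattern-at k true  true  false true Bx By _  Bw _ = forward k Bx By (inj₂ Bw)
    pattern-at k false true  true  true _  By Bz Bw _ = forward (1 + k) By Bz (inj₁ Bw)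
    pattern-at k true  false true  true Bx _  Bz Bw _ = backward k Bx Bz Bw
    pattern-at k true  true  false false _ _ _ _ (s≤s (s≤s ()))
    pattern-at k true  false true  false _ _ _ _ (s≤s (s≤s ()))
    pattern-at k true  false false true  _ _ _ _ (s≤s (s≤s ()))
    pattern-at k true  false false false _ _ _ _ (s≤s ())
    pattern-at k false true  true  false _ _ _ _ (s≤s (s≤s ()))
    pattern-at k false true  false true  _ _ _ _ (s≤s (s≤s ()))
    pattern-at k false true  false false _ _ _ _ (s≤s ())
    pattern-at k false false true  true  _ _ _ _ (s≤s (s≤s ()))
    pattern-at k false false true  false _ _ _ _ (s≤s ())
    pattern-at k false false false true  _ _ _ _ (s≤s ())
    pattern-at k false false false false _ _ _ _ ()

module _ {h : ℕ} {G : Graph (suc (suc h) * 2)} where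

  private
    c : ℕ
    c = h * 2

  tour-alternates : ∀ (P : Tour G) f → (∀ k → f (P .at k) ≡ true → f (P .at (suc k)) ≡ true → ⊥) →
                    4 + c ≤ cnt f + cnt f → ∀ k → k < 4 + c → f (P .at (suc k)) ≡ not (f (P .at k))
  tour-alternates P f exclusive n≤Σ k k<n = ≡1⇒not (f (P .at k)) (f (P .at (suc k)))
    (Σ<-tight (4 + c) (λ k _ → exclusive⇒≤1 _ _ (exclusive k))
      (≤-trans (≤-reflexive (trans (Σ<-const (4 + c) 1) (*-identityʳ (4 + c)))) (≤-trans n≤Σ (≤-reflexive (sym
        (trans (Σ<-+ (4 + c) _ _) (cong₂ _+_ (Σ<-injective (P .at-inj) f) (Σ<-injective (rotate-1 P .at-inj) f)))))))
      k k<n)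

  -- The large vertices may occupy every second position, so the consecutive pair used for l ≤ n - 2
  -- is supplied separately, by `heavy-edge`.
  half-large⇒pancyclic : (P : Tour G) → 2 + h ≤ cnt (atLeast G (3 + h)) →
    ∃[ k ] 4 + c ≤ degree G (P .at k) + degree G (P .at (suc k)) → Pancyclic G
  half-large⇒pancyclic P h≤cnt (j , n≤deg) l 3≤l l≤n = decidable-stable (Cycle? G l) contra
    where
    large : Fin (4 + c) → Bool
    large = atLeast G (3 + h)

    n< : ∀ {x y} → 3 + h ≤ x → 3 + h ≤ y → 5 + h * 2 ≤ x + y
    n< {x} {y} p q = linear (p ⊕ q) 1 (solve (h ∷ x ∷ y ∷ []))

    start : ∃[ k ] (k < 4 + c × large (P .at k) ≡ true)
    start = Σ<-exists (4 + c) (large ∘ P .at)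
      (≤-trans (≤-trans (s≤s z≤n) h≤cnt) (≤-reflexive (sym (Σ<-injective (P .at-inj) large))))

    R : Tour G
    R = rotate (proj₁ start) P

    T-0 : large (R .at 0) ≡ true
    T-0 = trans (cong large (trans (rotate-at (proj₁ start) P 0) (cong (P .at) (+-identityʳ (proj₁ start)))))
      (proj₂ (proj₂ start))

    contra : ¬ ¬ Cycle G l
    contra ¬C with m≤n⇒m<n∨m≡n l≤n
    ... | inj₂ refl = ¬C (tour⇒cycle P 3≤l)
    ... | inj₁ l<n with m≤n⇒m<n∨m≡n (≤-pred l<n)
    ...   | inj₁ l<n-1 = let Q , Q-M , Q-at = consecutive P j in
            ¬C (alternates⇒pancyclic {h = 2 + h} Q refl
              (missing⇒alternates-ends Q l 3≤l (≤-pred l<n-1) ¬C (≤-trans n≤deg (≤-reflexive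
                (trans (+-comm (degree G (P .at j)) _) (cong₂ (λ u v → degree G u + degree G v)
                  (sym (trans (Q-at 0) (cong (P .at) (+-identityʳ (suc j))))) (sym Q-M))))))
              (R .at 0) (atLeast⁻ G T-0) l 3≤l l≤n)
    -- After rotation by 2, position n - 2 carries v_n = v_0, so the two ends compared are v_2 and
    -- v_0.
    ...   | inj₂ refl  = <⇒≱ (n< (atLeast⁻ G T-2) (atLeast⁻ G T-0)) (≤-trans
              (≤-reflexive (cong (λ v → degree G (R .at 2) + degree G v) (sym (R .periodic 0))))
              (second-neighbour-degrees-≤ (rotate 2 R) (s≤s (s≤s z≤n)) ¬C))
      where
      alternating : ∀ k → k < 4 + c → large (R .at (suc k)) ≡ not (large (R .at k))
      alternating = tour-alternates R large
        (λ k Tk T1+k → ¬C (strict⇒pancyclic R k (n< (atLeast⁻ G Tk) (atLeast⁻ G T1+k)) l 3≤l l≤n))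
        (linear (h≤cnt ⊕ h≤cnt) 0 (reorder h (cnt large)))
        where
        reorder : ∀ h x → 4 + h * 2 + (x + x) + 0 ≡ x + x + (2 + h + (2 + h))
        reorder h x = solve (h ∷ x ∷ [])
      T-2 : large (R .at 2) ≡ true
      T-2 = trans (alternating 1 (s≤s (s≤s z≤n)))
        (trans (cong not (alternating 0 (s≤s z≤n))) (trans (not-involutive (large (R .at 0))) T-0))

-- Large degrees from Chvátal's condition

module _ {N : ℕ} {G : Graph (suc (suc N))} (P : Tour G) (chv : Chvátal G) where

  private
    n : ℕ
    n = suc (suc N)

    no-isolated : 0 < cnt (atMost G 0) → ⊥
    no-isolated 0<cnt =
      let k , isolated , _ = tour-meet P (atMost G 0) (λ _ → true)
            (≤-trans (+-monoˡ-≤ (suc (suc N)) 0<cnt) (≤-reflexive (cong (cnt (atMost G 0) +_) (sym (cnt-true (suc (suc N)))))))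
      in <⇒≱ (neighbour⇒0<degree G (P .at-link k)) (atMost⁻ G isolated)

  -- At least i + 1 vertices have degree at least r. If fewer than n - i vertices have degree at
  -- least i, then more than i have degree at most i - 1, and the condition applies with i - 1; this
  -- descent ends at isolated vertices, which a tour excludes. Otherwise the two counts together
  -- exceed n, and some vertex of the first kind is followed by one of the second.
  heavy-edge : ∀ i r → 1 ≤ i → i < r → i + r ≡ n → i ≤ cnt (atMost G i) →
               ∃[ k ] n ≤ degree G (P .at k) + degree G (P .at (suc k))
  heavy-edge (suc i) r 1≤i i<r i+r≡n i≤cnt with n <? cnt (atLeast G (suc i)) + cnt (atLeast G r)
  ... | yes n<cnt = let k , ik , rk = tour-meet P (atLeast G (suc i)) (atLeast G r) n<cnt in
          k , ≤-trans (≤-reflexive (sym i+r≡n)) (atLeast⁻ G ik ⊕ atLeast⁻ G rk)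
  ... | no  n≮cnt = smaller i 2+i≤cnt i+r≡n i<r
    where
    2+i≤cnt : 2 + i ≤ cnt (atMost G i)
    2+i≤cnt = bound (cnt (atLeast G (suc i))) (≮⇒≥ n≮cnt) (chv (suc i) r 1≤i i<r i+r≡n i≤cnt) (cnt-atLeast G i)
      where
      bound : ∀ x {y z n i} → x + y ≤ n → 2 + i ≤ y → x + z ≡ n → 2 + i ≤ z
      bound x {y} {z} {n} {i} p q e = linear (p ⊕ q ⊕ ≤-reflexive (sym e)) 0 (solve (x ∷ y ∷ z ∷ n ∷ i ∷ []))
    smaller : ∀ i → 2 + i ≤ cnt (atMost G i) → suc i + r ≡ n → suc i < r →
              ∃[ k ] n ≤ degree G (P .at k) + degree G (P .at (suc k))
    smaller zero    2≤cnt   _     _   = ⊥-elim (no-isolated (≤-trans (s≤s z≤n) 2≤cnt))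
    smaller (suc i) 3+i≤cnt i+r≡n i<r = heavy-edge (suc i) (suc r) (s≤s z≤n)
      (≤-trans (n≤1+n (2 + i)) (m≤n⇒m≤1+n i<r)) (trans (+-suc (suc i) r) i+r≡n) (≤-trans (m≤n+m (suc i) 2) 3+i≤cnt)

double-or-odd : ∀ n → ∃[ h ] (n ≡ h * 2 ⊎ n ≡ suc (h * 2))
double-or-odd zero    = 0 , inj₁ refl
double-or-odd (suc n) with double-or-odd n
... | h , inj₁ refl = h , inj₂ refl
... | h , inj₂ refl = suc h , inj₁ refl

tour⇒pancyclic : ∀ {n} {G : Graph n} → 3 ≤ n → Tour G → Chvátal G →
                 (∀ h → n ≡ h * 2 → ∃[ v ] suc h ≤ degree G v) → Pancyclic G
tour⇒pancyclic {n} {G} 3≤n P chv large with double-or-odd n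
... | zero        , inj₁ refl = contradiction 3≤n λ ()
... | suc zero    , inj₁ refl = contradiction 3≤n λ where (s≤s (s≤s ()))
... | zero        , inj₂ refl = contradiction 3≤n λ where (s≤s ())
-- Here n = 2m + 3, and at least m + 2 vertices have degree at least m + 2: by the condition for i =
-- m + 1, or because its premise fails.
... | suc m , inj₂ refl = let k , mk , m1+k = tour-meet P (atLeast G (2 + m)) (atLeast G (2 + m)) (double-< n<) in
        strict⇒pancyclic P k (double-≤ (atLeast⁻ G mk) (atLeast⁻ G m1+k))
  where
  n< : 2 + m ≤ cnt (atLeast G (2 + m))
  n< with suc m ≤? cnt (atMost G (suc m))
  ... | yes m≤cnt = chv (suc m) (2 + m) (s≤s z≤n) ≤-refl (halves m) m≤cnt
    where
    halves : ∀ m → suc m + (2 + m) ≡ suc (suc m * 2)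
    halves m = solve (m ∷ [])
  ... | no  m≰cnt = bound (cnt (atLeast G (2 + m))) (cnt (atMost G (suc m))) m (cnt-atLeast G (suc m)) (≰⇒> m≰cnt)
    where
    bound : ∀ x y m → x + y ≡ suc (suc m * 2) → suc y ≤ suc m → 2 + m ≤ x
    bound x y m e p = linear (≤-reflexive (sym e) ⊕ p) 1 (solve (x ∷ y ∷ m ∷ []))
  double-< : ∀ {x} → 2 + m ≤ x → suc (suc m * 2) < x + x
  double-< {x} p = linear (p ⊕ p) 0 (solve (m ∷ x ∷ []))
  double-≤ : ∀ {x y} → 2 + m ≤ x → 2 + m ≤ y → 2 + suc m * 2 ≤ x + y
  double-≤ {x} {y} p q = linear (p ⊕ q) 0 (solve (m ∷ x ∷ y ∷ []))
... | suc (suc h) , inj₁ refl with suc h ≤? cnt (atMost G (suc h))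
...   | yes h≤cnt = half-large⇒pancyclic P (chv (suc h) (3 + h) (s≤s z≤n) (n≤1+n (2 + h)) (halves h) h≤cnt)
        (heavy-edge P chv (suc h) (3 + h) (s≤s z≤n) (n≤1+n (2 + h)) (halves h) h≤cnt)
  where
  halves : ∀ h → suc h + (3 + h) ≡ suc (suc h) * 2
  halves h = solve (h ∷ [])
...   | no  h≰cnt = many-large⇒pancyclic (proj₂ (large (suc (suc h)) refl)) P
        (bound (cnt (atLeast G (2 + h))) (cnt (atMost G (suc h))) h (cnt-atLeast G (suc h)) (≰⇒> h≰cnt))
  where
  bound : ∀ x y h → x + y ≡ suc (suc h) * 2 → suc y ≤ suc h → 3 + h ≤ x
  bound x y h e p = linear (≤-reflexive (sym e) ⊕ p) 1 (solve (x ∷ y ∷ h ∷ []))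

-- Chvátal's theorem

addEdge : ∀ {n} (G : Graph n) {u v} → u ≢ v → Graph n
addEdge {n} G {u} {v} u≢v = record
  { adj        = λ x y → adj G x y ∨ (new x y ∨ new y x)
  ; adj-sym    = λ x y → cong₂ _∨_ (adj-sym G x y) (∨-comm (new x y) (new y x))
  ; adj-irrefl = λ x → trans (cong (_∨ (new x x ∨ new x x)) (adj-irrefl G x)) (trans (∨-idem (new x x)) (¬new x))
  }
  where
  new : Fin n → Fin n → Bool
  new x y = (x ≡ᵇ u) ∧ (y ≡ᵇ v)
  ¬new : ∀ x → new x x ≡ false
  ¬new x with x Finₚ.≟ u | x Finₚ.≟ v
  ... | no _     | _        = refl
  ... | yes _    | no _     = refl
  ... | yes x≡u  | yes x≡v  = contradiction (trans (sym x≡u) x≡v) u≢v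

module _ {n : ℕ} (G : Graph n) {u v : Fin n} (u≢v : u ≢ v) where

  private
    G⁺ : Graph n
    G⁺ = addEdge G u≢v

  addEdge-⊇ : ∀ x y → adj G x y ≡ true → adj G⁺ x y ≡ true
  addEdge-⊇ x y xy rewrite xy = refl

  addEdge-new : adj G⁺ u v ≡ true
  addEdge-new rewrite ≡ᵇ-refl u | ≡ᵇ-refl v = ∨-zeroʳ (adj G u v)

  addEdge-⊆ : ∀ x y → adj G⁺ x y ≡ true → adj G x y ≡ false → x ≡ u × y ≡ v ⊎ x ≡ v × y ≡ u
  addEdge-⊆ x y xy⁺ ¬xy rewrite ¬xy with x Finₚ.≟ u | y Finₚ.≟ v | y Finₚ.≟ u | x Finₚ.≟ v
  ... | yes x≡u | yes y≡v | _       | _       = inj₁ (x≡u , y≡v)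
  ... | yes _   | no _    | yes y≡u | yes x≡v = inj₂ (x≡v , y≡u)
  ... | no _    | _       | yes y≡u | yes x≡v = inj₂ (x≡v , y≡u)

  degree-⊆ : ∀ x → degree G x ≤ degree G⁺ x
  degree-⊆ x = ≤-trans (≤-reflexive (∣tabulate∣ (adj G x)))
    (≤-trans (cnt-mono (addEdge-⊇ x)) (≤-reflexive (sym (∣tabulate∣ (adj G⁺ x)))))

  -- Larger degrees make the premise harder and the conclusion easier to satisfy.
  addEdge-chvátal : Chvátal G → Chvátal G⁺
  addEdge-chvátal chv i r 1≤i i<r i+r≡n i≤cnt = ≤-trans
    (chv i r 1≤i i<r i+r≡n (≤-trans i≤cnt (cnt-mono (λ x h → atMost⁺ G {i} (≤-trans (degree-⊆ x) (atMost⁻ G⁺ {i} h))))))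
    (cnt-mono (λ x h → atLeast⁺ G⁺ {r} (≤-trans (atLeast⁻ G {r} h) (degree-⊆ x))))

non-edges : ∀ {n} → Graph n → ℕ
non-edges G = ∑ (λ x → cnt (not ∘ adj G x))

addEdge-non-edges : ∀ {n} (G : Graph n) {u v} (u≢v : u ≢ v) → adj G u v ≡ false → non-edges (addEdge G u≢v) < non-edges G
addEdge-non-edges G {u} {v} u≢v ¬uv = ∑-mono-< (λ x → ∑-mono (λ y → fewer x y)) u
    (∑-mono-< (fewer u) v (subst₂ _<_ (cong (⟦_⟧ ∘ not) (sym (addEdge-new G u≢v))) (cong (⟦_⟧ ∘ not) (sym ¬uv)) ≤-refl))
  where
  fewer : ∀ x y → ⟦ not (adj (addEdge G u≢v) x y) ⟧ ≤ ⟦ not (adj G x y) ⟧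
  fewer x y with adj G x y in xy
  ... | true  = z≤n
  ... | false = ⟦⟧≤1 _

-- If the Hamiltonian cycle of G + uv uses uv, it leaves a Hamiltonian path of G from u to v.
addEdge-hamiltonian : ∀ {n} (G : Graph n) {u v} (u≢v : u ≢ v) → n ≤ degree G u + degree G v → 3 ≤ n →
                      Tour (addEdge G u≢v) → Cycle G n
addEdge-hamiltonian {suc M} G {u} {v} u≢v n≤deg 3≤n P = decidable-stable (Cycle? G (suc M)) λ ¬C →
    case anyUpTo? (λ k → adj G (P .at k) (P .at (suc k)) Boolₚ.≟ false) (suc M) of λ where
      (yes (k , _ , ¬e)) → broken ¬C (rotate (suc k) P)
        (trans (cong₂ (adj G) (trans (rotate-at (suc k) P M) (trans (cong (P .at) (sym (+-suc k M))) (P .periodic k)))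
                              (trans (rotate-at (suc k) P 0) (cong (P .at) (+-identityʳ (suc k))))) ¬e)
      (no ¬∃) → ¬C (unbroken λ k k<n → ≢false λ ¬e → ¬∃ (k , k<n , ¬e))
  where
  unbroken : (∀ k → k < suc M → adj G (P .at k) (P .at (suc k)) ≡ true) → Cycle G (suc M)
  unbroken e = close (up (λ i i<M → true⇒T (e i (m<n⇒m<1+n i<M))) 0 M ≤-refl) ≤-refl
      (subst (Adjacent G (P .at M)) (P .periodic 0) (true⇒T (e M ≤-refl))) 3≤n refl
    where open Positions G (P .at) M (P .at-inj)

  broken : ¬ Cycle G (suc M) → (Q : Tour (addEdge G u≢v)) → adj G (Q .at M) (Q .at 0) ≡ false → ⊥
  broken ¬C Q ¬e = <⇒≱ (≤-trans n≤deg (≤-reflexive (degrees ends))) (ore-≤ Q-path (≤-pred 3≤n) ¬C)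
    where
    ends : Q .at M ≡ u × Q .at 0 ≡ v ⊎ Q .at M ≡ v × Q .at 0 ≡ u
    ends = addEdge-⊆ G u≢v _ _ (T⇒true (tour-closing Q)) ¬e

    same-ends : ∀ {x y} → x ≡ u × y ≡ v ⊎ x ≡ v × y ≡ u → x ≡ Q .at M × y ≡ Q .at 0 ⊎ x ≡ Q .at 0 × y ≡ Q .at M
    same-ends h with ends | h
    ... | inj₁ (M≡ , 0≡) | inj₁ (x≡ , y≡) = inj₁ (trans x≡ (sym M≡) , trans y≡ (sym 0≡))
    ... | inj₁ (M≡ , 0≡) | inj₂ (x≡ , y≡) = inj₂ (trans x≡ (sym 0≡) , trans y≡ (sym M≡))
    ... | inj₂ (M≡ , 0≡) | inj₁ (x≡ , y≡) = inj₂ (trans x≡ (sym 0≡) , trans y≡ (sym M≡))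
    ... | inj₂ (M≡ , 0≡) | inj₂ (x≡ , y≡) = inj₁ (trans x≡ (sym M≡) , trans y≡ (sym 0≡))

    Q-path : Path G M (Q .at)
    Q-path = record { inj = Q .at-inj ; link = λ i i<M → true⇒T (≢false λ ¬ei → not-new i i<M ¬ei) }
      where
      not-new : ∀ i → i < M → adj G (Q .at i) (Q .at (suc i)) ≡ false → ⊥
      not-new i i<M ¬ei with same-ends (addEdge-⊆ G u≢v _ _ (T⇒true (Q .at-link i)) ¬ei)
      ... | inj₁ (i≡M , _)   = <-irrefl (Q .at-inj (m<n⇒m<1+n i<M) ≤-refl i≡M) i<M
      -- The new edge joins the ends 0 and M, which are consecutive on the path only if M = 1.
      ... | inj₂ (i≡0 , 1+i≡M) = <-irrefl
              (trans (cong suc (sym (Q .at-inj (m<n⇒m<1+n i<M) (s≤s z≤n) i≡0))) (Q .at-inj (s≤s i<M) ≤-refl 1+i≡M))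
              (≤-pred 3≤n)

    degree-at : ∀ {k x} → Q .at k ≡ x → degree G x ≡ Σ< (suc M) (λ i → ⟦ adj G (Q .at k) (Q .at i) ⟧)
    degree-at {x = x} refl = trans (∣tabulate∣ (adj G x)) (sym (Σ<-injective (Q .at-inj) (adj G x)))

    degrees : Q .at M ≡ u × Q .at 0 ≡ v ⊎ Q .at M ≡ v × Q .at 0 ≡ u → degree G u + degree G v
            ≡ Σ< (suc M) (λ i → ⟦ adj G (Q .at 0) (Q .at i) ⟧) + Σ< (suc M) (λ i → ⟦ adj G (Q .at M) (Q .at i) ⟧)
    degrees (inj₁ (M≡u , 0≡v)) = trans (+-comm (degree G u) _) (cong₂ _+_ (degree-at 0≡v) (degree-at M≡u))
    degrees (inj₂ (M≡v , 0≡u)) = cong₂ _+_ (degree-at 0≡u) (degree-at M≡v)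

module _ {n : ℕ} {G : Graph n} (3≤n : 3 ≤ n) (chv : Chvátal G) where

  private
    others : Fin n → Fin n → Bool
    others v = (not ∘ adj G v) without v

    cnt-others : ∀ v → degree G v + suc (cnt (others v)) ≡ n
    cnt-others v = trans (cong₂ _+_ (∣tabulate∣ (adj G v))
        (trans (cong (λ x → ⟦ not x ⟧ + cnt (others v)) (sym (adj-irrefl G v))) (sym (cnt-without (not ∘ adj G v) v))))
      (cnt-not (adj G v))

    degree-cnt : ∀ v → cnt (adj G v) ≡ degree G v
    degree-cnt v = sym (∣tabulate∣ (adj G v))

    others⁺ : ∀ {v w} → v ≢ w → adj G v w ≡ false → others v w ≡ true
    others⁺ v≢w ¬vw rewrite ¬vw | ≡ᵇ-false (v≢w ∘ sym) = refl

    others⁻ : ∀ {v w} → others v w ≡ true → v ≢ w × adj G v w ≡ false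
    others⁻ {v} {w} h with adj G v w | w Finₚ.≟ v
    others⁻ h | false | no w≢v = w≢v ∘ sym , refl

    ¬adjacent⇒degree< : ∀ {v w} → v ≢ w → adj G v w ≡ false → 2 + degree G v ≤ n
    ¬adjacent⇒degree< {v} {w} v≢w ¬vw = bound (degree G v) (cnt (others v)) (cnt-others v)
      (cnt-positive (others v) (others⁺ v≢w ¬vw))
      where
      bound : ∀ d x → d + suc x ≡ n → 1 ≤ x → 2 + d ≤ n
      bound d x e p = linear (≤-reflexive e ⊕ p) 0 (solve (d ∷ x ∷ n ∷ []))

  -- The step of Chvátal's argument: a non-adjacent pair of maximal degree sum has degree sum ≥ n.
  maximal-non-edge : ∀ u v → u ≢ v → adj G u v ≡ false → degree G u ≤ degree G v → degree G u + degree G v < n →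
    (∀ x y → x ≢ y → adj G x y ≡ false → degree G x + degree G y ≤ degree G u + degree G v) → ⊥
  maximal-non-edge u v u≢v ¬uv du≤dv sum<n maximal = cases (degree G u) refl
    where
    -- Replacing u by another non-neighbour w of v cannot raise the degree sum, so d(w) ≤ d(u).
    -- Since v has n - 1 - d(v) ≥ d(u) non-neighbours, this yields the premise of the condition at i
    -- = d(u).
    others-light : cnt (others v) ≤ cnt (atMost G (degree G u))
    others-light = cnt-mono λ w h → let v≢w , ¬vw = others⁻ h in
      atMost⁺ G (+-cancelʳ-≤ (degree G v) (degree G w) (degree G u)
        (maximal w v (v≢w ∘ sym) (trans (adj-sym G w v) ¬vw)))

    i≤cnt : degree G u ≤ cnt (atMost G (degree G u))
    i≤cnt = ≤-trans (bound (degree G u) (degree G v) (cnt (others v)) (cnt-others v) sum<n) others-light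
      where
      bound : ∀ i d x → d + suc x ≡ n → i + d < n → i ≤ x
      bound i d x e p = linear (p ⊕ ≤-reflexive (sym e)) 0 (solve (i ∷ d ∷ x ∷ n ∷ []))

    heavy-non-neighbour : ∀ r → degree G u < r → degree G u < cnt (atLeast G r) →
                          ∃[ w ] (u ≢ w × adj G u w ≡ false × r ≤ degree G w)
    heavy-non-neighbour r du<r d<cnt =
      let w , ¬uw , rw = cnt-exists (adj G u) (atLeast G r) (≤-trans (s≤s (≤-reflexive (degree-cnt u))) d<cnt)
      in w , (λ u≡w → <⇒≱ du<r (≤-trans (atLeast⁻ G rw) (≤-reflexive (cong (degree G) (sym u≡w))))) , ¬uw , atLeast⁻ G rw

    cases : ∀ i → degree G u ≡ i → ⊥
    -- The condition starts at i = 1, so an isolated u is treated with r = n - 1: some non-neighbour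
    -- of u would have degree n - 1.
    cases zero du≡0 with m≤n⇒∃[o]m+o≡n (≤-trans (s≤s z≤n) 3≤n)
    ... | r , 1+r≡n =
      let w , u≢w , ¬uw , r≤dw = heavy-non-neighbour r (≤-trans (s≤s (≤-reflexive du≡0)) (<⇒≤ 1<r))
            (≤-trans (s≤s (≤-reflexive du≡0)) (<⇒≤ (chv 1 r ≤-refl 1<r 1+r≡n 1≤cnt)))
      in <⇒≱ (¬adjacent⇒degree< (u≢w ∘ sym) (trans (adj-sym G w u) ¬uw)) (≤-trans (≤-reflexive (sym 1+r≡n)) (s≤s r≤dw))
      where
      1<r : 1 < r
      1<r = ≤-pred (≤-trans 3≤n (≤-reflexive (sym 1+r≡n)))
      1≤cnt : 1 ≤ cnt (atMost G 1)
      1≤cnt = cnt-positive (atMost G 1) {u} (atMost⁺ G {1} {u} (≤-trans (≤-reflexive du≡0) z≤n))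
    cases i@(suc _) du≡i with m≤n⇒∃[o]m+o≡n
      (≤-trans (≤-reflexive (sym du≡i)) (≤-trans (m≤m+n (degree G u) (degree G v)) (<⇒≤ sum<n)))
    ... | r , i+r≡n =
      let w , u≢w , ¬uw , r≤dw = heavy-non-neighbour r (≤-trans (s≤s (≤-reflexive du≡i)) i<r)
            (≤-trans (s≤s (≤-reflexive du≡i)) (chv i r (s≤s z≤n) i<r i+r≡n (subst (λ i → i ≤ cnt (atMost G i)) du≡i i≤cnt)))
      in <⇒≱ sum<n (≤-trans (≤-reflexive (sym i+r≡n)) (≤-trans (≤-reflexive (sym du≡i) ⊕ r≤dw) (maximal u w u≢w ¬uw)))
      where
      i<r : i < r
      i<r = bound i (degree G v) r (subst (_≤ degree G v) du≡i du≤dv) (subst (λ j → j + degree G v < n) du≡i sum<n) i+r≡n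
        where
        bound : ∀ i d r → i ≤ d → i + d < n → i + r ≡ n → i < r
        bound i d r p q e = linear (p ⊕ q ⊕ ≤-reflexive (sym e)) 0 (solve (i ∷ d ∷ r ∷ n ∷ []))

  -- No maximum is searched for: `k` bounds how far the degree sum is below n, and a non-edge of
  -- larger sum is refuted by the recursive call, so the present one may be treated as maximal.
  heavy-non-edge : (∀ x y → x ≢ y → adj G x y ≡ false → n ≤ degree G x + degree G y → ⊥) →
                   ∀ x y → x ≢ y → adj G x y ≡ true
  heavy-non-edge none x y x≢y = ≢false λ ¬xy → descend n x y x≢y ¬xy (m≤n+m n _)
    where
    descend : ∀ k x y → x ≢ y → adj G x y ≡ false → n ≤ degree G x + degree G y + k → ⊥
    descend zero    x y x≢y ¬xy n≤ = none x y x≢y ¬xy (≤-trans n≤ (≤-reflexive (+-identityʳ _)))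
    descend (suc k) x y x≢y ¬xy n≤ = ordered (≤-total (degree G x) (degree G y))
      where
      maximal : ∀ x′ y′ → x′ ≢ y′ → adj G x′ y′ ≡ false → degree G x′ + degree G y′ ≤ degree G x + degree G y
      maximal x′ y′ x′≢y′ ¬x′y′ = ≮⇒≥ λ s<s′ → descend k x′ y′ x′≢y′ ¬x′y′
        (≤-trans n≤ (≤-trans (≤-reflexive (+-suc (degree G x + degree G y) k)) (+-monoˡ-≤ k s<s′)))
      sum<n : degree G x + degree G y < n
      sum<n = ≰⇒> (none x y x≢y ¬xy)
      ordered : degree G x ≤ degree G y ⊎ degree G y ≤ degree G x → ⊥
      ordered (inj₁ dx≤dy) = maximal-non-edge x y x≢y ¬xy dx≤dy sum<n maximal
      ordered (inj₂ dy≤dx) = maximal-non-edge y x (x≢y ∘ sym) (trans (adj-sym G y x) ¬xy) dy≤dx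
        (subst (_< n) (+-comm (degree G x) _) sum<n)
        (λ x′ y′ ne ¬e → ≤-trans (maximal x′ y′ ne ¬e) (≤-reflexive (+-comm (degree G x) _)))

complete⇒hamiltonian : ∀ {n} {G : Graph n} → 3 ≤ n → (∀ x y → x ≢ y → adj G x y ≡ true) → Cycle G n
complete⇒hamiltonian 3≤n full = record
  { 3≤length = 3≤n
  ; vertex   = id
  ; distinct = id
  ; step     = λ i j eq → true⇒T (full i j λ { refl → 1+n≢n (sym eq) })
  ; closing  = λ i j last first → true⇒T (full i j λ { refl →
                 <-irrefl (trans (cong suc (sym first)) last) (≤-trans (s≤s (s≤s z≤n)) 3≤n) })
  }

-- The Bondy-Chvátal closure: non-edges of degree sum at least n are added until none is left, and
-- then the condition forces the graph to be complete.
chvátal⇒hamiltonian : ∀ {n} {G : Graph n} → 3 ≤ n → Chvátal G → Cycle G n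
chvátal⇒hamiltonian {n} {G₀} 3≤n chv₀ = go G₀ chv₀ (<-wellFounded (non-edges G₀))
  where
  go : (G : Graph n) → Chvátal G → Acc _<_ (non-edges G) → Cycle G n
  go G chv (acc smaller) with Finₚ.any? (λ u → Finₚ.any? (λ v →
    ¬? (u Finₚ.≟ v) ×-dec (adj G u v Boolₚ.≟ false) ×-dec (n ≤? degree G u + degree G v)))
  ... | yes (u , v , u≢v , ¬uv , n≤deg) = addEdge-hamiltonian G u≢v n≤deg 3≤n (cycle⇒tour
          (go (addEdge G u≢v) (addEdge-chvátal G u≢v chv) (smaller (addEdge-non-edges G u≢v ¬uv))))
  ... | no none = complete⇒hamiltonian 3≤n (heavy-non-edge {G = G} 3≤n chv
          (λ x y x≢y ¬xy n≤deg → none (x , y , x≢y , ¬xy , n≤deg)))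

-- Degree sequences

cnt-splitAt : ∀ m {n} (f : Fin (m + n) → Bool) → cnt f ≡ cnt (λ u → f (u ↑ˡ n)) + cnt (λ v → f (m ↑ʳ v))
cnt-splitAt zero    f = refl
cnt-splitAt (suc m) f = trans (cong (⟦ f zero ⟧ +_) (cnt-splitAt m (f ∘ suc))) (sym (+-assoc ⟦ f zero ⟧ _ _))

cnt-false : ∀ n → cnt {n} (λ _ → false) ≡ 0
cnt-false zero    = refl
cnt-false (suc n) = cnt-false n

cnt-below : ∀ {n} k → cnt {n} (λ j → toℕ j ℕ.<ᵇ k) ≤ k
cnt-below {zero}  k       = z≤n
cnt-below {suc n} zero    = cnt-below {n} zero
cnt-below {suc n} (suc k) = s≤s (cnt-below {n} k)

cnt-const : ∀ n b → cnt {n} (λ _ → b) ≡ (if b then n else 0)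
cnt-const n true  = cnt-true n
cnt-const n false = cnt-false n

degree-< : ∀ {n} (G : Graph n) v → degree G v < n
degree-< G v = ≤-trans (s≤s (≤-reflexive (∣tabulate∣ (adj G v)))) (≤-trans
  (≤-trans (≤-reflexive (+-comm 1 (cnt (adj G v))))
           (+-monoʳ-≤ (cnt (adj G v)) (cnt-positive (not ∘ adj G v) (cong not (adj-irrefl G v)))))
  (≤-reflexive (cnt-not (adj G v))))

degree-complete : ∀ n v → suc (degree (complete n) v) ≡ n
degree-complete n v = begin
    suc (degree (complete n) v)                    ≡⟨ cong suc (∣tabulate∣ (adj (complete n) v)) ⟩
    suc (cnt (λ w → not (v ≡ᵇ w)))                 ≡⟨ cong suc (cnt-cong (λ w → cong not (≡ᵇ-sym v w))) ⟩
    suc (cnt ((λ _ → true) without v))             ≡⟨ cnt-without (λ _ → true) v ⟨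
    cnt {n} (λ _ → true)                           ≡⟨ cnt-true n ⟩
    n                                              ∎
  where
  open ≡-Reasoning
  ≡ᵇ-sym : ∀ {n} (v w : Fin n) → (v ≡ᵇ w) ≡ (w ≡ᵇ v)
  ≡ᵇ-sym v w with v Finₚ.≟ w | w Finₚ.≟ v
  ... | yes _   | yes _   = refl
  ... | no _    | no _    = refl
  ... | yes v≡w | no w≢v  = contradiction (sym v≡w) w≢v
  ... | no v≢w  | yes w≡v = contradiction (sym w≡v) v≢w

degree-edgeless : ∀ n v → degree (edgeless n) v ≡ 0
degree-edgeless n v = trans (∣tabulate∣ (adj (edgeless n) v)) (cnt-false n)

module _ (cross : Bool) {m n : ℕ} (G : Graph m) (H : Graph n) where

  degree-combineˡ : ∀ u → degree (combine cross G H) (u ↑ˡ n) ≡ degree G u + (if cross then n else 0)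
  degree-combineˡ u = begin
      degree (combine cross G H) (u ↑ˡ n)
        ≡⟨ trans (∣tabulate∣ (adj (combine cross G H) (u ↑ˡ n))) (cnt-splitAt m _) ⟩
      cnt (λ w → adj (combine cross G H) (u ↑ˡ n) (w ↑ˡ n)) + cnt (λ w → adj (combine cross G H) (u ↑ˡ n) (m ↑ʳ w))
        ≡⟨ cong₂ _+_ (cnt-cong (λ w → cong₂ (adj⊎ cross G H) (Finₚ.splitAt-↑ˡ m u n) (Finₚ.splitAt-↑ˡ m w n)))
                     (cnt-cong (λ w → cong₂ (adj⊎ cross G H) (Finₚ.splitAt-↑ˡ m u n) (Finₚ.splitAt-↑ʳ m n w))) ⟩
      cnt (adj G u) + cnt {n} (λ _ → cross)
        ≡⟨ cong₂ _+_ (sym (∣tabulate∣ (adj G u))) (cnt-const n cross) ⟩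
      degree G u + (if cross then n else 0) ∎
    where open ≡-Reasoning

  degree-combineʳ : ∀ v → degree (combine cross G H) (m ↑ʳ v) ≡ (if cross then m else 0) + degree H v
  degree-combineʳ v = begin
      degree (combine cross G H) (m ↑ʳ v)
        ≡⟨ trans (∣tabulate∣ (adj (combine cross G H) (m ↑ʳ v))) (cnt-splitAt m _) ⟩
      cnt (λ w → adj (combine cross G H) (m ↑ʳ v) (w ↑ˡ n)) + cnt (λ w → adj (combine cross G H) (m ↑ʳ v) (m ↑ʳ w))
        ≡⟨ cong₂ _+_ (cnt-cong (λ w → cong₂ (adj⊎ cross G H) (Finₚ.splitAt-↑ʳ m n v) (Finₚ.splitAt-↑ˡ m w n)))
                     (cnt-cong (λ w → cong₂ (adj⊎ cross G H) (Finₚ.splitAt-↑ʳ m n v) (Finₚ.splitAt-↑ʳ m n w))) ⟩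
      cnt {m} (λ _ → cross) + cnt (adj H v)
        ≡⟨ cong₂ _+_ (cnt-const m cross) (sym (∣tabulate∣ (adj H v))) ⟩
      (if cross then m else 0) + degree H v ∎
    where open ≡-Reasoning

term-lookup : ∀ {n} (π : Vec ℕ n) k .(1≤k : 1 ≤ k) .(k≤n : k ≤ n) j → suc (toℕ j) ≡ k → term π k 1≤k k≤n ≡ lookup π j
term-lookup π (suc k) _ k<n j eq = cong (lookup π) (Finₚ.toℕ-injective (trans (Finₚ.toℕ-fromℕ< k<n) (sym (suc-injective eq))))

index : ∀ {n} k → 1 ≤ k → k ≤ n → ∃[ j ] suc (toℕ {n} j) ≡ k
index (suc k) _ k<n = fromℕ< k<n , cong suc (Finₚ.toℕ-fromℕ< k<n)

pointwise : ∀ {m n} {R : ℕ → ℕ → Set} (xs : Vec ℕ m) (ys : Vec ℕ n) → m ≡ n →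
            (∀ i j → toℕ i ≡ toℕ j → R (lookup xs i) (lookup ys j)) → Pointwise R xs ys
pointwise []ᵛ       []ᵛ       _  _ = Pointwise.[]
pointwise (x ∷ᵛ xs) (y ∷ᵛ ys) eq h = h zero zero refl Pointwise.∷
  pointwise xs ys (suc-injective eq) (λ i j i≡j → h (suc i) (suc j) (cong suc i≡j))

-- The residues mod n and their images under `σ` both enumerate all vertices, so one sum over
-- positions computes both counts.
cnt-permute : ∀ {n} (σ : Permutation′ n) (f : Fin n → Bool) → cnt (f ∘ (σ ⟨$⟩ʳ_)) ≡ cnt f
cnt-permute {zero}  σ f = refl
cnt-permute {suc M} σ f = trans (sym (Σ<-injective p-inj (f ∘ (σ ⟨$⟩ʳ_))))
    (Σ<-injective (λ i<n j<n eq → p-inj i<n j<n (σ-inj eq)) f)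
  where
  p-inj : InjectiveBelow (suc M) (_mod suc M)
  p-inj {i} {j} i<n j<n eq = trans (sym (m<n⇒m%n≡m i<n)) (trans (sym (mod-toℕ i M))
    (trans (cong toℕ eq) (trans (mod-toℕ j M) (m<n⇒m%n≡m j<n))))
  σ-inj : ∀ {u v} → σ ⟨$⟩ʳ u ≡ σ ⟨$⟩ʳ v → u ≡ v
  σ-inj {u} {v} eq = trans (sym (inverseˡ σ)) (trans (cong (σ ⟨$⟩ˡ_) eq) (inverseˡ σ))

module _ {n : ℕ} {π : Vec ℕ n} {G : Graph n} (D : DegreeSequence G π) where

  private
    sorted : Nondecreasing π
    sorted = proj₁ D

    cnt-index : ∀ f → cnt (λ j → f (lookup π j)) ≡ cnt (λ v → f (degree G v))
    cnt-index f = trans (cnt-cong (λ j → cong f (proj₂ (proj₂ D) j))) (cnt-permute (proj₁ (proj₂ D)) (λ v → f (degree G v)))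

    ≤ᵇ-true : ∀ {x y} → x ≤ y → (x ≤ᵇ y) ≡ true
    ≤ᵇ-true x≤y = T⇒true (≤⇒≤ᵇ x≤y)

  -- If the i-th entry exceeded i, so would all later ones, leaving at most i - 1 entries that do
  -- not.
  entry-≤ : ∀ i j → suc (toℕ j) ≡ i → i ≤ cnt (atMost G i) → lookup π j ≤ i
  entry-≤ i j 1+j≡i i≤cnt = ≮⇒≥ λ i<πj → <⇒≱ (≤-reflexive 1+j≡i) (≤-trans i≤cnt (≤-trans
    (≤-reflexive (sym (cnt-index (λ d → not (suc i ≤ᵇ d)))))
    (≤-trans (cnt-mono (λ k small → below i<πj k small)) (cnt-below {n} (toℕ j)))))
    where
    below : i < lookup π j → ∀ k → not (suc i ≤ᵇ lookup π k) ≡ true → (toℕ k ℕ.<ᵇ toℕ j) ≡ true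
    below i<πj k small = T⇒true (<⇒<ᵇ (≰⇒> λ j≤k → true≢false small
      (cong not (≤ᵇ-true {suc i} (≤-trans i<πj (sorted j k j≤k))))))

  entry-≥ : ∀ i r j → suc (toℕ j) ≡ r → i + r ≡ n → r ≤ lookup π j → suc i ≤ cnt (atLeast G r)
  entry-≥ i r j 1+j≡r i+r≡n r≤πj = ≤-trans bound (≤-trans
      (cnt-mono above) (≤-reflexive (cnt-index (r ≤ᵇ_))))
    where
    above : ∀ k → not (toℕ k ℕ.<ᵇ toℕ j) ≡ true → (r ≤ᵇ lookup π k) ≡ true
    above k h = ≤ᵇ-true {r} (≤-trans r≤πj (sorted j k (≮⇒≥ λ k<j → true≢false h (cong not (T⇒true (<⇒<ᵇ k<j))))))
    bound : suc i ≤ cnt {n} (λ k → not (toℕ k ℕ.<ᵇ toℕ j))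
    bound = arith (toℕ j) (cnt {n} (λ k → toℕ k ℕ.<ᵇ toℕ j)) (cnt-not (λ k → toℕ k ℕ.<ᵇ toℕ j))
      (cnt-below {n} (toℕ j)) (trans (cong (i +_) 1+j≡r) i+r≡n)
      where
      arith : ∀ j x {y} → x + y ≡ n → x ≤ j → i + suc j ≡ n → suc i ≤ y
      arith j x {y} e p e′ = linear (≤-reflexive (sym e) ⊕ p ⊕ ≤-reflexive e′) 0 (solve (j ∷ x ∷ y ∷ n ∷ i ∷ []))

  conditionA⇒chvátal : (∀ i (b : BelowHalf n i) → ConditionA π i b) → Chvátal G
  conditionA⇒chvátal condA i r 1≤i i<r i+r≡n i≤cnt =
      let j , 1+j≡i = index i 1≤i (<⇒≤ i<n)
          k , 1+k≡r = index r (≤-trans (s≤s z≤n) i<r) (≤-trans (m≤n+m r i) (≤-reflexive i+r≡n))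
      in entry-≥ i r k 1+k≡r i+r≡n (subst₂ _≤_ n∸i≡r (term-lookup π (n ∸ i) _ _ k (trans 1+k≡r (sym n∸i≡r)))
           (condA i b (≤-trans (≤-reflexive (term-lookup π i _ _ j 1+j≡i)) (entry-≤ i j 1+j≡i i≤cnt))))
    where
    b : BelowHalf n i
    b = mkBelowHalf 1≤i (≤-trans (s≤s (≤-reflexive (cong (i +_) (+-identityʳ i)))) (≤-trans (+-monoʳ-< i i<r) (≤-reflexive i+r≡n)))
    open BelowHalf b using (i<n)
    n∸i≡r : n ∸ i ≡ r
    n∸i≡r = trans (cong (_∸ i) (sym i+r≡n)) (m+n∸m≡n i r)

  conditionB⇒large : (1≤n : 1 ≤ n) → ConditionB π 1≤n → ∀ h → n ≡ h * 2 → ∃[ v ] suc h ≤ degree G v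
  conditionB⇒large 1≤n condB h n≡2h =
    let j , 1+j≡n = index n 1≤n ≤-refl in
    proj₁ (proj₂ D) ⟨$⟩ʳ j , (begin
      suc h                           ≡⟨ +-comm 1 h ⟩
      h + 1                           ≡⟨ cong (_+ 1) (trans (cong (_/ 2) n≡2h) (m*n/n≡m h 2)) ⟨
      n / 2 + 1                       ≤⟨ condB (divides h n≡2h) ⟩
      term π n 1≤n ≤-refl             ≡⟨ term-lookup π n 1≤n ≤-refl j 1+j≡n ⟩
      lookup π j                      ≡⟨ proj₂ (proj₂ D) j ⟩
      degree G (proj₁ (proj₂ D) ⟨$⟩ʳ j) ∎)
    where open ≤-Reasoning

-- Weak optimality

-- `join` lists the vertices of K_i, those of largest degree, first, whereas a degree sequence has
-- to end with them.
turn : ∀ a b → Permutation (a + b) (b + a)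
turn a b = permutation (Fin.join b a ∘ Sum.swap ∘ splitAt a) (Fin.join a b ∘ Sum.swap ∘ splitAt b)
    (λ x → turned b a x) (λ x → turned a b x)
  where
  turned : ∀ a b x → Fin.join a b (Sum.swap (splitAt b (Fin.join b a (Sum.swap (splitAt a x))))) ≡ x
  turned a b x = trans (cong (Fin.join a b ∘ Sum.swap) (Finₚ.splitAt-join b a (Sum.swap (splitAt a x))))
    (trans (cong (Fin.join a b) (swap-involutive (splitAt a x))) (Finₚ.join-splitAt a b x))

isˡ : ∀ {A B : Set} → A ⊎ B → Bool
isˡ = [ (λ _ → true) , (λ _ → false) ]′

cnt-isˡ : ∀ m n → cnt (λ v → isˡ (splitAt m {n} v)) ≡ m
cnt-isˡ m n = trans (cnt-splitAt m _) (trans (cong₂ _+_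
    (trans (cnt-cong (λ u → cong isˡ (Finₚ.splitAt-↑ˡ m u n))) (cnt-true m))
    (trans (cnt-cong (λ w → cong isˡ (Finₚ.splitAt-↑ʳ m n w))) (cnt-false n)))
  (+-identityʳ m))

-- The graph K_i + (K̄_i ∪ K_m), with the vertices ordered by increasing degree through σ.

module Extremal (i m : ℕ) (1≤i : 1 ≤ i) (1≤m : 1 ≤ m) where

  H : Graph (i + (i + m))
  H = join (complete i) (disjointUnion (edgeless i) (complete m))

  σ : Permutation′ (i + (i + m))
  σ = cast-id (+-comm i (i + m)) ∘ₚ turn (i + m) i

  -- The three plateaus i, n - i - 1 and n - 1 of the degree sequence, for n = i + (i + m);
  -- successors stand in for truncated subtraction.
  data Zone (j d : ℕ) : Set where
    low  : j < i → d ≡ i → Zone j d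
    mid  : i ≤ j → j < i + m → suc d ≡ i + m → Zone j d
    high : i + m ≤ j → suc d ≡ i + (i + m) → Zone j d

  zone : ∀ j → Zone (toℕ j) (degree H (σ ⟨$⟩ʳ j))
  zone j with splitAt (i + m) (Fin.cast (+-comm i (i + m)) j) in eq
  ... | inj₂ y = high
          (≤-trans (m≤m+n (i + m) (toℕ y)) (≤-reflexive (trans (sym (Finₚ.toℕ-↑ʳ (i + m) y))
            (trans (cong toℕ (Finₚ.splitAt⁻¹-↑ʳ eq)) (Finₚ.toℕ-cast (+-comm i (i + m)) j)))))
          (trans (cong suc (degree-combineˡ true (complete i) _ y)) (cong (_+ (i + m)) (degree-complete i y)))
  ... | inj₁ x = within x (trans (sym (Finₚ.toℕ-↑ˡ x i)) (trans (cong toℕ (Finₚ.splitAt⁻¹-↑ˡ eq)) (Finₚ.toℕ-cast (+-comm i (i + m)) j)))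
    where
    within : ∀ x → toℕ x ≡ toℕ j → Zone (toℕ j) (degree H (i ↑ʳ x))
    within x x≡j with splitAt i x in eq
    ... | inj₁ u = low
            (subst (_< i) (trans (sym (Finₚ.toℕ-↑ˡ u m)) (trans (cong toℕ (Finₚ.splitAt⁻¹-↑ˡ eq)) x≡j)) (Finₚ.toℕ<n u))
            (begin
              degree H (i ↑ʳ x)
                ≡⟨ cong (λ x → degree H (i ↑ʳ x)) (Finₚ.splitAt⁻¹-↑ˡ eq) ⟨
              degree H (i ↑ʳ (u ↑ˡ m))
                ≡⟨ degree-combineʳ true (complete i) _ (u ↑ˡ m) ⟩
              i + degree (disjointUnion (edgeless i) (complete m)) (u ↑ˡ m)
                ≡⟨ cong (i +_) (degree-combineˡ false (edgeless i) (complete m) u) ⟩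
              i + (degree (edgeless i) u + 0)
                ≡⟨ cong (λ d → i + (d + 0)) (degree-edgeless i u) ⟩
              i + 0
                ≡⟨ +-identityʳ i ⟩
              i ∎)
      where open ≡-Reasoning
    ... | inj₂ w = mid
            (≤-trans (m≤m+n i (toℕ w)) (≤-reflexive (trans (sym (Finₚ.toℕ-↑ʳ i w)) (trans (cong toℕ (Finₚ.splitAt⁻¹-↑ʳ eq)) x≡j))))
            (subst (_< i + m) x≡j (Finₚ.toℕ<n x))
            (begin
              suc (degree H (i ↑ʳ x))
                ≡⟨ cong (λ x → suc (degree H (i ↑ʳ x))) (Finₚ.splitAt⁻¹-↑ʳ eq) ⟨
              suc (degree H (i ↑ʳ (i ↑ʳ w)))
                ≡⟨ cong suc (degree-combineʳ true (complete i) _ (i ↑ʳ w)) ⟩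
              suc (i + degree (disjointUnion (edgeless i) (complete m)) (i ↑ʳ w))
                ≡⟨ cong (λ d → suc (i + d)) (degree-combineʳ false (edgeless i) (complete m) w) ⟩
              suc (i + degree (complete m) w)
                ≡⟨ +-suc i _ ⟨
              i + suc (degree (complete m) w)
                ≡⟨ cong (i +_) (degree-complete m w) ⟩
              i + m ∎)
      where open ≡-Reasoning

  zone-mono : ∀ {j k d e} → j ≤ k → Zone j d → Zone k e → d ≤ e
  zone-mono j≤k (low _ refl)      (low _ refl)      = ≤-refl
  zone-mono j≤k (low _ refl)      (mid _ _ e≡)      = ≤-pred (≤-trans (m<m+n i 1≤m) (≤-reflexive (sym e≡)))
  zone-mono j≤k (low _ refl)      (high _ e≡)       = ≤-pred (≤-trans (m<m+n i (≤-trans 1≤i (m≤m+n i m))) (≤-reflexive (sym e≡)))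
  zone-mono j≤k (mid i≤j _ _)     (low k<i _)       = contradiction (≤-trans k<i (≤-trans i≤j j≤k)) (<-irrefl refl)
  zone-mono j≤k (mid _ _ d≡)      (mid _ _ e≡)      = ≤-pred (≤-reflexive (trans d≡ (sym e≡)))
  zone-mono j≤k (mid _ _ d≡)      (high _ e≡)       = ≤-pred (≤-trans (≤-reflexive d≡) (≤-trans (m≤n+m (i + m) i) (≤-reflexive (sym e≡))))
  zone-mono j≤k (high i+m≤j _)    (low k<i _)       = contradiction (≤-trans k<i (≤-trans (m≤m+n i m) (≤-trans i+m≤j j≤k))) (<-irrefl refl)
  zone-mono j≤k (high i+m≤j _)    (mid _ k<i+m _)   = contradiction (≤-trans k<i+m (≤-trans i+m≤j j≤k)) (<-irrefl refl)
  zone-mono j≤k (high _ d≡)       (high _ e≡)       = ≤-pred (≤-reflexive (trans d≡ (sym e≡)))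

  degrees : Vec ℕ (i + (i + m))
  degrees = tabulate (λ j → degree H (σ ⟨$⟩ʳ j))

  degrees-lookup : ∀ j → lookup degrees j ≡ degree H (σ ⟨$⟩ʳ j)
  degrees-lookup = Vecₚ.lookup∘tabulate _

  isDegreeSequence : DegreeSequence H degrees
  isDegreeSequence = (λ j k j≤k → subst₂ _≤_ (sym (degrees-lookup j)) (sym (degrees-lookup k)) (zone-mono j≤k (zone j) (zone k)))
    , σ , degrees-lookup

  majorizes : ∀ {n} (π : Vec ℕ n) → i + (i + m) ≡ n → (∀ j → toℕ j < i → lookup π j ≤ i) →
              (∀ j → toℕ j < i + m → lookup π j < i + m) → (∀ j → lookup π j < n) → degrees ≽ π
  majorizes π refl πlow πmid πhigh = pointwise degrees π refl λ j k j≡k →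
      ≤-trans (bound k j≡k (zone j)) (≤-reflexive (sym (degrees-lookup j)))
    where
    bound : ∀ {j d} k → j ≡ toℕ k → Zone j d → lookup π k ≤ d
    bound k refl (low k<i refl)    = πlow k k<i
    bound k refl (mid _ k<i+m d≡)  = ≤-pred (≤-trans (πmid k k<i+m) (≤-reflexive (sym d≡)))
    bound k refl (high _ d≡)       = ≤-pred (≤-trans (πhigh k) (≤-reflexive (sym d≡)))

  inK inI : Fin (i + (i + m)) → Bool
  inK v = isˡ (splitAt i v)
  inI v = [ (λ _ → false) , (λ w → isˡ (splitAt i w)) ]′ (splitAt i v)

  cnt-inK : cnt inK ≡ i
  cnt-inK = cnt-isˡ i (i + m)

  cnt-inI : cnt inI ≡ i
  cnt-inI = trans (cnt-splitAt i inI) (cong₂ _+_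
      (trans (cnt-cong (λ u → cong from (Finₚ.splitAt-↑ˡ i u (i + m)))) (cnt-false i))
      (trans (cnt-cong (λ w → cong from (Finₚ.splitAt-↑ʳ i (i + m) w))) (cnt-isˡ i m)))
    where
    from : Fin i ⊎ Fin (i + m) → Bool
    from = [ (λ _ → false) , (λ w → isˡ (splitAt i w)) ]′

  I~K : ∀ u v → Adjacent H u v → inI u ≡ true → inK v ≡ true
  I~K u v u~v u∈I with splitAt i u | splitAt i v
  ... | inj₂ _ | inj₁ _ = refl
  ... | inj₂ x | inj₂ y with splitAt i x | splitAt i y
  ...   | inj₁ _ | inj₁ _ = ⊥-elim u~v
  ...   | inj₁ _ | inj₂ _ = ⊥-elim u~v

  -- The i vertices of K̄_i and the i vertices of K_i alternate along a Hamiltonian cycle.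
  module _ (P : Tour H) where

    private
      n : ℕ
      n = i + (i + m)

      Σ-shifted : ∀ f → Σ< n (λ k → ⟦ f (P .at (suc k)) ⟧) ≡ cnt f
      Σ-shifted = Σ<-injective (rotate-1 P .at-inj)

      Σ-plain : ∀ f → Σ< n (λ k → ⟦ f (P .at k) ⟧) ≡ cnt f
      Σ-plain = Σ<-injective (P .at-inj)

      ⟦⟧-injective : ∀ {x y} → ⟦ x ⟧ ≡ ⟦ y ⟧ → x ≡ y
      ⟦⟧-injective {true}  {true}  _ = refl
      ⟦⟧-injective {false} {false} _ = refl

    -- `I~K` gives one implication at each position; since both sets have i elements, the sums over
    -- the tour agree and the implication is an equality.
    K-before-I : ∀ k → k < n → inI (P .at (suc k)) ≡ inK (P .at k)
    K-before-I k k<n = ⟦⟧-injective (Σ<-tight n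
      (λ k _ → ⟦⟧-mono (I~K (P .at (suc k)) (P .at k) (adjacent-sym H (P .at-link k))))
      (≤-reflexive (trans (Σ-plain inK) (trans cnt-inK (sym (trans (Σ-shifted inI) cnt-inI))))) k k<n)

  module _ (P : Tour H) (start : inI (P .at 0) ≡ true) where

    I-or-K : ∀ k → k < i + (i + m) → inI (P .at k) ≡ true ⊎ inK (P .at k) ≡ true
    I-or-K zero    _   = inj₁ start
    I-or-K (suc k) k<n with I-or-K k (<⇒≤ k<n)
    ... | inj₁ k∈I = inj₂ (I~K (P .at k) (P .at (suc k)) (P .at-link k) k∈I)
    ... | inj₂ k∈K = inj₁ (trans (K-before-I P k (<⇒≤ k<n)) k∈K)

    tour-absurd : ⊥
    tour-absurd =
      let w , _ = index {m} 1 ≤-refl 1≤m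
          k , k<n , at-k = position P (i ↑ʳ (i ↑ʳ w))
      in [ (λ h → true≢false h (trans (cong inI at-k) (outside-I w)))
         , (λ h → true≢false h (trans (cong inK at-k) (outside-K w))) ]′ (I-or-K k k<n)
      where
      outside-K : ∀ w → inK (i ↑ʳ (i ↑ʳ w)) ≡ false
      outside-K w rewrite Finₚ.splitAt-↑ʳ i (i + m) (i ↑ʳ w) = refl
      outside-I : ∀ w → inI (i ↑ʳ (i ↑ʳ w)) ≡ false
      outside-I w rewrite Finₚ.splitAt-↑ʳ i (i + m) (i ↑ʳ w) | Finₚ.splitAt-↑ʳ i m w = refl

  ¬hamiltonian : ¬ Cycle H (i + (i + m))
  ¬hamiltonian C = tour-absurd (rotate k P)
      (trans (cong inI (trans (rotate-at k P 0) (cong (P .at) (+-identityʳ k)))) k∈I)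
    where
    P = cycle⇒tour C
    start = Σ<-exists (i + (i + m)) (inI ∘ P .at) (≤-trans 1≤i (≤-reflexive (sym (trans (Σ<-injective (P .at-inj) inI) cnt-inI))))
    k = proj₁ start
    k∈I = proj₂ (proj₂ start)

module Balanced (h : ℕ) where

  K : Graph (h + h)
  K = completeBipartite h h

  degree-K : ∀ v → degree K v ≡ h
  degree-K v = by-side (splitAt h v) refl
    where
    by-side : ∀ s → splitAt h v ≡ s → degree K v ≡ h
    by-side (inj₁ u) eq = trans (cong (degree K) (sym (Finₚ.splitAt⁻¹-↑ˡ eq)))
      (trans (degree-combineˡ true (edgeless h) (edgeless h) u) (cong (_+ h) (degree-edgeless h u)))
    by-side (inj₂ w) eq = trans (cong (degree K) (sym (Finₚ.splitAt⁻¹-↑ʳ eq)))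
      (trans (degree-combineʳ true (edgeless h) (edgeless h) w) (trans (cong (h +_) (degree-edgeless h w)) (+-identityʳ h)))

  degrees : Vec ℕ (h + h)
  degrees = tabulate (degree K)

  degrees-lookup : ∀ j → lookup degrees j ≡ h
  degrees-lookup j = trans (Vecₚ.lookup∘tabulate (degree K) j) (degree-K j)

  isDegreeSequence : DegreeSequence K degrees
  isDegreeSequence = (λ j k _ → ≤-reflexive (trans (degrees-lookup j) (sym (degrees-lookup k))))
    , idₚ , Vecₚ.lookup∘tabulate (degree K)

  majorizes : ∀ {n} (π : Vec ℕ n) → h + h ≡ n → (∀ j → lookup π j ≤ h) → degrees ≽ π
  majorizes π h+h≡n π≤h = pointwise degrees π h+h≡n (λ j k _ → ≤-trans (π≤h k) (≤-reflexive (sym (degrees-lookup j))))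

  side : Fin (h + h) → Bool
  side v = isˡ (splitAt h v)

  opposite : ∀ u v → Adjacent K u v → side v ≡ not (side u)
  opposite u v u~v with splitAt h u | splitAt h v
  ... | inj₁ _ | inj₂ _ = refl
  ... | inj₂ _ | inj₁ _ = refl

  triangle-free : ¬ Cycle K 3
  triangle-free C = odd-cycle _ _ _
      (opposite _ _ (step zero (suc zero) refl)) (opposite _ _ (step (suc zero) (suc (suc zero)) refl))
      (opposite _ _ (closing (suc (suc zero)) zero refl refl))
    where
    open Cycle C
    odd-cycle : ∀ x y z → y ≡ not x → z ≡ not y → x ≡ not z → ⊥
    odd-cycle true  _ _ refl refl ()
    odd-cycle false _ _ refl refl ()

module _ {n : ℕ} {π : Vec ℕ n} {G : Graph n} (D : DegreeSequence G π) where

  entry-<n : ∀ j → lookup π j < n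
  entry-<n j = subst (_< n) (sym (proj₂ (proj₂ D) j)) (degree-< G _)

  failing-A : ∀ i (b : BelowHalf n i) → ¬ ConditionA π i b →
    let H = join (complete i) (disjointUnion (edgeless i) (complete (n ∸ 2 * i)))
    in MajorizedByDegreesOf π H × ¬ Cycle H n
  failing-A i b ¬A = (degrees , isDegreeSequence , majorizes π size low-entries mid-entries entry-<n)
      , λ C → ¬hamiltonian (subst (Cycle H) (sym size) C)
    where
    open BelowHalf b
    m : ℕ
    m = n ∸ 2 * i
    open Extremal i m 1≤i (m<n⇒0<n∸m 2i<n)

    size : i + (i + m) ≡ n
    size = trans (reorder i m) (m+[n∸m]≡n (<⇒≤ 2i<n))
      where
      reorder : ∀ i m → i + (i + m) ≡ 2 * i + m
      reorder i m = solve (i ∷ m ∷ [])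

    n∸i≡i+m : n ∸ i ≡ i + m
    n∸i≡i+m = trans (cong (_∸ i) (sym size)) (m+n∸m≡n i (i + m))

    -- The failing implication is classical, so its premise is recovered by stability of ≤. With
    -- d_(n-i) < n - i and monotonicity it bounds the first two blocks of π by the plateaus of
    -- `Zone`.
    dᵢ≤i : term π i 1≤i (<⇒≤ i<n) ≤ i
    dᵢ≤i = decidable-stable (_ ≤? _) λ d≰i → ¬A λ d≤i → contradiction d≤i d≰i

    d[n-i]<n-i : term π (n ∸ i) 1≤n∸i (m∸n≤m n i) < n ∸ i
    d[n-i]<n-i = ≰⇒> λ n-i≤d → ¬A λ _ → n-i≤d

    low-entries : ∀ j → toℕ j < i → lookup π j ≤ i
    low-entries j j<i = let k , 1+k≡i = index i 1≤i (<⇒≤ i<n) in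
      ≤-trans (proj₁ D j k (≤-pred (≤-trans j<i (≤-reflexive (sym 1+k≡i)))))
        (≤-trans (≤-reflexive (sym (term-lookup π i _ _ k 1+k≡i))) dᵢ≤i)

    mid-entries : ∀ j → toℕ j < i + m → lookup π j < i + m
    mid-entries j j<i+m = let k , 1+k≡n-i = index (n ∸ i) 1≤n∸i (m∸n≤m n i) in
      ≤-trans (s≤s (≤-trans (proj₁ D j k (≤-pred (≤-trans j<i+m (≤-reflexive (trans (sym n∸i≡i+m) (sym 1+k≡n-i))))))
        (≤-reflexive (sym (term-lookup π (n ∸ i) _ _ k 1+k≡n-i))))) (≤-trans d[n-i]<n-i (≤-reflexive n∸i≡i+m))

  failing-B : (1≤n : 1 ≤ n) → 3 ≤ n → ¬ ConditionB π 1≤n →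
    let K = completeBipartite (n / 2) (n / 2) in MajorizedByDegreesOf π K × ¬ Pancyclic K
  failing-B 1≤n 3≤n ¬B = (degrees , isDegreeSequence , majorizes π size entries)
      , λ pan → triangle-free (pan 3 ≤-refl (≤-trans 3≤n (≤-reflexive (sym size))))
    where
    open Balanced (n / 2)

    2∣n : 2 ∣ n
    2∣n = decidable-stable (2 ∣? n) λ 2∤n → ¬B λ 2∣n → contradiction 2∣n 2∤n

    size : n / 2 + n / 2 ≡ n
    size with 2∣n
    ... | divides h refl = trans (cong (λ x → x + x) (m*n/n≡m h 2)) (double h)
      where
      double : ∀ h → h + h ≡ h * 2
      double h = solve (h ∷ [])

    dₙ≤n/2 : term π n 1≤n ≤-refl ≤ n / 2
    dₙ≤n/2 = ≤-pred (≤-trans (≰⇒> λ large → ¬B λ _ → large) (≤-reflexive (+-comm (n / 2) 1)))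

    entries : ∀ j → lookup π j ≤ n / 2
    entries j = let k , 1+k≡n = index n 1≤n ≤-refl in
      ≤-trans (proj₁ D j k (≤-pred (≤-trans (Finₚ.toℕ<n j) (≤-reflexive (sym 1+k≡n)))))
        (≤-trans (≤-reflexive (sym (term-lookup π n 1≤n ≤-refl k 1+k≡n))) dₙ≤n/2)

theorem3p5p5 : ∀ {n : ℕ} (π : Vec ℕ n) → Graphical π → (3≤n : 3 ≤ n) →
    ((∀ i (r : BelowHalf n i) → ConditionA π i r) →
    ConditionB π (≤-trans (s≤s z≤n) 3≤n) →
    ∀ (G : Graph n) → DegreeSequence G π → Pancyclic G)
    × (∀ i (r : BelowHalf n i) → ¬ ConditionA π i r →
    let H = join (complete i) (disjointUnion (edgeless i) (complete (n ∸ 2 * i)))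
    in MajorizedByDegreesOf π H × ¬ Cycle H n)
    × (¬ ConditionB π (≤-trans (s≤s z≤n) 3≤n) →
    let K = completeBipartite (n / 2) (n / 2)
    in MajorizedByDegreesOf π K × ¬ Pancyclic K)
theorem3p5p5 π (G₀ , D₀) 3≤n =
    (λ condA condB G D → let chv = conditionA⇒chvátal {G = G} D condA in
      tour⇒pancyclic 3≤n (cycle⇒tour (chvátal⇒hamiltonian 3≤n chv)) chv
        (conditionB⇒large {G = G} D (≤-trans (s≤s z≤n) 3≤n) condB))
  , failing-A {G = G₀} D₀
  , failing-B {G = G₀} D₀ (≤-trans (s≤s z≤n) 3≤n) 3≤n
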